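{- Let $g\in\mathbb Z_{>0}$ and $x=2g+1$. Let $(G,\rho)$ have vertices $v,z,w$, two edges $c_1,c_2$ joining $v$ and $z$, and $x$ edges $f_1,\dots,f_x$ joining $z$ and $w$, where $c_1,c_2$ are consecutive in $\rho_z$ and the restriction of $\rho_z$ to $\{f_1,\dots,f_x\}$ equals $\rho_w$. Let $(G',\rho')$ have the same vertices $v,z,w$, one edge $c$ joining $v$ and $z$, and $2x$ edges $h_1,\dots,h_{2x}$ joining $z$ and $w$, where the restriction of $\rho'_z$ to $\{h_1,\dots,h_{2x}\}$ equals $\rho'_w$. Then: $\operatorname{Pic}^0(G)\cong\operatorname{Pic}^0(G')$; the set $V_{gen}=\{v,w\}$ satisfies Properties 1 and 2 below, so the map $\hat\gamma:\operatorname{Pic}^0(G)\to\operatorname{Pic}^0(G')$ induced by the identity on $V_{gen}$ is an isomorphism; there is a bijection $\varphi:\mathcal T(G)\to\mathcal T(G')$ such that for every vertex $u\in\{v,z,w\}$ and for $\alpha$ either the rotor routing process or the Bernardi process, $\varphi(\alpha_u^{G}(S,T))=\alpha_u^{G'}(\hat\gamma(S),\varphi(T))$ for all $S\in\operatorname{Pic}^0(G)$, $T\in\mathcal T(G)$; and the genus of $(G,\rho)$ is $g$ while the genus of $(G',\rho')$ is $2g$.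
   Context: Graphs are finite, connected, loopless, possibly with multiple edges; $\mathcal T(G)$ is the set of spanning trees. A ribbon graph assigns to each vertex $u$ a cyclic order $\rho_u$ on incident edges. $\operatorname{Pic}^0$ is degree-zero integer chip configurations modulo firings (firing $u$ sends one chip from $u$ along each incident edge); $\operatorname{Pic}^k$ likewise for degree $k$. For graphs $G,G'$ on the same vertex set and $V_{gen}\subseteq V(G)$: Property 1: every element of $\operatorname{Pic}^0(G)$ and of $\operatorname{Pic}^0(G')$ has a representative with no chips outside $V_{gen}$; Property 2: two degree-zero configurations with no chips outside $V_{gen}$ are equivalent in $G$ iff equivalent in $G'$. Then $\hat\gamma(S)$ is the class in $\operatorname{Pic}^0(G')$ of any representative of $S$ supported on $V_{gen}$ (same chip counts). Rotor routing torsor $r_u$: for $S$, $T$, choose a representative of $S$ nonnegative away from $u$; orient $T$ towards $u$ giving each other vertex a rotor; while some vertex $y\ne u$ has positive chips, advance its rotor to the next edge of $\rho_y$ and send a chip along it; when all vertices but $u$ have zero chips, the rotors form $r_u(S,T)$. Bernardi torsor $\beta_u$: with half-edges $(e,y)$, for $T$ start at $(e_0,u)$, $e_0$ a fixed edge at $u$; at $(e',y')$: if $e'\in T$ with other endpoint $y''$, move to $(e'',y'')$ with $e''$ following $e'$ in $\rho_{y''}$; if $e'\notin T$, move to $(\tilde e,y')$ with $\tilde e$ following $e'$ in $\rho_{y'}$, placing a chip on $y'$ if the other half-edge of $e'$ was not yet visited; stop on return to $(e_0,u)$. The resulting divisors $D_T$ of degree $|E|-|V|+1$ are in bijection with $\operatorname{Pic}^{|E|-|V|+1}$,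 and $\beta_u(S,T)$ is the unique $T'$ with $[D_{T'}]=[D_T]+S$. Genus: a cycle is a closed walk which, entering $y$ along $e$, exits along the edge following $e$ in $\rho_y$; the genus $g$ satisfies $2g=2-|V|+|E|-\operatorname{cyc}$, $\operatorname{cyc}$ the number of cycles. -}

module Defs where

open import Level using (0ℓ)
open import Algebra.Bundles using (AbelianGroup)
open import Algebra.Morphism.Structures using (module GroupMorphisms)
import Algebra.Properties.Semiring.Sum as SemiringSum
open import Data.Bool.Base using (Bool; if_then_else_; _∨_)
open import Data.Fin.Base using (Fin; zero; _↑ˡ_; _↑ʳ_; splitAt)
open import Data.Fin.Patterns using (0F; 1F; 2F)
open import Data.Fin.Properties using (_≟_; splitAt-↑ˡ; splitAt-↑ʳ)
import Data.Fin.Subset as Sub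
open import Data.Fin.Subset using (Subset)
open import Data.Fin.Subset.Properties using (_∈?_; ∈⊤)
open import Data.Integer.Base using (ℤ; +_; 0ℤ; 1ℤ; -1ℤ; _+_; _-_; _*_; -_; _≤_; _<_)
import Data.Integer.Properties as ℤ
open import Data.Integer.Tactic.RingSolver using (solve-∀)
open import Data.List.Base using (List; []; _∷_)
import Data.List.Membership.DecPropositional as DecMembership
open import Data.List.Relation.Unary.Unique.Propositional using (Unique)
import Data.Nat.Base as ℕ
open import Data.Nat.Base using (ℕ; NonZero)
open import Data.Nat.GeneralisedArithmetic using (iterate)
open import Data.Product.Base using (Σ; ∃; _×_; _,_; proj₁; proj₂)
open import Data.Product.Properties using (≡-dec)
open import Data.Sum.Base using (_⊎_; inj₁; inj₂; [_,_]′)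
open import Data.Vec.Functional using (Vector; updateAt)
open import Function.Base using (const; _∘_)
open import Function.Bundles using (_⇔_)
open import Relation.Binary.Bundles using (Setoid)
import Relation.Binary.Construct.On as On
open import Relation.Binary.Construct.Closure.ReflexiveTransitive using (Star)
open import Relation.Binary.PropositionalEquality
  using (_≡_; _≢_; refl; sym; trans; cong; cong₂; setoid; module ≡-Reasoning)
open import Relation.Nullary using (¬_; Dec; does)
open import Relation.Nullary.Decidable using (_⊎-dec_)

open SemiringSum ℤ.+-*-semiring using (sum; sum-syntax; sum-cong-≋; sum-replicate-zero; ∑-distrib-+; *-distribˡ-sum)

Joins : ∀ {n m} → (Fin m → Fin n × Fin n) → Fin m → Fin n → Fin n → Set
Joins ends e u y = (ends e ≡ (u , y)) ⊎ (ends e ≡ (y , u))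

-- Walk ends T u y es: a walk from u to y traversing the edges es, in this
-- order, all of them in T.
data Walk {n m} (ends : Fin m → Fin n × Fin n) (T : Subset m)
          : Fin n → Fin n → List (Fin m) → Set where
  []   : ∀ {u} → Walk ends T u u []
  step : ∀ {e u y y′ es} → e Sub.∈ T → Joins ends e u y →
         Walk ends T y y′ es → Walk ends T u y′ (e ∷ es)

Connects : ∀ {n m} → (Fin m → Fin n × Fin n) → Subset m → Set
Connects ends T = ∀ u y → ∃ λ es → Walk ends T u y es

-- The order of the two ends of an edge carries no meaning.
record Graph (n m : ℕ) : Set where
  field
    ends      : Fin m → Fin n × Fin n
    loopless  : ∀ e → proj₁ (ends e) ≢ proj₂ (ends e)
    connected : Connects ends Sub.⊤

open Graph public

module _ {n m} (G : Graph n m) where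

  Incident : Fin m → Fin n → Set
  Incident e u = (proj₁ (ends G e) ≡ u) ⊎ (proj₂ (ends G e) ≡ u)

  incident? : ∀ e u → Dec (Incident e u)
  incident? e u = (proj₁ (ends G e) ≟ u) ⊎-dec (proj₂ (ends G e) ≟ u)

  -- The endpoint of e different from u; meaningful when e is incident to u.
  other : Fin m → Fin n → Fin n
  other e u = if does (proj₁ (ends G e) ≟ u) then proj₂ (ends G e) else proj₁ (ends G e)

  -- A cycle is excluded in the form of a nonempty closed trail.
  Acyclic : Subset m → Set
  Acyclic T = ∀ {u es} → Walk (ends G) T u u es → Unique es → es ≡ []

  SpanningTree : Set
  SpanningTree = Σ (Subset m) λ T → Connects (ends G) T × Acyclic T

  -- Spanning trees are compared as edge sets.
  𝒯 : Setoid 0ℓ 0ℓ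
  𝒯 = On.setoid {B = SpanningTree} (setoid (Subset m)) proj₁

edges : ∀ {n m} {G : Graph n m} → SpanningTree G → Subset m
edges = proj₁

Reaches : {A : Set} → (A → A) → A → A → Set
Reaches σ a b = ∃ λ k → iterate σ a k ≡ b

-- next u is the successor function of the cyclic order at u: a self-map of
-- the finite set of edges incident to u under which any edge reaches any
-- other is a single cycle, in particular a permutation.  The values of
-- next u on edges not incident to u carry no meaning.
record Ribbon {n m} (G : Graph n m) : Set where
  field
    next   : Fin n → Fin m → Fin m
    stays  : ∀ {u e} → Incident G e u → Incident G (next u e) u
    cyclic : ∀ {u e e′} → Incident G e u → Incident G e′ u → Reaches (next u) e e′

open Ribbon public

-- FirstReturn P σ e e′: e′ is the first of σ e, σ (σ e), ... satisfying P.
data FirstReturn {A : Set} (P : A → Set) (σ : A → A) (e : A) : A → Set where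
  here  : P (σ e) → FirstReturn P σ e (σ e)
  there : ∀ {e′} → ¬ P (σ e) → FirstReturn P σ (σ e) e′ → FirstReturn P σ e e′

-- The cyclic order induced by σ on the set P is τ.
RestrictsTo : {A : Set} → (P : A → Set) → (σ τ : A → A) → Set
RestrictsTo P σ τ = ∀ e → P e → FirstReturn P σ e (τ e)

Consecutive : {A : Set} → (A → A) → A → A → Set
Consecutive σ a b = (σ a ≡ b) ⊎ (σ b ≡ a)

Chips : ℕ → Set
Chips n = Vector ℤ n

degree : ∀ {n} → Chips n → ℤ
degree D = sum D

Div⁰ : ℕ → Set
Div⁰ n = Σ (Chips n) λ D → degree D ≡ 0ℤ

chip : ∀ {n} → Fin n → Chips n
chip u y = if does (u ≟ y) then 1ℤ else 0ℤ

_⊕_ : ∀ {n} → Chips n → Chips n → Chips n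
(D ⊕ D′) y = D y + D′ y

module _ {n m} (G : Graph n m) where

  sending : Fin n → Fin m → Chips n
  sending u e y = chip (other G e u) y - chip u y

  -- The change to a configuration when u fires; loops being excluded, each
  -- incident edge carries exactly one chip away.
  firing : Fin n → Chips n
  firing u y = ∑[ e < m ] (if does (incident? G e u) then sending u e y else 0ℤ)

  -- Equality modulo the subgroup generated by the firings.
  _⊢_∼_ : Chips n → Chips n → Set
  _⊢_∼_ D D′ = ∃ λ (s : Fin n → ℤ) → ∀ y → D′ y ≡ D y + ∑[ u < n ] (s u * firing u y)

module _ {n m} (G : Graph n m) where

  private
    F : (Fin n → ℤ) → Fin n → ℤ
    F s y = ∑[ u < n ] (s u * firing G u y)

    F-0 : ∀ y → F (const 0ℤ) y ≡ 0ℤ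
    F-0 y = trans (sum-cong-≋ {n} (λ u → ℤ.*-zeroˡ (firing G u y))) (sum-replicate-zero n)

    F-+ : ∀ s t y → F (s ⊕ t) y ≡ F s y + F t y
    F-+ s t y = trans
      (sum-cong-≋ {n} (λ u → ℤ.*-distribʳ-+ (firing G u y) (s u) (t u)))
      (∑-distrib-+ {n} (λ u → s u * firing G u y) (λ u → t u * firing G u y))

    sum-neg : (f : Chips n) → sum (λ y → - f y) ≡ - sum f
    sum-neg f = begin
      sum (λ y → - f y)      ≡⟨ sum-cong-≋ {n} (λ y → sym (ℤ.-1*i≡-i (f y))) ⟩
      sum (λ y → -1ℤ * f y)  ≡⟨ sym (*-distribˡ-sum {n} -1ℤ f) ⟩
      -1ℤ * sum f            ≡⟨ ℤ.-1*i≡-i (sum f) ⟩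
      - sum f                ∎
      where open ≡-Reasoning

    F-neg : ∀ s y → F (λ u → - s u) y ≡ - F s y
    F-neg s y = trans
      (sum-cong-≋ {n} (λ u → sym (ℤ.neg-distribˡ-* (s u) (firing G u y))))
      (sum-neg (λ u → s u * firing G u y))

    _≈_ : Div⁰ n → Div⁰ n → Set
    D ≈ D′ = _⊢_∼_ G (proj₁ D) (proj₁ D′)

    ≗⇒∼ : ∀ {D D′ : Chips n} → (∀ y → D′ y ≡ D y) → _⊢_∼_ G D D′
    ≗⇒∼ {D} eq = const 0ℤ , λ y → trans (eq y)
      (sym (trans (cong (λ i → D y + i) (F-0 y)) (ℤ.+-identityʳ (D y))))

    ∼-sym : ∀ {D D′ : Chips n} → _⊢_∼_ G D D′ → _⊢_∼_ G D′ D
    ∼-sym {D} {D′} (s , eq) = (λ u → - s u) , λ y →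
      trans (lem (D y) (F s y)) (cong₂ _+_ (sym (eq y)) (sym (F-neg s y)))
      where
      lem : ∀ a b → a ≡ (a + b) + - b
      lem = solve-∀

    ∼-trans : ∀ {D D′ D″ : Chips n} → _⊢_∼_ G D D′ → _⊢_∼_ G D′ D″ → _⊢_∼_ G D D″
    ∼-trans {D} (s , p) (t , q) = (s ⊕ t) , λ y → trans (q y)
      (trans (cong (_+ F t y) (p y))
      (trans (ℤ.+-assoc (D y) (F s y) (F t y)) (cong (λ i → D y + i) (sym (F-+ s t y)))))

    _∙_ : Div⁰ n → Div⁰ n → Div⁰ n
    (D , p) ∙ (D′ , p′) = (D ⊕ D′) , trans (∑-distrib-+ {n} D D′) (cong₂ _+_ p p′)

    ε : Div⁰ n
    ε = const 0ℤ , sum-replicate-zero n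

    _⁻¹ : Div⁰ n → Div⁰ n
    (D , p) ⁻¹ = (λ y → - D y) , trans (sum-neg D) (cong -_ p)

    ∙-cong : ∀ {A B C D} → A ≈ B → C ≈ D → (A ∙ C) ≈ (B ∙ D)
    ∙-cong {A} {_} {C} (s , p) (t , q) = (s ⊕ t) , λ y → trans (cong₂ _+_ (p y) (q y))
      (trans (lem (proj₁ A y) (F s y) (proj₁ C y) (F t y))
             (cong (λ i → (proj₁ A y + proj₁ C y) + i) (sym (F-+ s t y))))
      where
      lem : ∀ a b c d → (a + b) + (c + d) ≡ (a + c) + (b + d)
      lem = solve-∀

    ⁻¹-cong : ∀ {A B} → A ≈ B → (A ⁻¹) ≈ (B ⁻¹)
    ⁻¹-cong {A} (s , p) = (λ u → - s u) , λ y → trans (cong -_ (p y))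
      (trans (ℤ.neg-distrib-+ (proj₁ A y) (F s y)) (cong (λ i → - proj₁ A y + i) (sym (F-neg s y))))

  Pic⁰ : AbelianGroup 0ℓ 0ℓ
  Pic⁰ = record
    { Carrier = Div⁰ n
    ; _≈_ = _≈_
    ; _∙_ = _∙_
    ; ε   = ε
    ; _⁻¹ = _⁻¹
    ; isAbelianGroup = record
      { isGroup = record
        { isMonoid = record
          { isSemigroup = record
            { isMagma = record
              { isEquivalence = record
                { refl = ≗⇒∼ (λ _ → refl)
                ; sym = λ {A} {B} → ∼-sym {proj₁ A} {proj₁ B}
                ; trans = λ {A} {B} {C} → ∼-trans {proj₁ A} {proj₁ B} {proj₁ C} }
              ; ∙-cong = λ {A} {B} {C} {D} → ∙-cong {A} {B} {C} {D} }
            ; assoc = λ A B C → ≗⇒∼ (λ y → sym (ℤ.+-assoc (proj₁ A y) (proj₁ B y) (proj₁ C y))) }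
          ; identity = (λ A → ≗⇒∼ (λ y → sym (ℤ.+-identityˡ (proj₁ A y))))
                     , (λ A → ≗⇒∼ (λ y → sym (ℤ.+-identityʳ (proj₁ A y)))) }
        ; inverse = (λ A → ≗⇒∼ (λ y → sym (ℤ.+-inverseˡ (proj₁ A y))))
                  , (λ A → ≗⇒∼ (λ y → sym (ℤ.+-inverseʳ (proj₁ A y))))
        ; ⁻¹-cong = λ {A} {B} → ⁻¹-cong {A} {B} }
      ; comm = λ A B → ≗⇒∼ (λ y → ℤ.+-comm (proj₁ B y) (proj₁ A y)) } }

module _ (A B : AbelianGroup 0ℓ 0ℓ) where
  private
    module A = AbelianGroup A
    module B = AbelianGroup B

  IsIsomorphism : (A.Carrier → B.Carrier) → Set
  IsIsomorphism = GroupMorphisms.IsGroupIsomorphism A.rawGroup B.rawGroup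

  _≅_ : Set
  _≅_ = ∃ IsIsomorphism

SupportedOn : ∀ {n} → Subset n → Div⁰ n → Set
SupportedOn U (D , _) = ∀ y → y Sub.∉ U → D y ≡ 0ℤ

module _ {n m m′} (G : Graph n m) (G′ : Graph n m′) (U : Subset n) where
  private
    module P  = AbelianGroup (Pic⁰ G)
    module P′ = AbelianGroup (Pic⁰ G′)

  Property1 : Set
  Property1 = (∀ S → ∃ λ D → SupportedOn U D × S P.≈ D)
            × (∀ S → ∃ λ D → SupportedOn U D × S P′.≈ D)

  Property2 : Set
  Property2 = ∀ D D′ → SupportedOn U D → SupportedOn U D′ → (D P.≈ D′) ⇔ (D P′.≈ D′)

  InducedByIdentity : (P.Carrier → P′.Carrier) → Set
  InducedByIdentity γ = ∀ S D → SupportedOn U D → S P.≈ D → γ S P′.≈ D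

-- An action of Pic⁰ on spanning trees is given by its graph: α S T T′ says
-- that the procedure can turn S and T into T′, for some choice of whatever
-- it leaves free.

Action : ∀ {n m} → Graph n m → Set₁
Action {n} G = Div⁰ n → SpanningTree G → SpanningTree G → Set

-- α(S , T) is well defined, and equal to T′.
IsValue : ∀ {n m} (G : Graph n m) → Action G → Div⁰ n → SpanningTree G → SpanningTree G → Set
IsValue G α S T T′ = α S T T′ × (∀ T″ → α S T T″ → Setoid._≈_ (𝒯 G) T′ T″)

-- φ(α(S , T)) = α′(γ(S) , φ(T)), both values being well defined.
Intertwines : ∀ {n m m′} (G : Graph n m) (G′ : Graph n m′) →
              (Div⁰ n → Div⁰ n) → (SpanningTree G → SpanningTree G′) →
              Action G → Action G′ → Set
Intertwines G G′ γ φ α α′ = ∀ S T → ∃ λ T′ →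
  IsValue G α S T T′ × IsValue G′ α′ (γ S) (φ T) (φ T′)

module _ {n m} {G : Graph n m} (R : Ribbon G) where

  -- The rotor at the sink carries no meaning.
  Rotors : Set
  Rotors = Vector (Fin m) n

  OrientedTowards : Fin n → SpanningTree G → Rotors → Set
  OrientedTowards u T rot = ∀ y → y ≢ u → ∃ λ es →
    Walk (ends G) (edges {G = G} T) y u (rot y ∷ es) × Unique (rot y ∷ es)

  data RotorStep (u : Fin n) : Chips n × Rotors → Chips n × Rotors → Set where
    advance : ∀ {D rot} y → y ≢ u → 0ℤ < D y →
              RotorStep u (D , rot)
                (D ⊕ sending G y (next R y (rot y)) , updateAt rot y (next R y))

  record RotorRouting (u : Fin n) (S : Div⁰ n) (T T′ : SpanningTree G) : Set where
    field
      {start final}       : Chips n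
      {rotors rotors′}    : Rotors
      representative      : _⊢_∼_ G (proj₁ S) start
      nonnegative         : ∀ y → y ≢ u → 0ℤ ≤ start y
      orientedTowards     : OrientedTowards u T rotors
      run                 : Star (RotorStep u) (start , rotors) (final , rotors′)
      finished            : ∀ y → y ≢ u → final y ≡ 0ℤ
      orientedTowards′    : OrientedTowards u T′ rotors′

  -- (e , y) is a half-edge when e is incident to y.
  HalfEdge : Set
  HalfEdge = Fin m × Fin n

  _≟ʰ_ : (h h′ : HalfEdge) → Dec (h ≡ h′)
  _≟ʰ_ = ≡-dec _≟_ _≟_

  -- The half-edges passed before the current one.
  _visited?_ : (h : HalfEdge) (hs : List HalfEdge) → Bool
  h visited? hs = does (DecMembership._∈?_ _≟ʰ_ h hs)

  tourNext : Subset m → HalfEdge → HalfEdge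
  tourNext T (e , y) =
    if does (e ∈? T)
    then (next R (other G e y) e , other G e y)
    else (next R y e , y)

  tourPlace : Subset m → List HalfEdge → HalfEdge → Chips n
  tourPlace T hs (e , y) =
    if does (e ∈? T) ∨ ((e , other G e y) visited? hs)
    then const 0ℤ
    else chip y

  -- Tour T h₀ hs h D D′: when standing at h, having passed hs and placed D,
  -- the tour continues until its return to h₀, at which point D′ is placed.
  data Tour (T : Subset m) (h₀ : HalfEdge)
            : List HalfEdge → HalfEdge → Chips n → Chips n → Set where
    stop     : ∀ {hs h D} → tourNext T h ≡ h₀ →
               Tour T h₀ hs h D (D ⊕ tourPlace T hs h)
    continue : ∀ {hs h D D′} → tourNext T h ≢ h₀ →
               Tour T h₀ (h ∷ hs) (tourNext T h) (D ⊕ tourPlace T hs h) D′ →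
               Tour T h₀ hs h D D′

  BernardiDivisor : (u : Fin n) (e₀ : Fin m) → SpanningTree G → Chips n → Set
  BernardiDivisor u e₀ T D = Tour (edges {G = G} T) (e₀ , u) [] (e₀ , u) (const 0ℤ) D

  record Bernardi (u : Fin n) (e₀ : Fin m) (S : Div⁰ n) (T T′ : SpanningTree G) : Set where
    field
      {divisor divisor′} : Chips n
      bernardi           : BernardiDivisor u e₀ T divisor
      bernardi′          : BernardiDivisor u e₀ T′ divisor′
      equivalent         : _⊢_∼_ G divisor′ (divisor ⊕ proj₁ S)

  -- (e , y) stands for entering y along e.
  face : HalfEdge → HalfEdge
  face (e , y) = next R y e , other G (next R y e) y

  -- The half-edges are partitioned into k cycles; cycles are taken without a
  -- starting point, and label only matters on half-edges.
  record NumberOfCycles (k : ℕ) : Set where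
    field
      label : HalfEdge → Fin k
      onto  : ∀ c → ∃ λ e → ∃ λ y → Incident G e y × label (e , y) ≡ c
      same  : ∀ {e y e′ y′} → Incident G e y → Incident G e′ y′ →
              (label (e , y) ≡ label (e′ , y′)) ⇔ Reaches face (e , y) (e′ , y′)

  HasGenus : ℕ → Set
  HasGenus g = ∃ λ k → NumberOfCycles k × + 2 * + g ≡ + 2 - + n + + m - + k

pattern v = 0F
pattern z = 1F
pattern w = 2F

Vgen : Subset 3
Vgen = Sub.⁅ v ⁆ Sub.∪ Sub.⁅ w ⁆

-- Of the a + b edges of twoBundles a b, the first a, vz a b i, join v and z
-- and the last b, zw a b j, join z and w.
vz : ∀ a b → Fin a → Fin (a ℕ.+ b)
vz a b i = i ↑ˡ b

zw : ∀ a b → Fin b → Fin (a ℕ.+ b)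
zw a b j = a ↑ʳ j

IsZW : ∀ a b → Fin (a ℕ.+ b) → Set
IsZW a b e = ∃ λ j → e ≡ zw a b j

twoBundles : ∀ a b → .{{NonZero a}} → .{{NonZero b}} → Graph 3 (a ℕ.+ b)
twoBundles (ℕ.suc a′) (ℕ.suc b′) = record
  { ends      = ends′
  ; loopless  = loopless′
  ; connected = connected′
  }
  where
  a b : ℕ
  a = ℕ.suc a′
  b = ℕ.suc b′

  bundle : Fin a ⊎ Fin b → Fin 3 × Fin 3
  bundle = [ const (v , z) , const (z , w) ]′

  ends′ : Fin (a ℕ.+ b) → Fin 3 × Fin 3
  ends′ = bundle ∘ splitAt a

  loopless′ : ∀ e → proj₁ (ends′ e) ≢ proj₂ (ends′ e)
  loopless′ e with splitAt a e
  ... | inj₁ _ = λ ()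
  ... | inj₂ _ = λ ()

  c f : Fin (a ℕ.+ b)
  c = vz a b zero
  f = zw a b zero

  c-ends : ends′ c ≡ (v , z)
  c-ends = cong bundle (splitAt-↑ˡ a zero b)

  f-ends : ends′ f ≡ (z , w)
  f-ends = cong bundle (splitAt-↑ʳ a b zero)

  connected′ : Connects ends′ Sub.⊤
  connected′ v v = _ , []
  connected′ v z = _ , step {e = c} ∈⊤ (inj₁ c-ends) []
  connected′ v w = _ , step {e = c} ∈⊤ (inj₁ c-ends) (step {e = f} ∈⊤ (inj₁ f-ends) [])
  connected′ z v = _ , step {e = c} ∈⊤ (inj₂ c-ends) []
  connected′ z z = _ , []
  connected′ z w = _ , step {e = f} ∈⊤ (inj₁ f-ends) []
  connected′ w v = _ , step {e = f} ∈⊤ (inj₂ f-ends) (step {e = c} ∈⊤ (inj₂ c-ends) [])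
  connected′ w z = _ , step {e = f} ∈⊤ (inj₂ f-ends) []
  connected′ w w = _ , []

{-# OPTIONS --safe #-}

-- Let x = 2g + 1.  A homomorphism χ from chip configurations to ℤ/2x is given
-- by the potentials χ(v), χ(z), χ(w) = x, 0, x + 1 on G and 0, 0, 1 on G′; it
-- kills firings and is faithful in degree zero, and as χ(w) − χ(v) = 1 in both
-- cases it identifies Pic⁰(G) with Pic⁰(G′) through the chips on v and w.
-- Number the edges of the two bundles along the cyclic orders from the place
-- where ρ_z changes from one bundle to the other.  The tree with edges number
-- i and j gets the label i χ(v) + j χ(w), and the labels of the trees run once
-- through ℤ/2x; the bijection φ preserves labels.
--
-- Rotor routing conserves χ of the chips plus the sum of the heights of the
-- rotors away from the sink, where the height of a rotor changes by what the
-- chip sent along its new edge loses.  In the Bernardi process, starting the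
-- tour one step later changes χ of the divisor by an amount that telescopes
-- around the tour, so it suffices to count chips for one starting point.
-- Since 2 χ(v) = 0, in either process acting by S adds ± χ(S) to the label,
-- where the sign depends on the base vertex and the process but not on the
-- graph.

module Submission where

open import Defs
open import Algebra.Bundles using (AbelianGroup)
import Algebra.Properties.Semiring.Sum as SemiringSum
open import Data.Bool.Base using (if_then_else_)
open import Data.Bool.Properties using (∨-zeroʳ)
open import Data.Empty using (⊥-elim)
open import Data.Fin.Base using (Fin; zero; suc; toℕ; fromℕ<; _↑ˡ_; _↑ʳ_; splitAt)
open import Data.Fin.Patterns using (0F; 1F; 2F)
import Data.Fin.Properties as Fin
import Data.Fin.Subset as Sub
open import Data.Fin.Subset using (Subset)
import Data.Fin.Subset.Properties as Sub
open import Data.Fin.Subset.Properties using (_∈?_)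
open import Data.Integer.Base as ℤ using (ℤ; +_; -[1+_]; 0ℤ; 1ℤ; -1ℤ)
import Data.Integer.DivMod as ℤ
import Data.Integer.Properties as ℤ
open import Data.Integer.Tactic.RingSolver using (solve-∀)
open import Data.List.Base using (List; []; _∷_; _++_; _∷ʳ_; _ʳ++_)
import Data.List.Membership.DecPropositional as DecMembership
open import Data.List.Membership.Propositional using (_∈_; _∉_)
open import Data.List.Membership.Propositional.Properties using (∈-++⁺ˡ; ∈-++⁺ʳ; ∈-++⁻; ∈-∃++)
open import Data.List.Properties using (++-assoc; ++-identityʳ)
open import Data.List.Relation.Unary.All as All using ([]; _∷_)
open import Data.List.Relation.Unary.AllPairs using ([]; _∷_)
open import Data.List.Relation.Unary.Any using (here; there)
open import Data.List.Relation.Unary.Unique.Propositional using (Unique)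
open import Data.List.Relation.Unary.Unique.Propositional.Properties using (Unique[x∷xs]⇒x∉xs; ++⁺)
open import Data.Nat.Base as ℕ using (ℕ; zero; suc; z≤n; s≤s; NonZero)
open import Data.Nat.GeneralisedArithmetic using (iterate)
open import Data.Nat.Induction using (<-rec)
import Data.Nat.Properties as ℕ
open import Data.Product.Base using (∃; ∃₂; Σ-syntax; _×_; _,_; proj₁; proj₂)
open import Data.Sum.Base using (_⊎_; inj₁; inj₂; [_,_]′)
open import Data.Unit.Base using (tt)
import Data.Vec.Base as Vec
open import Data.Vec.Functional using (updateAt)
open import Data.Vec.Functional.Properties using (updateAt-updates; updateAt-minimal)
open import Function.Base using (const; _∘_)
open import Function.Bundles using (_⇔_; mk⇔; Equivalence; Bijection)
open import Relation.Binary.Construct.Closure.ReflexiveTransitive using (Star; ε; _◅_; _◅◅_)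
open import Relation.Binary.Definitions using (tri<; tri≈; tri>)
open import Relation.Binary.PropositionalEquality
  using (_≡_; _≢_; refl; sym; trans; cong; cong₂; subst; subst₂; module ≡-Reasoning)
open import Relation.Nullary using (¬_; Dec; does; yes; no; contradiction)
open import Relation.Nullary.Decidable using (dec-true; dec-false; toWitnessFalse)

open SemiringSum ℤ.+-*-semiring using (sum; sum-cong-≗)

-- Cyclic orders

-- Two difficulties shape the argument. The cyclic orders are arbitrary, so the hypotheses on them
-- are first turned into explicit enumerations of the two bundles. And both processes are relations
-- with free choices, so a value must be shown to exist and to be independent of the choices. Both
-- follow from one equivalence per process: `T′` is a result of `S` and `T` exactly when the labels
-- differ by the signed class of `S`. The invariant gives one direction; for the other a single
-- terminating run suffices, because labels separate trees. The order two of χ(v) is what makes one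
-- label serve all base vertices. Changing the base vertex reverses the sign of one of the two
-- summands of the label but not of the other. The summand i χ(v) does not notice a sign, so the
-- discrepancy can always be moved there, and what remains is a global sign. The same sign then
-- occurs on both graphs although the bundles have different sizes.

last-or-next : ∀ {k n} → k ℕ.< suc n → k ≡ n ⊎ suc k ℕ.< suc n
last-or-next (s≤s k≤n) = [ (λ k<n → inj₂ (s≤s k<n)) , inj₁ ]′ (ℕ.m≤n⇒m<n∨m≡n k≤n)

module _ {A : Set} (σ : A → A) where

  iterate-+ : ∀ x m n → iterate σ x (m ℕ.+ n) ≡ iterate σ (iterate σ x m) n
  iterate-+ x zero    n = refl
  iterate-+ x (suc m) n = iterate-+ (σ x) m n

  iterate-suc : ∀ x n → iterate σ x (suc n) ≡ σ (iterate σ x n)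
  iterate-suc x zero    = refl
  iterate-suc x (suc n) = iterate-suc (σ x) n

  Closed : (A → Set) → Set
  Closed P = ∀ {x} → P x → P (σ x)

  closed-iterate : ∀ {P : A → Set} → Closed P → ∀ {x} → P x → ∀ n → P (iterate σ x n)
  closed-iterate {P} cl p zero    = p
  closed-iterate {P} cl p (suc n) = closed-iterate {P} cl (cl p) n

  closed-reaches : ∀ {P : A → Set} → Closed P → ∀ {x y} → P x → Reaches σ x y → P y
  closed-reaches {P} cl p (n , eq) = subst P eq (closed-iterate {P} cl p n)

module Transitive {n} (τ : Fin n → Fin n) (reach : ∀ i j → Reaches τ i j) (base : Fin n) where

  orbit : ℕ → Fin n
  orbit = iterate τ base

  module _ {k l} (k<l : k ℕ.< l) (eq : orbit k ≡ orbit l) where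

    shorten : ∀ s → orbit (l ℕ.+ s) ≡ orbit (k ℕ.+ s)
    shorten s = begin
      orbit (l ℕ.+ s)          ≡⟨ iterate-+ τ base l s ⟩
      iterate τ (orbit l) s  ≡⟨ cong (λ i → iterate τ i s) (sym eq) ⟩
      iterate τ (orbit k) s  ≡⟨ sym (iterate-+ τ base k s) ⟩
      orbit (k ℕ.+ s)          ∎
      where open ≡-Reasoning

    -- A time l + s may be lowered to k + s without changing the value. The bound c survives since
    -- the lowered time is still at least k; with c = 1 it later produces a positive return time.
    reduce : ∀ {c} → c ℕ.≤ k → ∀ r → c ℕ.≤ r → ∃ λ r′ → c ℕ.≤ r′ × r′ ℕ.< l × orbit r′ ≡ orbit r
    reduce {c} c≤k = <-rec (λ r → c ℕ.≤ r → ∃ λ r′ → c ℕ.≤ r′ × r′ ℕ.< l × orbit r′ ≡ orbit r) go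
      where
      go : ∀ r → (∀ {s} → s ℕ.< r → c ℕ.≤ s → ∃ λ r′ → c ℕ.≤ r′ × r′ ℕ.< l × orbit r′ ≡ orbit s) →
           c ℕ.≤ r → ∃ λ r′ → c ℕ.≤ r′ × r′ ℕ.< l × orbit r′ ≡ orbit r
      go r rec c≤r with ℕ.<-≤-connex r l
      ... | inj₁ r<l = r , c≤r , r<l , refl
      ... | inj₂ l≤r with r ℕ.∸ l | ℕ.m+[n∸m]≡n l≤r
      ... | s | refl with rec (ℕ.+-monoˡ-< s k<l) (ℕ.≤-trans c≤k (ℕ.m≤m+n k s))
      ... | r′ , c≤r′ , r′<l , e = r′ , c≤r′ , r′<l , trans e (sym (shorten s))

    -- Transitivity puts every element of `Fin n` at some time, and after a repetition at l every
    -- time reduces below l; so l times exhaust all n elements.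
    all-before : n ℕ.≤ l
    all-before = Fin.injective⇒≤ {f = index} inj
      where
      found : ∀ j → ∃ λ r → 0 ℕ.≤ r × r ℕ.< l × orbit r ≡ orbit (proj₁ (reach base j))
      found j = reduce z≤n (proj₁ (reach base j)) z≤n

      index : Fin n → Fin l
      index j = fromℕ< (proj₁ (proj₂ (proj₂ (found j))))

      orbit-index : ∀ j → orbit (toℕ (index j)) ≡ j
      orbit-index j with found j
      ... | r , _ , r<l , e = trans (cong orbit (Fin.toℕ-fromℕ< r<l)) (trans e (proj₂ (reach base j)))

      inj : ∀ {i j} → index i ≡ index j → i ≡ j
      inj {i} {j} e = trans (sym (orbit-index i)) (trans (cong (orbit ∘ toℕ) e) (orbit-index j))

  opaque
    orbit-injective : ∀ {k l} → k ℕ.< n → l ℕ.< n → orbit k ≡ orbit l → k ≡ l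
    orbit-injective {k} {l} k<n l<n eq with ℕ.<-cmp k l
    ... | tri< k<l _ _ = contradiction l<n (ℕ.≤⇒≯ (all-before k<l eq))
    ... | tri≈ _ k≡l _ = k≡l
    ... | tri> _ _ l<k = contradiction k<n (ℕ.≤⇒≯ (all-before l<k (sym eq)))

    -- Among the times 0, ..., n two agree, and by `all-before` the later one is n. As `τ` is not
    -- known to be injective, the earlier one must still be shown to be 0: if it were positive, some
    -- return to `base` could be reduced to a time strictly between 0 and n, against
    -- `orbit-injective`.
    orbit-period : orbit n ≡ base
    orbit-period with Fin.pigeonhole (ℕ.n<1+n n) (orbit ∘ toℕ)
    ... | i , j , i<j , eq = go (toℕ i) (subst (toℕ i ℕ.<_) j≡n i<j) (trans eq (cong orbit j≡n))
      where
      j≡n : toℕ j ≡ n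
      j≡n = ℕ.≤-antisym (Fin.toℕ≤pred[n] j) (all-before i<j eq)

      go : ∀ k → k ℕ.< n → orbit k ≡ orbit n → orbit n ≡ base
      go zero    _   e = sym e
      go (suc k) k<n e with reach (τ base) base
      ... | r , e′ with reduce k<n e {1} (s≤s z≤n) (suc r) (s≤s z≤n)
      ... | suc r′ , _ , r′<n , e″ =
        contradiction (orbit-injective r′<n (ℕ.≤-<-trans z≤n r′<n) (trans e″ e′)) λ ()

    orbit-surjective : ∀ j → ∃ λ k → k ℕ.< n × orbit k ≡ j
    orbit-surjective j with reduce (ℕ.≤-<-trans z≤n (Fin.toℕ<n base)) (sym orbit-period) z≤n (proj₁ (reach base j)) z≤n
    ... | k , _ , k<n , e = k , k<n , trans e (proj₂ (reach base j))

first-hit : {A : Set} {P : A → Set} {σ : A → A} {e e′ : A} → P (σ e) → FirstReturn P σ e e′ → e′ ≡ σ e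
first-hit p (here _)     = refl
first-hit p (there ¬p _) = contradiction p ¬p

first-miss : {A : Set} {P : A → Set} {σ : A → A} {e e′ : A} → ¬ P (σ e) → FirstReturn P σ e e′ → FirstReturn P σ (σ e) e′
first-miss ¬p (here p)    = contradiction p ¬p
first-miss ¬p (there _ r) = r

-- Incidences in a graph with two bundles, and the normal form of its ribbon structures.

module TwoBundles (a′ b′ : ℕ) where

  a b m : ℕ
  a = suc a′
  b = suc b′
  m = a ℕ.+ b

  Edge : Set
  Edge = Fin m

  G : Graph 3 m
  G = twoBundles a b

  c-edge : Fin a → Edge
  c-edge = vz a b

  f-edge : Fin b → Edge
  f-edge = zw a b

  data Side : Edge → Set where
    isC : ∀ i → Side (c-edge i)
    isF : ∀ j → Side (f-edge j)

  side : ∀ e → Side e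
  side e with splitAt a e in eq
  ... | inj₁ i = subst Side (Fin.splitAt⁻¹-↑ˡ {m = a} {i = e} eq) (isC i)
  ... | inj₂ j = subst Side (Fin.splitAt⁻¹-↑ʳ {m = a} {i = e} eq) (isF j)

  opaque
    c-or-f : ∀ e → (∃ λ i → e ≡ c-edge i) ⊎ (∃ λ j → e ≡ f-edge j)
    c-or-f e with side e
    ... | isC i = inj₁ (i , refl)
    ... | isF j = inj₂ (j , refl)

    ends-c : ∀ i → ends G (c-edge i) ≡ (v , z)
    ends-c i = cong [ const (v , z) , const (z , w) ]′ (Fin.splitAt-↑ˡ a i b)

    ends-f : ∀ j → ends G (f-edge j) ≡ (z , w)
    ends-f j = cong [ const (v , z) , const (z , w) ]′ (Fin.splitAt-↑ʳ a b j)

    c-injective : ∀ {i j} → c-edge i ≡ c-edge j → i ≡ j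
    c-injective = Fin.↑ˡ-injective b _ _

    f-injective : ∀ {i j} → f-edge i ≡ f-edge j → i ≡ j
    f-injective = Fin.↑ʳ-injective a _ _

    c≢f : ∀ {i j} → c-edge i ≢ f-edge j
    c≢f {i} {j} e with trans (sym (Fin.splitAt-↑ˡ a i b)) (trans (cong (splitAt a) e) (Fin.splitAt-↑ʳ a b j))
    ... | ()

    c-at-v : ∀ i → Incident G (c-edge i) v
    c-at-v i rewrite Fin.splitAt-↑ˡ a i b = inj₁ refl

    c-at-z : ∀ i → Incident G (c-edge i) z
    c-at-z i rewrite Fin.splitAt-↑ˡ a i b = inj₂ refl

    f-at-z : ∀ j → Incident G (f-edge j) z
    f-at-z j rewrite Fin.splitAt-↑ʳ a b j = inj₁ refl

    f-at-w : ∀ j → Incident G (f-edge j) w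
    f-at-w j rewrite Fin.splitAt-↑ʳ a b j = inj₂ refl

    at-z : ∀ e → Incident G e z
    at-z e with side e
    ... | isC i = c-at-z i
    ... | isF j = f-at-z j

    at-v : ∀ {e} → Incident G e v → ∃ λ i → e ≡ c-edge i
    at-v {e} inc with side e
    ... | isC i = i , refl
    ... | isF j rewrite Fin.splitAt-↑ʳ a b j with inc
    ... | inj₁ ()
    ... | inj₂ ()

    at-w : ∀ {e} → Incident G e w → ∃ λ j → e ≡ f-edge j
    at-w {e} inc with side e
    ... | isF j = j , refl
    ... | isC i rewrite Fin.splitAt-↑ˡ a i b with inc
    ... | inj₁ ()
    ... | inj₂ ()

    other-cv : ∀ i → other G (c-edge i) v ≡ z
    other-cv i rewrite Fin.splitAt-↑ˡ a i b = refl

    other-cz : ∀ i → other G (c-edge i) z ≡ v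
    other-cz i rewrite Fin.splitAt-↑ˡ a i b = refl

    other-fz : ∀ j → other G (f-edge j) z ≡ w
    other-fz j rewrite Fin.splitAt-↑ʳ a b j = refl

    other-fw : ∀ j → other G (f-edge j) w ≡ z
    other-fw j rewrite Fin.splitAt-↑ʳ a b j = refl

  -- E enumerates, in the cyclic order at y, the n edges joining y and z.
  record Bundle (ρ : Ribbon G) (y : Fin 3) (n : ℕ) (E : ℕ → Edge) : Set where
    field
      far        : ∀ k → other G (E k) z ≡ y
      near       : ∀ k → other G (E k) y ≡ z
      incident   : ∀ k → Incident G (E k) y
      next-far   : ∀ k → next ρ y (E k) ≡ E (suc k)
      next-near  : ∀ k → suc k ℕ.< n → next ρ z (E k) ≡ E (suc k)
      period     : E n ≡ E 0
      injective  : ∀ {k l} → k ℕ.< n → l ℕ.< n → E k ≡ E l → k ≡ l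
      surjective : ∀ {e} → Incident G e y → ∃ λ k → k ℕ.< n × e ≡ E k

  -- The order at `z` reads `C 0`, ..., `C a′`, `F 0`, ..., `F b′`. The enumerations live on ℕ and
  -- continue periodically, so the successor at `v` or `w` has no exceptional last edge; only at `z`
  -- does the end of a bundle matter.
  record NormalForm (ρ : Ribbon G) : Set where
    field
      {C F} : ℕ → Edge
      isC-C : ∀ k → ∃ λ i → C k ≡ c-edge i
      isF-F : ∀ k → ∃ λ j → F k ≡ f-edge j
      C-bundle : Bundle ρ v a C
      F-bundle : Bundle ρ w b F
      next-CF  : next ρ z (C a′) ≡ F 0
      next-FC  : next ρ z (F b′) ≡ C 0

  module _ (ρ : Ribbon G) where

    opaque
      next-c : ∀ i → ∃ λ i′ → next ρ v (c-edge i) ≡ c-edge i′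
      next-c i = at-v (stays ρ (c-at-v i))

      next-f : ∀ j → ∃ λ j′ → next ρ w (f-edge j) ≡ f-edge j′
      next-f j = at-w (stays ρ (f-at-w j))

    τ-v : Fin a → Fin a
    τ-v i = proj₁ (next-c i)

    τ-w : Fin b → Fin b
    τ-w j = proj₁ (next-f j)

    iterate-v : ∀ i k → iterate (next ρ v) (c-edge i) k ≡ c-edge (iterate τ-v i k)
    iterate-v i zero    = refl
    iterate-v i (suc k) = trans (cong (λ e → iterate (next ρ v) e k) (proj₂ (next-c i))) (iterate-v (τ-v i) k)

    iterate-w : ∀ j k → iterate (next ρ w) (f-edge j) k ≡ f-edge (iterate τ-w j k)
    iterate-w j zero    = refl
    iterate-w j (suc k) = trans (cong (λ e → iterate (next ρ w) e k) (proj₂ (next-f j))) (iterate-w (τ-w j) k)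

    transitive-v : ∀ i j → Reaches τ-v i j
    transitive-v i j with cyclic ρ (c-at-v i) (c-at-v j)
    ... | k , e = k , c-injective (trans (sym (iterate-v i k)) e)

    transitive-w : ∀ i j → Reaches τ-w i j
    transitive-w i j with cyclic ρ (f-at-w i) (f-at-w j)
    ... | k , e = k , f-injective (trans (sym (iterate-w i k)) e)

    -- `run-C` says that the edges at `v` form one run at `z` beginning with `c₀`. It is vacuous for
    -- a = 1, and for a = 2 it is the assumption that the two edges are consecutive.
    module Normalise
      (c₀ : Fin a)
      (run-C : ∀ k → suc k ℕ.< a → next ρ z (c-edge (iterate τ-v c₀ k)) ≡ c-edge (iterate τ-v c₀ (suc k)))
      (same : RestrictsTo (IsZW a b) (next ρ z) (next ρ w))
      where

      module TC = Transitive τ-v transitive-v c₀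

      C : ℕ → Edge
      C k = c-edge (TC.orbit k)

      IsC IsF : Edge → Set
      IsC e = ∃ λ k → k ℕ.< a × e ≡ C k
      IsF e = IsZW a b e

      opaque
        C-surj : ∀ i → IsC (c-edge i)
        C-surj i with TC.orbit-surjective i
        ... | k , k<a , e = k , k<a , cong c-edge (sym e)

      opaque
        -- Were the last `C` followed by another one, the `C` edges would be closed under the
        -- successor at `z`, and no edge to `w` could be reached from them.
        after-C : ∃ λ j → next ρ z (C a′) ≡ f-edge j
        after-C = [ (λ (i , eq) → ⊥-elim (absurd (escape i eq))) , (λ found → found) ]′ (c-or-f (next ρ z (C a′)))
          where
          escape : ∀ i → next ρ z (C a′) ≡ c-edge i → IsC (f-edge zero)
          escape i eq = closed-reaches (next ρ z) {IsC} closed (C-surj c₀) (cyclic ρ (at-z (c-edge c₀)) (at-z (f-edge zero)))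
            where
            closed : Closed (next ρ z) IsC
            closed (k , k<a , refl) with last-or-next k<a
            ... | inj₁ refl = subst IsC (sym eq) (C-surj i)
            ... | inj₂ lt   = suc k , lt , run-C k lt

          absurd : ¬ IsC (f-edge zero)
          absurd (_ , _ , e) = c≢f (sym e)

      f₀ : Fin b
      f₀ = proj₁ after-C

      module TF = Transitive τ-w transitive-w f₀

      F : ℕ → Edge
      F k = f-edge (TF.orbit k)

      next-C : ∀ k → next ρ v (C k) ≡ C (suc k)
      next-C k = trans (proj₂ (next-c (TC.orbit k))) (cong c-edge (sym (iterate-suc τ-v c₀ k)))

      next-F : ∀ k → next ρ w (F k) ≡ F (suc k)
      next-F k = trans (proj₂ (next-f (TF.orbit k))) (cong f-edge (sym (iterate-suc τ-w f₀ k)))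

      opaque
        F-surj : ∀ j → ∃ λ k → k ℕ.< b × f-edge j ≡ F k
        F-surj j with TF.orbit-surjective j
        ... | k , k<b , e = k , k<b , cong f-edge (sym e)

      -- Induction on the number d of `C` edges still ahead: the run must be passed to its end
      -- before an edge to `w` occurs, and that edge is `F 0`.
      return-from-C : ∀ d k → k ℕ.+ d ≡ a′ → ∀ {e} → FirstReturn (IsZW a b) (next ρ z) (C k) e → e ≡ F 0
      return-from-C zero k eq ret = trans
        (first-hit (subst (λ k → IsZW a b (next ρ z (C k))) (sym k≡a′) after-C) ret)
        (trans (cong (next ρ z ∘ C) k≡a′) (proj₂ after-C))
        where
        k≡a′ : k ≡ a′
        k≡a′ = trans (sym (ℕ.+-identityʳ k)) eq
      return-from-C (suc d) k eq ret = return-from-C d (suc k) eq′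
        (subst (λ e → FirstReturn (IsZW a b) (next ρ z) e _) onward (first-miss miss ret))
        where
        eq′ : suc k ℕ.+ d ≡ a′
        eq′ = trans (sym (ℕ.+-suc k d)) eq

        onward : next ρ z (C k) ≡ C (suc k)
        onward = run-C k (s≤s (subst (suc k ℕ.≤_) eq′ (ℕ.m≤m+n (suc k) d)))

        miss : ¬ IsZW a b (next ρ z (C k))
        miss (_ , e) = c≢f (trans (sym onward) e)

      opaque
        -- The successor of `F k` at `w` is its first return at `z`. Either the return is immediate,
        -- or it leads through `C` edges and then necessarily ends at `F 0`. For k + 1 < b the
        -- second case contradicts injectivity.
        after-F : ∀ k → (next ρ z (F k) ≡ F (suc k)) ⊎ ((∃ λ l → l ℕ.< a × next ρ z (F k) ≡ C l) × F (suc k) ≡ F 0)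
        after-F k = [ inj₂ ∘ through-C , (λ found → inj₁ (sym (first-hit found ret))) ]′ (c-or-f (next ρ z (F k)))
          where
          ret : FirstReturn (IsZW a b) (next ρ z) (F k) (F (suc k))
          ret = subst (FirstReturn (IsZW a b) (next ρ z) (F k)) (next-F k) (same (F k) (_ , refl))

          through-C : (∃ λ i → next ρ z (F k) ≡ c-edge i) →
                      (∃ λ l → l ℕ.< a × next ρ z (F k) ≡ C l) × F (suc k) ≡ F 0
          through-C (i , eq) = (l , proj₁ (proj₂ (C-surj i)) , eq′)
            , return-from-C (a′ ℕ.∸ l) l (ℕ.m+[n∸m]≡n (ℕ.≤-pred (proj₁ (proj₂ (C-surj i)))))
                (subst (λ e → FirstReturn (IsZW a b) (next ρ z) e _) eq′ (first-miss (λ (_ , e) → c≢f (trans (sym eq) e)) ret))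
            where
            l : ℕ
            l = proj₁ (C-surj i)

            eq′ : next ρ z (F k) ≡ C l
            eq′ = trans eq (proj₂ (proj₂ (C-surj i)))

      run-F : ∀ k → suc k ℕ.< b → next ρ z (F k) ≡ F (suc k)
      run-F k lt with after-F k
      ... | inj₁ e = e
      ... | inj₂ (_ , e) = contradiction (TF.orbit-injective lt (s≤s z≤n) (f-injective e)) λ ()

      F-period : F b ≡ F 0
      F-period = cong f-edge TF.orbit-period

      closed-from-F : ∀ {P : Edge → Set} → (∀ {e} → IsF e → P e) → P (next ρ z (F b′)) → ∀ {e} → IsF e → P (next ρ z e)
      closed-from-F {P} inc last (j , refl) with F-surj j
      ... | k , k<b , eq with last-or-next k<b
      ... | inj₁ refl = subst (P ∘ next ρ z) (sym eq) last
      ... | inj₂ lt   = subst P (sym (trans (cong (next ρ z) eq) (run-F k lt))) (inc (_ , refl))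

      f₀-reaches-c₀ : Reaches (next ρ z) (f-edge f₀) (c-edge c₀)
      f₀-reaches-c₀ = cyclic ρ (at-z (f-edge f₀)) (at-z (c-edge c₀))

      -- If the last `F` were followed by an edge to `w`, the `F` edges would be closed under the
      -- successor at `z`; if by `C (suc l)`, the `F` edges together with all `C` edges except `C 0`
      -- would be. In both cases `c₀` could not be reached from `f₀`.
      next-FC : next ρ z (F b′) ≡ C 0
      next-FC with after-F b′
      ... | inj₁ e = ⊥-elim (absurd (closed-reaches (next ρ z) {IsF} (closed-from-F (λ p → p) (_ , e)) (_ , refl) f₀-reaches-c₀))
        where
        absurd : ¬ IsF (c-edge c₀)
        absurd (_ , e) = c≢f e
      ... | inj₂ ((zero , _ , e) , _) = e
      ... | inj₂ ((suc l , l<a , e) , _) = ⊥-elim (absurd (closed-reaches (next ρ z) {P} closed (inj₁ (_ , refl)) f₀-reaches-c₀))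
        where
        P : Edge → Set
        P e = IsF e ⊎ (∃ λ k → suc k ℕ.< a × e ≡ C (suc k))

        closed : Closed (next ρ z) P
        closed (inj₁ f) = closed-from-F {P} inj₁ (inj₂ (l , l<a , e)) f
        closed (inj₂ (k , k<a , refl)) with last-or-next k<a
        ... | inj₁ refl = inj₁ after-C
        ... | inj₂ lt   = inj₂ (suc k , lt , run-C (suc k) lt)

        absurd : ¬ P (c-edge c₀)
        absurd (inj₁ (_ , e)) = c≢f e
        absurd (inj₂ (k , k<a , e)) = contradiction (TC.orbit-injective (s≤s z≤n) k<a (c-injective e)) λ ()

      normalForm : NormalForm ρ
      normalForm = record
        { C = C
        ; F = F
        ; isC-C = λ k → _ , refl
        ; isF-F = λ k → _ , refl
        ; C-bundle = record
          { far        = λ k → other-cz (TC.orbit k)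
          ; near       = λ k → other-cv (TC.orbit k)
          ; incident   = λ k → c-at-v (TC.orbit k)
          ; next-far   = next-C
          ; next-near  = run-C
          ; period     = cong c-edge TC.orbit-period
          ; injective  = λ k<n l<n e → TC.orbit-injective k<n l<n (c-injective e)
          ; surjective = λ inc → let i , e = at-v inc ; k , k<a , e′ = C-surj i in k , k<a , trans e e′
          }
        ; F-bundle = record
          { far        = λ k → other-fz (TF.orbit k)
          ; near       = λ k → other-fw (TF.orbit k)
          ; incident   = λ k → f-at-w (TF.orbit k)
          ; next-far   = next-F
          ; next-near  = run-F
          ; period     = F-period
          ; injective  = λ k<n l<n e → TF.orbit-injective k<n l<n (f-injective e)
          ; surjective = λ inc → let j , e = at-w inc ; k , k<b , e′ = F-surj j in k , k<b , trans e e′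
          }
        ; next-CF = proj₂ after-C
        ; next-FC = next-FC
        }

normalForm₁ : ∀ b′ (ρ : Ribbon (twoBundles 1 (suc b′))) →
  RestrictsTo (IsZW 1 (suc b′)) (next ρ z) (next ρ w) → TwoBundles.NormalForm 0 b′ ρ
normalForm₁ b′ ρ same = TwoBundles.Normalise.normalForm 0 b′ ρ zero (λ { k (s≤s ()) }) same

-- The enumeration starts with whichever of the two edges precedes the other at `z`. At `v` there is
-- nothing to choose, since a cyclic order on two edges exchanges them.
normalForm₂ : ∀ b′ (ρ : Ribbon (twoBundles 2 (suc b′))) →
  Consecutive (next ρ z) (vz 2 (suc b′) 0F) (vz 2 (suc b′) 1F) →
  RestrictsTo (IsZW 2 (suc b′)) (next ρ z) (next ρ w) → TwoBundles.NormalForm 1 b′ ρ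
normalForm₂ b′ ρ (inj₁ e) same = TB.Normalise.normalForm ρ 0F run same
  where
  module TB = TwoBundles 1 b′
  module T = Transitive (TB.τ-v ρ) (TB.transitive-v ρ) 0F

  τ0 : T.orbit 1 ≡ 1F
  τ0 with T.orbit 1 in eq
  ... | 1F = refl
  ... | 0F = contradiction (T.orbit-injective {1} {0} (s≤s (s≤s z≤n)) (s≤s z≤n) eq) λ ()

  run : ∀ k → suc k ℕ.< 2 → _
  run zero    _ = trans e (cong (vz 2 (suc b′)) (sym τ0))
  run (suc k) (s≤s (s≤s ()))
normalForm₂ b′ ρ (inj₂ e) same = TB.Normalise.normalForm ρ 1F run same
  where
  module TB = TwoBundles 1 b′
  module T = Transitive (TB.τ-v ρ) (TB.transitive-v ρ) 1F

  τ1 : T.orbit 1 ≡ 0F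
  τ1 with T.orbit 1 in eq
  ... | 0F = refl
  ... | 1F = contradiction (T.orbit-injective {1} {0} (s≤s (s≤s z≤n)) (s≤s z≤n) eq) λ ()

  run : ∀ k → suc k ℕ.< 2 → _
  run zero    _ = trans e (cong (vz 2 (suc b′)) (sym τ1))
  run (suc k) (s≤s (s≤s ()))

-- Spanning trees

module Trees (a′ b′ : ℕ) (ρ : Ribbon (twoBundles (suc a′) (suc b′))) (nf : TwoBundles.NormalForm a′ b′ ρ) where
  open TwoBundles a′ b′
  open NormalForm nf public
  module CB = Bundle C-bundle
  module FB = Bundle F-bundle

  opaque
    ends-C : ∀ k → ends G (C k) ≡ (v , z)
    ends-C k with isC-C k
    ... | i , e rewrite e = ends-c i

    ends-F : ∀ k → ends G (F k) ≡ (z , w)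
    ends-F k with isF-F k
    ... | j , e rewrite e = ends-f j

    C≢F : ∀ {k l} → C k ≢ F l
    C≢F {k} {l} e with isC-C k | isF-F l
    ... | i , e₁ | j , e₂ = c≢f (trans (sym e₁) (trans e e₂))

    C-or-F : ∀ e → (∃ λ k → k ℕ.< a × e ≡ C k) ⊎ (∃ λ k → k ℕ.< b × e ≡ F k)
    C-or-F e with c-or-f e
    ... | inj₁ (i , refl) = inj₁ (CB.surjective (c-at-v i))
    ... | inj₂ (j , refl) = inj₂ (FB.surjective (f-at-w j))

  joins-incident : ∀ {e u y} → Joins (ends G) e u y → Incident G e u
  joins-incident (inj₁ eq) = inj₁ (cong proj₁ eq)
  joins-incident (inj₂ eq) = inj₂ (cong proj₂ eq)

  record Shape (T : Subset m) (i j : ℕ) : Set where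
    field
      i<a   : i ℕ.< a
      j<b   : j ℕ.< b
      C∈    : C i Sub.∈ T
      F∈    : F j Sub.∈ T
      only  : ∀ {e} → e Sub.∈ T → e ≡ C i ⊎ e ≡ F j

  shape-unique : ∀ {T T′ i j} → Shape T i j → Shape T′ i j → T ≡ T′
  shape-unique S S′ = Sub.⊆-antisym (⊆ S S′) (⊆ S′ S)
    where
    ⊆ : ∀ {T T′ i j} → Shape T i j → Shape T′ i j → T Sub.⊆ T′
    ⊆ S S′ e∈T with Shape.only S e∈T
    ... | inj₁ refl = Shape.C∈ S′
    ... | inj₂ refl = Shape.F∈ S′

  -- The first edge of the path from y to u in the tree with edges C i and F j;
  -- junk for y = u.
  heading : (i j : ℕ) (y u : Fin 3) → Edge
  heading i j 0F u  = C i
  heading i j 1F 0F = C i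
  heading i j 1F 1F = C i
  heading i j 1F 2F = F j
  heading i j 2F u  = F j

  module _ {T : Subset m} {i j : ℕ} (S : Shape T i j) where
    open Shape S

    data Move : Edge → Fin 3 → Fin 3 → Set where
      v→z : Move (C i) v z
      z→v : Move (C i) z v
      w→z : Move (F j) w z
      z→w : Move (F j) z w

    opaque
      move : ∀ {e u y} → e Sub.∈ T → Joins (ends G) e u y → Move e u y
      move e∈T joins with only e∈T
      move e∈T (inj₁ eq) | inj₁ refl with trans (sym eq) (ends-C i)
      ... | refl = v→z
      move e∈T (inj₂ eq) | inj₁ refl with trans (sym eq) (ends-C i)
      ... | refl = z→v
      move e∈T (inj₁ eq) | inj₂ refl with trans (sym eq) (ends-F j)
      ... | refl = z→w
      move e∈T (inj₂ eq) | inj₂ refl with trans (sym eq) (ends-F j)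
      ... | refl = w→z

    stuck-at-v : ∀ {y es} → Walk (ends G) T v y es → C i ∉ es → y ≡ v
    stuck-at-v [] _ = refl
    stuck-at-v (step e∈T joins _) C∉ with move e∈T joins
    ... | v→z = contradiction (here refl) C∉

    stuck-at-w : ∀ {y es} → Walk (ends G) T w y es → F j ∉ es → y ≡ w
    stuck-at-w [] _ = refl
    stuck-at-w (step e∈T joins _) F∉ with move e∈T joins
    ... | w→z = contradiction (here refl) F∉

    -- A trail from `z` that avoids `C i` can only pass to `w` along `F j`, and there it is stuck
    -- because `F j` is spent.
    never-v : ∀ {y es} → Walk (ends G) T z y es → Unique es → C i ∉ es → y ≢ v
    never-v [] _ _ = λ ()
    never-v (step e∈T joins walk) uniq C∉ with move e∈T joins
    ... | z→v = contradiction (here refl) C∉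
    ... | z→w with stuck-at-w walk (Unique[x∷xs]⇒x∉xs uniq)
    ... | refl = λ ()

    never-w : ∀ {y es} → Walk (ends G) T z y es → Unique es → F j ∉ es → y ≢ w
    never-w [] _ _ = λ ()
    never-w (step e∈T joins walk) uniq F∉ with move e∈T joins
    ... | z→w = contradiction (here refl) F∉
    ... | z→v with stuck-at-v walk (Unique[x∷xs]⇒x∉xs uniq)
    ... | refl = λ ()

    shape-acyclic : Acyclic G T
    shape-acyclic [] _ = refl
    shape-acyclic (step e∈T joins walk) uniq@(_ ∷ uniq′) with move e∈T joins
    ... | v→z = contradiction refl (never-v walk uniq′ (Unique[x∷xs]⇒x∉xs uniq))
    ... | w→z = contradiction refl (never-w walk uniq′ (Unique[x∷xs]⇒x∉xs uniq))
    ... | z→v = contradiction (stuck-at-v walk (Unique[x∷xs]⇒x∉xs uniq)) λ ()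
    ... | z→w = contradiction (stuck-at-w walk (Unique[x∷xs]⇒x∉xs uniq)) λ ()

    Path : Fin 3 → Fin 3 → Edge → Set
    Path y u e = ∃ λ es → Walk (ends G) T y u (e ∷ es) × Unique (e ∷ es)

    path : ∀ y u → y ≢ u → Path y u (heading i j y u)
    path 0F 0F y≢u = contradiction refl y≢u
    path 0F 1F _ = [] , step C∈ (inj₁ (ends-C i)) [] , [] ∷ []
    path 0F 2F _ = F j ∷ [] , step C∈ (inj₁ (ends-C i)) (step F∈ (inj₁ (ends-F j)) []) , (C≢F ∷ []) ∷ [] ∷ []
    path 1F 0F _ = [] , step C∈ (inj₂ (ends-C i)) [] , [] ∷ []
    path 1F 1F y≢u = contradiction refl y≢u
    path 1F 2F _ = [] , step F∈ (inj₁ (ends-F j)) [] , [] ∷ []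
    path 2F 0F _ = C i ∷ [] , step F∈ (inj₂ (ends-F j)) (step C∈ (inj₂ (ends-C i)) []) , ((C≢F ∘ sym) ∷ []) ∷ [] ∷ []
    path 2F 1F _ = [] , step F∈ (inj₂ (ends-F j)) [] , [] ∷ []
    path 2F 2F y≢u = contradiction refl y≢u

    -- This makes the rotors away from the sink a function of the tree and the sink, although an
    -- orientation is only required to follow some trail.
    path-heading : ∀ y u → y ≢ u → ∀ {e} → Path y u e → e ≡ heading i j y u
    path-heading 0F u _ (_ , step e∈T joins _ , _) with move e∈T joins
    ... | v→z = refl
    path-heading 2F u _ (_ , step e∈T joins _ , _) with move e∈T joins
    ... | w→z = refl
    path-heading 1F 1F y≢u _ = contradiction refl y≢u
    path-heading 1F 0F _ (_ , step e∈T joins walk , uniq) with move e∈T joins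
    ... | z→v = refl
    ... | z→w = contradiction (stuck-at-w walk (Unique[x∷xs]⇒x∉xs uniq)) λ ()
    path-heading 1F 2F _ (_ , step e∈T joins walk , uniq) with move e∈T joins
    ... | z→w = refl
    ... | z→v = contradiction (stuck-at-v walk (Unique[x∷xs]⇒x∉xs uniq)) λ ()

    shape-connects : Connects (ends G) T
    shape-connects u y with u Fin.≟ y
    ... | yes refl = [] , []
    ... | no u≢y   = _ , proj₁ (proj₂ (path u y u≢y))

  opaque
    -- The first steps of walks from `v` to `z` and from `w` to `z` supply one edge of each bundle.
    -- A second edge of the same bundle would close a trail of length two.
    shape : (T : SpanningTree G) → ∃ λ i → ∃ λ j → Shape (edges {G = G} T) i j
    shape (T , connects , acyclic) = from (connects v z) (connects w z)
      where
      from : ∃ (Walk (ends G) T v z) → ∃ (Walk (ends G) T w z) → ∃ λ i → ∃ λ j → Shape T i j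
      from (_ , step {e = e} e∈T joins _) (_ , step {e = e′} e∈T′ joins′ _)
        with CB.surjective {e} (joins-incident {e} joins) | FB.surjective {e′} (joins-incident {e′} joins′)
      ... | i , i<a , refl | j , j<b , refl = i , j , record
        { i<a = i<a ; j<b = j<b ; C∈ = e∈T ; F∈ = e∈T′ ; only = only }
        where
        only : ∀ {e} → e Sub.∈ T → e ≡ C i ⊎ e ≡ F j
        only {e} e∈ with C-or-F e
        ... | inj₁ (k , _ , refl) with C k Fin.≟ C i
        ...   | yes eq = inj₁ eq
        ...   | no neq = contradiction
          (acyclic (step e∈ (inj₁ (ends-C k)) (step e∈T (inj₂ (ends-C i)) [])) ((neq ∷ []) ∷ [] ∷ [])) λ ()
        only {e} e∈ | inj₂ (k , _ , refl) with F k Fin.≟ F j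
        ...   | yes eq = inj₂ eq
        ...   | no neq = contradiction
          (acyclic (step e∈ (inj₂ (ends-F k)) (step e∈T′ (inj₁ (ends-F j)) [])) ((neq ∷ []) ∷ [] ∷ [])) λ ()

  pair : ℕ → ℕ → Subset m
  pair i j = Sub.⁅ C i ⁆ Sub.∪ Sub.⁅ F j ⁆

  pair-shape : ∀ {i j} → i ℕ.< a → j ℕ.< b → Shape (pair i j) i j
  pair-shape {i} {j} i<a j<b = record
    { i<a = i<a
    ; j<b = j<b
    ; C∈ = Sub.x∈p∪q⁺ (inj₁ (Sub.x∈⁅x⁆ (C i)))
    ; F∈ = Sub.x∈p∪q⁺ (inj₂ (Sub.x∈⁅x⁆ (F j)))
    ; only = λ e∈ → [ inj₁ ∘ Sub.x∈⁅y⁆⇒x≡y (C i) , inj₂ ∘ Sub.x∈⁅y⁆⇒x≡y (F j) ]′ (Sub.x∈p∪q⁻ _ _ e∈)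
    }

  opaque
    tree : ∀ {i j} → i ℕ.< a → j ℕ.< b → ∃ λ (T : SpanningTree G) → Shape (edges {G = G} T) i j
    tree {i} {j} i<a j<b = (pair i j , shape-connects S , shape-acyclic S) , S
      where
      S : Shape (pair i j) i j
      S = pair-shape i<a j<b

-- Genus

module _ {A : Set} {f : A → A} where

  reaches-refl : ∀ {x} → Reaches f x x
  reaches-refl = 0 , refl

  reaches-trans : ∀ {x y u} → Reaches f x y → Reaches f y u → Reaches f x u
  reaches-trans {x} (k , refl) (l , refl) = k ℕ.+ l , iterate-+ f x k l

  reaches-step : ∀ {x y} → f x ≡ y → Reaches f x y
  reaches-step e = 1 , e

  -- Reachability under a self-map is symmetric on periodic points: if x has period n + 1 and y
  -- comes k steps later, then n·k further steps complete k full periods.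
  reaches-back : ∀ {x y} → Reaches f (f x) x → Reaches f x y → Reaches f y x
  reaches-back {x} (n , returns) (k , refl) = n ℕ.* k , (begin
    iterate f (iterate f x k) (n ℕ.* k)  ≡⟨ sym (iterate-+ f x k (n ℕ.* k)) ⟩
    iterate f x (suc n ℕ.* k)            ≡⟨ cong (iterate f x) (ℕ.*-comm (suc n) k) ⟩
    iterate f x (k ℕ.* suc n)            ≡⟨ loops k ⟩
    x                                    ∎)
    where
    open ≡-Reasoning
    loops : ∀ k → iterate f x (k ℕ.* suc n) ≡ x
    loops zero    = refl
    loops (suc k) = trans (iterate-+ f x (suc n) (k ℕ.* suc n)) (trans (cong (λ y → iterate f y (k ℕ.* suc n)) returns) (loops k))

  returning : ∀ {x y} → Reaches f x y → f y ≡ x → Reaches f (f x) x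
  returning {x} (n , refl) e = n , trans (iterate-suc f x n) e

flip : Fin 2 → Fin 2
flip 0F = 1F
flip 1F = 0F

flip-flip : ∀ c → flip (flip c) ≡ c
flip-flip 0F = refl
flip-flip 1F = refl

parity : ℕ → Fin 2
parity zero    = 0F
parity (suc k) = flip (parity k)

parity-even : ∀ k → parity (2 ℕ.* k) ≡ 0F
parity-even zero    = refl
parity-even (suc k) rewrite ℕ.+-suc k (k ℕ.+ 0) = trans (flip-flip (parity (2 ℕ.* k))) (parity-even k)

module Faces (a′ b′ : ℕ) (ρ : Ribbon (twoBundles (suc a′) (suc b′))) (nf : TwoBundles.NormalForm a′ b′ ρ) where
  open TwoBundles a′ b′
  open Trees a′ b′ ρ nf

  H : Set
  H = HalfEdge ρ

  Proper : H → Set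
  Proper (e , y) = Incident G e y

  -- A certificate for two cycles: a label constant along faces, and for each label one periodic
  -- half-edge from which all half-edges with that label are reached. Periodicity of the base point
  -- alone yields mutual reachability within the class.
  record TwoFaces : Set where
    field
      label      : H → Fin 2
      base       : Fin 2 → H
      proper     : ∀ c → Proper (base c)
      label-base : ∀ c → label (base c) ≡ c
      label-face : ∀ e y → Incident G e y → label (face ρ (e , y)) ≡ label (e , y)
      returns    : ∀ c → Reaches (face ρ) (face ρ (base c)) (base c)
      covers     : ∀ e y → Incident G e y → Reaches (face ρ) (base (label (e , y))) (e , y)

  proper-face : ∀ h → Proper (face ρ h)
  proper-face (e , y) = other-incident (next ρ y e)
    where
    other-incident : ∀ e → Incident G e (other G e y)
    other-incident e with proj₁ (ends G e) Fin.≟ y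
    ... | yes _ = inj₂ refl
    ... | no _  = inj₁ refl

  two-cycles : TwoFaces → NumberOfCycles ρ 2
  two-cycles F = record
    { label = label
    ; onto  = λ c → proj₁ (base c) , proj₂ (base c) , proper c , label-base c
    ; same  = λ {e} {y} {e′} {y′} inc inc′ → mk⇔
        (λ eq → reaches-trans (reaches-back (returns (label (e , y))) (covers e y inc))
                  (subst (λ c → Reaches (face ρ) (base c) (e′ , y′)) (sym eq) (covers e′ y′ inc′)))
        (λ (k , eq) → trans (sym (along k {e , y} inc)) (cong label eq))
    }
    where
    open TwoFaces F
    along : ∀ k {h} → Proper h → label (iterate (face ρ) h k) ≡ label h
    along zero    inc = refl
    along (suc k) {e , y} inc = trans (along k (proper-face (e , y))) (label-face e y inc)

  opaque
    face-Cv : ∀ k → face ρ (C k , v) ≡ (C (suc k) , z)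
    face-Cv k rewrite CB.next-far k | CB.near (suc k) = refl

    face-Fw : ∀ k → face ρ (F k , w) ≡ (F (suc k) , z)
    face-Fw k rewrite FB.next-far k | FB.near (suc k) = refl

    face-Cz : ∀ {k} → suc k ℕ.< a → face ρ (C k , z) ≡ (C (suc k) , v)
    face-Cz {k} k< rewrite CB.next-near k k< | CB.far (suc k) = refl

    face-Fz : ∀ {k} → suc k ℕ.< b → face ρ (F k , z) ≡ (F (suc k) , w)
    face-Fz {k} k< rewrite FB.next-near k k< | FB.far (suc k) = refl

    face-Cz-last : face ρ (C a′ , z) ≡ (F 0 , w)
    face-Cz-last rewrite next-CF | FB.far 0 = refl

    face-Fz-last : face ρ (F b′ , z) ≡ (C 0 , v)
    face-Fz-last rewrite next-FC | CB.far 0 = refl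

    face-Fw-last : face ρ (F b′ , w) ≡ (F 0 , z)
    face-Fw-last = trans (face-Fw b′) (cong (_, z) FB.period)

  data View : Edge → Fin 3 → Set where
    Cv : ∀ {k} → k ℕ.< a → View (C k) v
    Cz : ∀ {k} → k ℕ.< a → View (C k) z
    Fz : ∀ {k} → k ℕ.< b → View (F k) z
    Fw : ∀ {k} → k ℕ.< b → View (F k) w

  opaque
    view : ∀ e y → Incident G e y → View e y
    view e 0F inc with CB.surjective {e} inc
    ... | k , k<a , refl = Cv k<a
    view e 2F inc with FB.surjective {e} inc
    ... | k , k<b , refl = Fw k<b
    view e 1F inc with C-or-F e
    ... | inj₁ (k , k<a , refl) = Cz k<a
    ... | inj₂ (k , k<b , refl) = Fz k<b

  same-label : (label : H → Fin 2) → ∀ {h h′ c} → face ρ h ≡ h′ → label h′ ≡ c → label h ≡ c → label (face ρ h) ≡ label h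
  same-label label refl e e′ = trans e (sym e′)

  start : Fin 2 → H
  start 0F = F 0 , w
  start 1F = F 0 , z

  opaque
    -- Within the second bundle a face zigzags between `z` and `w`, advancing by one edge each time.
    -- So there are two strands, from `F 0` entered at `w` and at `z`, and the parity of k tells
    -- which of them meets `F k` at which end.
    alternate : ∀ k → k ℕ.< b →
      Reaches (face ρ) (start (parity k)) (F k , w) × Reaches (face ρ) (start (parity (suc k))) (F k , z)
    alternate zero    _ = reaches-refl , reaches-refl
    alternate (suc k) k+1<b with alternate k (ℕ.<⇒≤ k+1<b)
    ... | to-w , to-z = reaches-trans to-z (reaches-step (face-Fz k+1<b))
      , subst (λ c → Reaches (face ρ) (start c) (F (suc k) , z)) (sym (flip-flip (parity k))) (reaches-trans to-w (reaches-step (face-Fw k)))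

-- For even b each strand closes on itself. The one from (`F 0`, `w`) ends in (`F b′`, `z`) and
-- returns by way of both half-edges of the single edge to `v`; the one from (`F 0`, `z`) ends in
-- (`F b′`, `w`) and returns directly.
module OneEdgeFaces (b′ : ℕ) (b-even : parity (suc b′) ≡ 0F)
  (ρ : Ribbon (twoBundles 1 (suc b′))) (nf : TwoBundles.NormalForm 0 b′ ρ) where
  open TwoBundles 0 b′
  open Trees 0 b′ ρ nf
  open Faces 0 b′ ρ nf

  at : Fin 3 → ℕ → Fin 2
  at 2F k = parity k
  at _  k = parity (suc k)

  label : H → Fin 2
  label (e , y) = [ (λ _ → 0F) , (λ (k , _) → at y k) ]′ (C-or-F e)

  opaque
    label-C : ∀ k y → label (C k , y) ≡ 0F
    label-C k y with C-or-F (C k)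
    ... | inj₁ _           = refl
    ... | inj₂ (_ , _ , e) = contradiction e C≢F

    label-F : ∀ {k} → k ℕ.< b → ∀ y → label (F k , y) ≡ at y k
    label-F {k} k<b y with C-or-F (F k)
    ... | inj₁ (_ , _ , e)   = contradiction (sym e) C≢F
    ... | inj₂ (l , l<b , e) = cong (at y) (FB.injective l<b k<b (sym e))

    label-face : ∀ {e y} → View e y → label (face ρ (e , y)) ≡ label (e , y)
    label-face (Cv {k} _) = same-label label (face-Cv k) (label-C (suc k) z) (label-C k v)
    label-face (Cz {suc k} (s≤s ()))
    label-face (Cz {zero} _) = same-label label face-Cz-last (label-F (s≤s z≤n) w) (label-C 0 z)
    label-face (Fz {k} k<b) with last-or-next k<b
    ... | inj₁ refl = same-label label face-Fz-last (label-C 0 v) (trans (label-F k<b z) b-even)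
    ... | inj₂ lt   = same-label label (face-Fz lt) (label-F lt w) (label-F k<b z)
    label-face (Fw {k} k<b) with last-or-next k<b
    ... | inj₁ refl = same-label label face-Fw-last (label-F (s≤s z≤n) z) (trans (label-F k<b w) (trans (sym (flip-flip (parity k))) (cong flip b-even)))
    ... | inj₂ lt   = same-label label (face-Fw k) (trans (label-F lt z) (flip-flip (parity k))) (label-F k<b w)

    cover-Cv : Reaches (face ρ) (start 0F) (C 0 , v)
    cover-Cv = reaches-trans (subst (λ c → Reaches (face ρ) (start c) (F b′ , z)) b-even (proj₂ (alternate b′ ℕ.≤-refl)))
      (reaches-step face-Fz-last)

    cover-Cz : Reaches (face ρ) (start 0F) (C 0 , z)
    cover-Cz = reaches-trans cover-Cv (reaches-step (trans (face-Cv 0) (cong (_, z) CB.period)))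

    cover : ∀ {h c} → label h ≡ c → Reaches (face ρ) (start c) h → Reaches (face ρ) (start (label h)) h
    cover refl r = r

    covers : ∀ {e y} → View e y → Reaches (face ρ) (start (label (e , y))) (e , y)
    covers (Cv {suc k} (s≤s ()))
    covers (Cv {zero} _)  = cover (label-C 0 v) cover-Cv
    covers (Cz {suc k} (s≤s ()))
    covers (Cz {zero} _)  = cover (label-C 0 z) cover-Cz
    covers (Fz {k} k<b)   = cover (label-F k<b z) (proj₂ (alternate k k<b))
    covers (Fw {k} k<b)   = cover (label-F k<b w) (proj₁ (alternate k k<b))

    odd-last : parity b′ ≡ 1F
    odd-last = trans (sym (flip-flip (parity b′))) (cong flip b-even)

    start-proper : ∀ c → Proper (start c)
    start-proper 0F = FB.incident 0
    start-proper 1F = at-z (F 0)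

    label-start : ∀ c → label (start c) ≡ c
    label-start 0F = label-F (s≤s z≤n) w
    label-start 1F = label-F (s≤s z≤n) z

  two-faces : TwoFaces
  two-faces = record
    { label = label
    ; base = start
    ; proper = start-proper
    ; label-base = label-start
    ; label-face = λ e y inc → label-face (view e y inc)
    ; returns = returns
    ; covers = λ e y inc → covers (view e y inc)
    }
    where
    returns : ∀ c → Reaches (face ρ) (face ρ (start c)) (start c)
    returns 0F = returning cover-Cz face-Cz-last
    returns 1F = returning (subst (λ c → Reaches (face ρ) (start c) (F b′ , w)) odd-last (proj₁ (alternate b′ ℕ.≤-refl))) face-Fw-last

-- For odd b the two strands follow each other and form one face, which also contains (`C 0`, `v`)
-- and (`C 1`, `z`). The other face consists of (`C 0`, `z`) and (`C 1`, `v`): it lies between the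
-- two consecutive edges.
module TwoEdgeFaces (b′ : ℕ) (b-odd : parity b′ ≡ 0F)
  (ρ : Ribbon (twoBundles 2 (suc b′))) (nf : TwoBundles.NormalForm 1 b′ ρ) where
  open TwoBundles 1 b′
  open Trees 1 b′ ρ nf
  open Faces 1 b′ ρ nf

  at : Fin 3 → ℕ → Fin 2
  at 0F 0 = 1F
  at 1F 1 = 1F
  at _  _ = 0F

  label : H → Fin 2
  label (e , y) = [ (λ (k , _) → at y k) , (λ _ → 1F) ]′ (C-or-F e)

  base : Fin 2 → H
  base 0F = C 0 , z
  base 1F = F 0 , w

  opaque
    label-F : ∀ k y → label (F k , y) ≡ 1F
    label-F k y with C-or-F (F k)
    ... | inj₁ (_ , _ , e) = contradiction (sym e) C≢F
    ... | inj₂ _           = refl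

    label-C : ∀ {k} → k ℕ.< a → ∀ y → label (C k , y) ≡ at y k
    label-C {k} k<a y with C-or-F (C k)
    ... | inj₁ (l , l<a , e) = cong (at y) (CB.injective l<a k<a (sym e))
    ... | inj₂ (_ , _ , e)   = contradiction e C≢F

    0<a : 0 ℕ.< a
    0<a = s≤s z≤n

    1<a : 1 ℕ.< a
    1<a = s≤s (s≤s z≤n)

    face-C1v : face ρ (C 1 , v) ≡ (C 0 , z)
    face-C1v = trans (face-Cv 1) (cong (_, z) CB.period)

    label-face : ∀ {e y} → View e y → label (face ρ (e , y)) ≡ label (e , y)
    label-face (Cv {0} _) = same-label label (face-Cv 0) (label-C 1<a z) (label-C 0<a v)
    label-face (Cv {1} _) = same-label label face-C1v (label-C 0<a z) (label-C 1<a v)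
    label-face (Cv {suc (suc k)} (s≤s (s≤s ())))
    label-face (Cz {0} _) = same-label label (face-Cz 1<a) (label-C 1<a v) (label-C 0<a z)
    label-face (Cz {1} _) = same-label label face-Cz-last (label-F 0 w) (label-C 1<a z)
    label-face (Cz {suc (suc k)} (s≤s (s≤s ())))
    label-face (Fw {k} _) = same-label label (face-Fw k) (label-F (suc k) z) (label-F k w)
    label-face (Fz {k} k<b) with last-or-next k<b
    ... | inj₁ refl = same-label label face-Fz-last (label-C 0<a v) (label-F k z)
    ... | inj₂ lt   = same-label label (face-Fz lt) (label-F (suc k) w) (label-F k z)

    first-half : Reaches (face ρ) (start 0F) (start 1F)
    first-half = reaches-trans (subst (λ c → Reaches (face ρ) (start c) (F b′ , w)) b-odd (proj₁ (alternate b′ ℕ.≤-refl)))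
      (reaches-step face-Fw-last)

    from-start : ∀ c {h} → Reaches (face ρ) (start c) h → Reaches (face ρ) (F 0 , w) h
    from-start 0F r = r
    from-start 1F r = reaches-trans first-half r

    cover-Cv : Reaches (face ρ) (F 0 , w) (C 0 , v)
    cover-Cv = reaches-trans (from-start (parity (suc b′)) (proj₂ (alternate b′ ℕ.≤-refl))) (reaches-step face-Fz-last)

    cover-Cz : Reaches (face ρ) (F 0 , w) (C 1 , z)
    cover-Cz = reaches-trans cover-Cv (reaches-step (face-Cv 0))

    cover : ∀ {h c} → label h ≡ c → Reaches (face ρ) (base c) h → Reaches (face ρ) (base (label h)) h
    cover refl r = r

    covers : ∀ {e y} → View e y → Reaches (face ρ) (base (label (e , y))) (e , y)
    covers (Cv {0} _)   = cover (label-C 0<a v) cover-Cv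
    covers (Cv {1} _)   = cover (label-C 1<a v) (reaches-step (face-Cz 1<a))
    covers (Cv {suc (suc k)} (s≤s (s≤s ())))
    covers (Cz {0} _)   = cover (label-C 0<a z) reaches-refl
    covers (Cz {1} _)   = cover (label-C 1<a z) cover-Cz
    covers (Cz {suc (suc k)} (s≤s (s≤s ())))
    covers (Fz {k} k<b) = cover (label-F k z) (from-start (parity (suc k)) (proj₂ (alternate k k<b)))
    covers (Fw {k} k<b) = cover (label-F k w) (from-start (parity k) (proj₁ (alternate k k<b)))

    base-proper : ∀ c → Proper (base c)
    base-proper 0F = at-z (C 0)
    base-proper 1F = FB.incident 0

    label-base : ∀ c → label (base c) ≡ c
    label-base 0F = label-C 0<a z
    label-base 1F = label-F 0 w

  two-faces : TwoFaces
  two-faces = record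
    { label = label
    ; base = base
    ; proper = base-proper
    ; label-base = label-base
    ; label-face = λ e y inc → label-face (view e y inc)
    ; returns = returns
    ; covers = λ e y inc → covers (view e y inc)
    }
    where
    returns : ∀ c → Reaches (face ρ) (face ρ (base c)) (base c)
    returns 0F = returning (reaches-step {x = base 0F} (face-Cz 1<a)) face-C1v
    returns 1F = returning cover-Cz face-Cz-last

module _ where
  open import Data.Integer.Base using (_+_; _-_; _*_; -_)

  -- Picard groups and their characters

  difference⇒sum : ∀ x y {u} → x - y ≡ u → x ≡ y + u
  difference⇒sum x y refl = lem x y
    where
    lem : ∀ x y → x ≡ y + (x - y)
    lem = solve-∀

  module Congruence (M : ℤ) where

    infix 4 _≈_
    record _≈_ (x y : ℤ) : Set where
      constructor _,_
      field
        multiplier : ℤ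
        difference : x ≡ y + multiplier * M

    ≡⇒≈ : ∀ {x y} → x ≡ y → x ≈ y
    ≡⇒≈ {y = y} refl = 0ℤ , lem y M
      where
      lem : ∀ y M → y ≡ y + 0ℤ * M
      lem = solve-∀

    ≈-refl : ∀ {x} → x ≈ x
    ≈-refl = ≡⇒≈ refl

    ≈-sym : ∀ {x y} → x ≈ y → y ≈ x
    ≈-sym {x} {y} (k , refl) = - k , lem y k M
      where
      lem : ∀ y k M → y ≡ (y + k * M) + - k * M
      lem = solve-∀

    ≈-trans : ∀ {x y u} → x ≈ y → y ≈ u → x ≈ u
    ≈-trans {u = u} (k , refl) (l , refl) = l + k , lem u k l M
      where
      lem : ∀ u k l M → (u + l * M) + k * M ≡ u + (l + k) * M
      lem = solve-∀

    +-cong : ∀ {x y x′ y′} → x ≈ y → x′ ≈ y′ → x + x′ ≈ y + y′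
    +-cong {y = y} {y′ = y′} (k , refl) (l , refl) = k + l , lem y y′ k l M
      where
      lem : ∀ y y′ k l M → (y + k * M) + (y′ + l * M) ≡ (y + y′) + (k + l) * M
      lem = solve-∀

    +-congˡ : ∀ x {y y′} → y ≈ y′ → x + y ≈ x + y′
    +-congˡ x e = +-cong (≈-refl {x}) e

    +-congʳ : ∀ x {y y′} → y ≈ y′ → y + x ≈ y′ + x
    +-congʳ x e = +-cong e (≈-refl {x})

    *-cong : ∀ c {x y} → x ≈ y → c * x ≈ c * y
    *-cong c {y = y} (k , refl) = c * k , lem c y k M
      where
      lem : ∀ c y k M → c * (y + k * M) ≡ c * y + (c * k) * M
      lem = solve-∀

    +-≈0 : ∀ {x y} → x ≈ 0ℤ → y ≈ 0ℤ → x + y ≈ 0ℤ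
    +-≈0 = +-cong

    *-≈0 : ∀ c {x} → x ≈ 0ℤ → c * x ≈ 0ℤ
    *-≈0 c e = ≈-trans (*-cong c e) (≡⇒≈ (ℤ.*-zeroʳ c))

    ≈-by : ∀ {x y e} → e ≈ 0ℤ → x ≡ y + e → x ≈ y
    ≈-by {y = y} (k , refl) refl = k , cong (λ i → y + i) (ℤ.+-identityˡ (k * M))

  ⟪_,_⟫ : (Fin 3 → ℤ) → Chips 3 → ℤ
  ⟪ f , D ⟫ = f v * D v + f z * D z + f w * D w

  degree-⟪⟫ : ∀ D → degree D ≡ ⟪ const 1ℤ , D ⟫
  degree-⟪⟫ D = lem (D v) (D z) (D w)
    where
    lem : ∀ x y u → x + (y + (u + 0ℤ)) ≡ 1ℤ * x + 1ℤ * y + 1ℤ * u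
    lem = solve-∀

  ⟪⟫-cong : ∀ f {D D′ : Chips 3} → (∀ y → D y ≡ D′ y) → ⟪ f , D ⟫ ≡ ⟪ f , D′ ⟫
  ⟪⟫-cong f eq rewrite eq v | eq z | eq w = refl

  ⟪⟫-⊕ : ∀ f D D′ → ⟪ f , D ⊕ D′ ⟫ ≡ ⟪ f , D ⟫ + ⟪ f , D′ ⟫
  ⟪⟫-⊕ f D D′ = lem (f v) (f z) (f w) (D v) (D z) (D w) (D′ v) (D′ z) (D′ w)
    where
    lem : ∀ p r q x y u x′ y′ u′ →
      p * (x + x′) + r * (y + y′) + q * (u + u′) ≡ (p * x + r * y + q * u) + (p * x′ + r * y′ + q * u′)
    lem = solve-∀

  ⟪⟫-chip : ∀ f y → ⟪ f , chip y ⟫ ≡ f y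
  ⟪⟫-chip f 0F = lem (f v) (f z) (f w)
    where
    lem : ∀ p r q → p * 1ℤ + r * 0ℤ + q * 0ℤ ≡ p
    lem = solve-∀
  ⟪⟫-chip f 1F = lem (f v) (f z) (f w)
    where
    lem : ∀ p r q → p * 0ℤ + r * 1ℤ + q * 0ℤ ≡ r
    lem = solve-∀
  ⟪⟫-chip f 2F = lem (f v) (f z) (f w)
    where
    lem : ∀ p r q → p * 0ℤ + r * 0ℤ + q * 1ℤ ≡ q
    lem = solve-∀

  ⟪⟫-0 : ∀ f → ⟪ f , const 0ℤ ⟫ ≡ 0ℤ
  ⟪⟫-0 f = lem (f v) (f z) (f w)
    where
    lem : ∀ p r q → p * 0ℤ + r * 0ℤ + q * 0ℤ ≡ 0ℤ
    lem = solve-∀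

  ⟪⟫-sending : ∀ {m} (G : Graph 3 m) f y e → ⟪ f , sending G y e ⟫ ≡ f (other G e y) - f y
  ⟪⟫-sending G f y e = begin
    ⟪ f , sending G y e ⟫
      ≡⟨ lem (f v) (f z) (f w) (chip o v) (chip o z) (chip o w) (chip y v) (chip y z) (chip y w) ⟩
    ⟪ f , chip o ⟫ - ⟪ f , chip y ⟫
      ≡⟨ cong₂ _-_ (⟪⟫-chip f o) (⟪⟫-chip f y) ⟩
    f o - f y  ∎
    where
    open ≡-Reasoning

    o : Fin 3
    o = other G e y

    lem : ∀ p r q x y u x′ y′ u′ →
      p * (x - x′) + r * (y - y′) + q * (u - u′) ≡ (p * x + r * y + q * u) - (p * x′ + r * y′ + q * u′)
    lem = solve-∀

  sum-++ : ∀ a b (f : Fin (a ℕ.+ b) → ℤ) → sum f ≡ sum (λ i → f (i ↑ˡ b)) + sum (λ j → f (a ↑ʳ j))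
  sum-++ zero    b f = sym (ℤ.+-identityˡ (sum f))
  sum-++ (suc a) b f = trans (cong (λ i → f zero + i) (sum-++ a b (f ∘ suc))) (sym (ℤ.+-assoc (f zero) _ _))

  sum-const : ∀ n c → sum {n} (const c) ≡ + n * c
  sum-const zero    c = refl
  sum-const (suc n) c = begin
    c + sum {n} (const c)  ≡⟨ cong (λ i → c + i) (sum-const n c) ⟩
    c + + n * c            ≡⟨ lem (+ n) c ⟩
    (1ℤ + + n) * c         ∎
    where
    open ≡-Reasoning

    lem : ∀ n c → c + n * c ≡ (1ℤ + n) * c
    lem = solve-∀

  sum-two-constants : ∀ a b (f : Fin (a ℕ.+ b) → ℤ) α β → (∀ i → f (i ↑ˡ b) ≡ α) → (∀ j → f (a ↑ʳ j) ≡ β) →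
    sum f ≡ + a * α + + b * β
  sum-two-constants a b f α β eα eβ = trans (sum-++ a b f) (cong₂ _+_
    (trans (sum-cong-≗ {a} eα) (sum-const a α))
    (trans (sum-cong-≗ {b} eβ) (sum-const b β)))

  module Firing (a′ b′ : ℕ) where
    open TwoBundles a′ b′

    private
      carried : Fin 3 → Fin 3 → Edge → ℤ
      carried u y e = if does (incident? G e u) then sending G u e y else 0ℤ

      opaque
        firing-v : ∀ y → firing G v y ≡ + a * (chip z y - chip v y)
        firing-v y = trans (sum-two-constants a b (carried v y) (chip z y - chip v y) 0ℤ c-sends f-sends) (lem (+ b) _)
          where
          c-sends : ∀ i → carried v y (c-edge i) ≡ chip z y - chip v y
          c-sends i rewrite Fin.splitAt-↑ˡ a i b = refl
          f-sends : ∀ j → carried v y (f-edge j) ≡ 0ℤ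
          f-sends j rewrite Fin.splitAt-↑ʳ a b j = refl
          lem : ∀ b x → x + b * 0ℤ ≡ x
          lem = solve-∀

        firing-z : ∀ y → firing G z y ≡ + a * (chip v y - chip z y) + + b * (chip w y - chip z y)
        firing-z y = sum-two-constants a b (carried z y) (chip v y - chip z y) (chip w y - chip z y) c-sends f-sends
          where
          c-sends : ∀ i → carried z y (c-edge i) ≡ chip v y - chip z y
          c-sends i rewrite Fin.splitAt-↑ˡ a i b = refl
          f-sends : ∀ j → carried z y (f-edge j) ≡ chip w y - chip z y
          f-sends j rewrite Fin.splitAt-↑ʳ a b j = refl

        firing-w : ∀ y → firing G w y ≡ + b * (chip z y - chip w y)
        firing-w y = trans (sum-two-constants a b (carried w y) 0ℤ (chip z y - chip w y) c-sends f-sends) (lem (+ a) _)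
          where
          c-sends : ∀ i → carried w y (c-edge i) ≡ 0ℤ
          c-sends i rewrite Fin.splitAt-↑ˡ a i b = refl
          f-sends : ∀ j → carried w y (f-edge j) ≡ chip z y - chip w y
          f-sends j rewrite Fin.splitAt-↑ʳ a b j = refl
          lem : ∀ a x → a * 0ℤ + x ≡ x
          lem = solve-∀

        fired : ∀ (s : Fin 3 → ℤ) y → sum (λ u → s u * firing G u y) ≡
          s v * (+ a * (chip z y - chip v y)) +
          (s z * (+ a * (chip v y - chip z y) + + b * (chip w y - chip z y)) +
          (s w * (+ b * (chip z y - chip w y)) + 0ℤ))
        fired s y = cong₂ _+_ (cong (s v *_) (firing-v y))
          (cong₂ _+_ (cong (s z *_) (firing-z y)) (cong (λ i → s w * i + 0ℤ) (firing-w y)))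

    opaque
      -- Together with `∼-elim` this exhibits Pic⁰ as ℤ/a × ℤ/b through the chips on `v` and `w`.
      -- Firing `v` removes a chips from it, hence the sign in `s`; `z` can stay idle since firing
      -- all three vertices once has no effect, and its chips follow from the degree.
      ∼-intro : ∀ {D D′} α β → D′ v ≡ D v + α * + a → D′ w ≡ D w + β * + b → degree D′ ≡ degree D → G ⊢ D ∼ D′
      ∼-intro {D} {D′} α β ev ew ed = s , eq
        where
        s : Fin 3 → ℤ
        s 0F = - α
        s 1F = 0ℤ
        s 2F = - β

        lem-v : ∀ a b α β x → x + α * a ≡ x + ((- α) * (a * (0ℤ - 1ℤ)) + (0ℤ * (a * (1ℤ - 0ℤ) + b * (0ℤ - 0ℤ)) + ((- β) * (b * (0ℤ - 0ℤ)) + 0ℤ)))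
        lem-v = solve-∀
        lem-w : ∀ a b α β x → x + β * b ≡ x + ((- α) * (a * (0ℤ - 0ℤ)) + (0ℤ * (a * (0ℤ - 0ℤ) + b * (1ℤ - 0ℤ)) + ((- β) * (b * (0ℤ - 1ℤ)) + 0ℤ)))
        lem-w = solve-∀
        from-degree : ∀ x y u → y ≡ (x + (y + (u + 0ℤ))) - x - u
        from-degree = solve-∀
        lem-z : ∀ a b α β x y u → (x + (y + (u + 0ℤ))) - (x + α * a) - (u + β * b) ≡
          y + ((- α) * (a * (1ℤ - 0ℤ)) + (0ℤ * (a * (0ℤ - 1ℤ) + b * (0ℤ - 1ℤ)) + ((- β) * (b * (1ℤ - 0ℤ)) + 0ℤ)))
        lem-z = solve-∀

        eq : ∀ y → D′ y ≡ D y + sum (λ u → s u * firing G u y)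
        eq 0F = trans ev (trans (lem-v (+ a) (+ b) α β (D v)) (cong (λ i → D v + i) (sym (fired s v))))
        eq 1F = trans (from-degree (D′ v) (D′ z) (D′ w))
          (trans (cong₂ _-_ (cong₂ _-_ ed ev) ew)
          (trans (lem-z (+ a) (+ b) α β (D v) (D z) (D w)) (cong (λ i → D z + i) (sym (fired s z)))))
        eq 2F = trans ew (trans (lem-w (+ a) (+ b) α β (D w)) (cong (λ i → D w + i) (sym (fired s w))))

      ∼-elim : ∀ {D D′} → G ⊢ D ∼ D′ →
        (∃₂ λ α β → D′ v ≡ D v + α * + a × D′ w ≡ D w + β * + b) × degree D′ ≡ degree D
      ∼-elim {D} {D′} (s , eq) = (s z - s v , s z - s w , ev , ew) , ed
        where
        lem-v : ∀ a b α β γ x → x + (α * (a * (0ℤ - 1ℤ)) + (γ * (a * (1ℤ - 0ℤ) + b * (0ℤ - 0ℤ)) + (β * (b * (0ℤ - 0ℤ)) + 0ℤ))) ≡ x + (γ - α) * a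
        lem-v = solve-∀
        lem-w : ∀ a b α β γ x → x + (α * (a * (0ℤ - 0ℤ)) + (γ * (a * (0ℤ - 0ℤ) + b * (1ℤ - 0ℤ)) + (β * (b * (0ℤ - 1ℤ)) + 0ℤ))) ≡ x + (γ - β) * b
        lem-w = solve-∀
        lem-z : ∀ a b α β γ x → x + (α * (a * (1ℤ - 0ℤ)) + (γ * (a * (0ℤ - 1ℤ) + b * (0ℤ - 1ℤ)) + (β * (b * (1ℤ - 0ℤ)) + 0ℤ))) ≡ x + (α - γ) * a + (β - γ) * b
        lem-z = solve-∀
        lem-d : ∀ a b α β γ x y u → (x + (γ - α) * a) + ((y + (α - γ) * a + (β - γ) * b) + ((u + (γ - β) * b) + 0ℤ)) ≡ x + (y + (u + 0ℤ))
        lem-d = solve-∀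

        ev : D′ v ≡ D v + (s z - s v) * + a
        ev = trans (eq v) (trans (cong (λ i → D v + i) (fired s v)) (lem-v (+ a) (+ b) (s v) (s w) (s z) (D v)))
        ew : D′ w ≡ D w + (s z - s w) * + b
        ew = trans (eq w) (trans (cong (λ i → D w + i) (fired s w)) (lem-w (+ a) (+ b) (s v) (s w) (s z) (D w)))
        ez : D′ z ≡ D z + (s v - s z) * + a + (s w - s z) * + b
        ez = trans (eq z) (trans (cong (λ i → D z + i) (fired s z)) (lem-z (+ a) (+ b) (s v) (s w) (s z) (D z)))
        ed : degree D′ ≡ degree D
        ed = trans (cong₂ _+_ ev (cong₂ _+_ ez (cong (_+ 0ℤ) ew))) (lem-d (+ a) (+ b) (s v) (s w) (s z) (D v) (D z) (D w))

  -- A homomorphism from chip configurations to ℤ/M, taking p at v, 0 at z and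
  -- q at w, which vanishes on firings and is injective in degree zero.
  record Character (a b : ℕ) (M : ℤ) : Set where
    open Congruence M
    field
      p q       : ℤ
      ap≈0      : + a * p ≈ 0ℤ
      bq≈0      : + b * q ≈ 0ℤ
      q≡1+p     : q ≡ 1ℤ + p
      2p≈0      : p + p ≈ 0ℤ
      faithful  : ∀ {α β} → α * p + β * q ≈ 0ℤ → (∃ λ s → α ≡ s * + a) × (∃ λ t → β ≡ t * + b)

  module PicardCharacter (a′ b′ : ℕ) (M : ℤ) (character : Character (suc a′) (suc b′) M) where
    open TwoBundles a′ b′
    open Firing a′ b′
    open Character character public
    open Congruence M public

    potential : Fin 3 → ℤ
    potential 0F = p
    potential 1F = 0ℤ
    potential 2F = q

    χ : Chips 3 → ℤ
    χ D = ⟪ potential , D ⟫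

    opaque
      χ-sound : ∀ {D D′} → G ⊢ D ∼ D′ → χ D′ ≈ χ D
      χ-sound {D} {D′} D∼D′ with ∼-elim {D} {D′} D∼D′
      ... | (α , β , ev , ew) , _ = ≈-by
        (+-≈0 (*-≈0 α ap≈0) (*-≈0 β bq≈0))
        (trans (cong₂ (λ x u → p * x + 0ℤ * D′ z + q * u) ev ew)
          (lem p q (+ a) (+ b) α β (D v) (D w) (D z) (D′ z)))
        where
        lem : ∀ p q a b α β x u y y′ → p * (x + α * a) + 0ℤ * y′ + q * (u + β * b) ≡
          (p * x + 0ℤ * y + q * u) + (α * (a * p) + β * (b * q))
        lem = solve-∀

      -- As the potential vanishes at `z`, the difference of the two values involves only the
      -- changes at `v` and `w`, and `faithful` turns it into the divisibilities by a and b that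
      -- `∼-intro` asks for.
      χ-complete : ∀ {D D′} → degree D′ ≡ degree D → χ D′ ≈ χ D → G ⊢ D ∼ D′
      χ-complete {D} {D′} ed (k , eq) with faithful {D′ v - D v} {D′ w - D w} (k , combine)
        where
        lem : ∀ p q x u y x′ u′ y′ → (x′ - x) * p + (u′ - u) * q ≡ (p * x′ + 0ℤ * y′ + q * u′) - (p * x + 0ℤ * y + q * u)
        lem = solve-∀
        cancel : ∀ x y → (x + y) - x ≡ 0ℤ + y
        cancel = solve-∀
        combine : (D′ v - D v) * p + (D′ w - D w) * q ≡ 0ℤ + k * M
        combine = trans (lem p q (D v) (D w) (D z) (D′ v) (D′ w) (D′ z))
          (trans (cong (_- χ D) eq) (cancel (χ D) (k * M)))
      ... | (s , es) , (t , et) = ∼-intro {D} {D′} s t (difference⇒sum (D′ v) (D v) es) (difference⇒sum (D′ w) (D w) et) ed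

  double : ∀ n → + (2 ℕ.* n) ≡ + 2 * + n
  double n = ℤ.pos-* 2 n

  odd : ∀ g → + (suc (2 ℕ.* g)) ≡ 1ℤ + + 2 * + g
  odd g = cong (λ i → 1ℤ + i) (double g)

  -- On G, of the 2x residues, x and x + 1 = 2(g + 1) have the orders 2 and x.
  character₂ : ∀ g → Character 2 (suc (2 ℕ.* g)) (+ 2 * + suc (2 ℕ.* g))
  character₂ g = record
    { p = x
    ; q = 1ℤ + x
    ; ap≈0 = 1ℤ , sym (lem₁ x)
    ; bq≈0 = 1ℤ + + g , trans (cong (λ y → x * (1ℤ + y)) (odd g)) (lem₂ x (+ g))
    ; q≡1+p = refl
    ; 2p≈0 = 1ℤ , sym (lem₃ x)
    ; faithful = faithful
    }
    where
    x : ℤ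
    x = + suc (2 ℕ.* g)

    lem₁ : ∀ x → 0ℤ + 1ℤ * (+ 2 * x) ≡ + 2 * x
    lem₁ = solve-∀
    lem₂ : ∀ x g → x * (1ℤ + (1ℤ + + 2 * g)) ≡ 0ℤ + (1ℤ + g) * (+ 2 * x)
    lem₂ = solve-∀
    lem₃ : ∀ x → 0ℤ + 1ℤ * (+ 2 * x) ≡ x + x
    lem₃ = solve-∀

    open Congruence (+ 2 * x)

    faithful : ∀ {α β} → α * x + β * (1ℤ + x) ≈ 0ℤ → (∃ λ s → α ≡ s * + 2) × (∃ λ t → β ≡ t * x)
    faithful {α} {β} (k , e) = (k - n * (1ℤ + + g) , eα) , (n , eβ)
      where
      -- Solving the equation for β gives β = n x with this n. Then α = 2k - β - n = 2k - n (x + 1),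
      -- which is even because x is odd.
      n : ℤ
      n = + 2 * k - α - β

      isolate-β : ∀ α β x → β ≡ (α * x + β * (1ℤ + x)) - (α + β) * x
      isolate-β = solve-∀
      collect-β : ∀ α β k x → (0ℤ + k * (+ 2 * x)) - (α + β) * x ≡ (+ 2 * k - α - β) * x
      collect-β = solve-∀
      eβ : β ≡ n * x
      eβ = trans (isolate-β α β x) (trans (cong (_- (α + β) * x) e) (collect-β α β k x))

      isolate-α : ∀ α β k → α ≡ + 2 * k - β - (+ 2 * k - α - β)
      isolate-α = solve-∀
      collect-α : ∀ n k g → + 2 * k - n * (1ℤ + + 2 * g) - n ≡ (k - n * (1ℤ + g)) * + 2
      collect-α = solve-∀
      eα : α ≡ (k - n * (1ℤ + + g)) * + 2
      eα = trans (isolate-α α β k) (trans (cong (λ y → + 2 * k - y - n) (trans eβ (cong (n *_) (odd g)))) (collect-α n k (+ g)))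

  -- The single edge at `v` is a bridge, so a chip may move freely between `v` and `z`; both get
  -- potential 0, and one chip moved from `v` to `w` generates ℤ/2x.
  character₁ : ∀ x → Character 1 (2 ℕ.* x) (+ 2 * + x)
  character₁ x = record
    { p = 0ℤ
    ; q = 1ℤ
    ; ap≈0 = 0ℤ , refl
    ; bq≈0 = 1ℤ , trans (cong (_* 1ℤ) (double x)) (lem₁ (+ 2 * + x))
    ; q≡1+p = refl
    ; 2p≈0 = 0ℤ , refl
    ; faithful = λ {α} {β} (k , e) → (α , sym (ℤ.*-identityʳ α))
                                   , (k , trans (lem₂ α β) (trans e (trans (ℤ.+-identityˡ _) (cong (k *_) (sym (double x))))))
    }
    where
    open Congruence (+ 2 * + x)

    lem₁ : ∀ y → y * 1ℤ ≡ 0ℤ + 1ℤ * y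
    lem₁ = solve-∀
    lem₂ : ∀ α β → β ≡ α * 0ℤ + β * 1ℤ
    lem₂ = solve-∀

  -- Comparison of two graphs whose trees are labelled by the same cyclic group.

  record Labelling {m} (G : Graph 3 m) (M : ℤ) : Set where
    open Congruence M
    field
      weight           : Fin 3 → ℤ
      weight-z         : weight z ≡ 0ℤ
      weight-w         : weight w ≡ 1ℤ + weight v
      sound            : ∀ {D D′ : Div⁰ 3} → G ⊢ proj₁ D ∼ proj₁ D′ → ⟪ weight , proj₁ D′ ⟫ ≈ ⟪ weight , proj₁ D ⟫
      complete         : ∀ {D D′ : Div⁰ 3} → ⟪ weight , proj₁ D′ ⟫ ≈ ⟪ weight , proj₁ D ⟫ → G ⊢ proj₁ D ∼ proj₁ D′
      label            : SpanningTree G → ℤ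
      label-cong       : ∀ {T T′} → edges {G = G} T ≡ edges {G = G} T′ → label T ≈ label T′
      label-injective  : ∀ {T T′} → label T ≈ label T′ → edges {G = G} T ≡ edges {G = G} T′
      label-surjective : ∀ n → ∃ λ T → label T ≈ n

    class : Div⁰ 3 → ℤ
    class D = ⟪ weight , proj₁ D ⟫

    -- The action is the translation of labels by the signed class. Since labels are bijective on
    -- trees, this contains both existence and uniqueness of the value.
    Exact : Action G → ℤ → Set
    Exact α sgn = ∀ S T T′ → α S T T′ ⇔ (label T′ ≈ label T + sgn * class S)

  -- A representative on `Vgen` for each class, whose class is n for every labelling. It therefore
  -- gives Property 1, and it defines `γ̂` with the same chips on either graph.
  multiple : ℤ → Div⁰ 3
  multiple n = D , lem n
    where
    D : Chips 3
    D 0F = - n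
    D 1F = 0ℤ
    D 2F = n
    lem : ∀ n → - n + (0ℤ + (n + 0ℤ)) ≡ 0ℤ
    lem = solve-∀

  z∉Vgen : z Sub.∉ Vgen
  z∉Vgen = toWitnessFalse {a? = z ∈? Vgen} tt

  multiple-supported : ∀ n → SupportedOn Vgen (multiple n)
  multiple-supported n 0F 0∉ = contradiction Vec.here 0∉
  multiple-supported n 1F _ = refl
  multiple-supported n 2F 2∉ = contradiction (Vec.there (Vec.there Vec.here)) 2∉

  module _ {m} {G : Graph 3 m} {M : ℤ} (X : Labelling G M) where
    open Labelling X
    open Congruence M
    private
      module P = AbelianGroup (Pic⁰ G)

    opaque
      -- With d chips on `w` and -d on `v` the class is d (weight w - weight v) = d. No trace of the
      -- graph is left, which is what makes Property 2 and the description of `γ̂` immediate.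
      class-supported : ∀ D → SupportedOn Vgen D → class D ≡ proj₁ D w
      class-supported (D , deg) supp = begin
        weight v * D v + weight z * D z + weight w * D w
          ≡⟨ cong₂ (λ r q → weight v * D v + r * D z + q * D w) weight-z weight-w ⟩
        weight v * D v + 0ℤ * D z + (1ℤ + weight v) * D w
          ≡⟨ lem (weight v) (D v) (D z) (D w) ⟩
        weight v * (D v + (D z + (D w + 0ℤ))) - weight v * D z + D w
          ≡⟨ cong₂ (λ d y → weight v * d - weight v * y + D w) deg (supp z z∉Vgen) ⟩
        weight v * 0ℤ - weight v * 0ℤ + D w
          ≡⟨ lem′ (weight v) (D w) ⟩
        D w ∎
        where
        open ≡-Reasoning
        lem : ∀ p x y u → p * x + 0ℤ * y + (1ℤ + p) * u ≡ p * (x + (y + (u + 0ℤ))) - p * y + u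
        lem = solve-∀
        lem′ : ∀ p u → p * 0ℤ - p * 0ℤ + u ≡ u
        lem′ = solve-∀

      class-multiple : ∀ n → class (multiple n) ≡ n
      class-multiple n = class-supported (multiple n) (multiple-supported n)

      class-∙ : ∀ D D′ → class (D P.∙ D′) ≡ class D + class D′
      class-∙ (D , _) (D′ , _) = ⟪⟫-⊕ weight D D′

      class-ε : class P.ε ≡ 0ℤ
      class-ε = ⟪⟫-0 weight

      class-⁻¹ : ∀ D → class (D P.⁻¹) ≡ - class D
      class-⁻¹ (D , _) = lem (weight v) (weight z) (weight w) (D v) (D z) (D w)
        where
        lem : ∀ p r q x y u → p * - x + r * - y + q * - u ≡ - (p * x + r * y + q * u)
        lem = solve-∀

    represented : ∀ D → ∃ λ D′ → SupportedOn Vgen D′ × D P.≈ D′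
    represented D = multiple (class D) , multiple-supported (class D) , complete {D} {multiple (class D)} (≡⇒≈ (class-multiple (class D)))

  module Compare {m m′} {G : Graph 3 m} {G′ : Graph 3 m′} {M : ℤ} (X : Labelling G M) (X′ : Labelling G′ M) where
    open Congruence M
    private
      module X  = Labelling X
      module X′ = Labelling X′

    property₁ : Property1 G G′ Vgen
    property₁ = represented X , represented X′

    property₂ : Property2 G G′ Vgen
    property₂ D D′ s s′ = mk⇔ forth back
      where
      same : ∀ D → SupportedOn Vgen D → X.class D ≡ X′.class D
      same D s = trans (class-supported X D s) (sym (class-supported X′ D s))
      forth : G ⊢ proj₁ D ∼ proj₁ D′ → G′ ⊢ proj₁ D ∼ proj₁ D′
      forth e = X′.complete {D} {D′} (≈-trans (≡⇒≈ (sym (same D′ s′))) (≈-trans (X.sound {D} {D′} e) (≡⇒≈ (same D s))))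
      back : G′ ⊢ proj₁ D ∼ proj₁ D′ → G ⊢ proj₁ D ∼ proj₁ D′
      back e = X.complete {D} {D′} (≈-trans (≡⇒≈ (same D′ s′)) (≈-trans (X′.sound {D} {D′} e) (≡⇒≈ (sym (same D s)))))

    γ̂ : Div⁰ 3 → Div⁰ 3
    γ̂ S = multiple (X.class S)

    class-γ̂ : ∀ S → X′.class (γ̂ S) ≡ X.class S
    class-γ̂ S = class-multiple X′ (X.class S)

    γ̂-induced : InducedByIdentity G G′ Vgen γ̂
    γ̂-induced S D s e = X′.complete {γ̂ S} {D}
      (≈-trans (≡⇒≈ (trans (class-supported X′ D s) (sym (class-supported X D s))))
      (≈-trans (X.sound {S} {D} e) (≡⇒≈ (sym (class-γ̂ S)))))

    private
      module P  = AbelianGroup (Pic⁰ G)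
      module P′ = AbelianGroup (Pic⁰ G′)

      equal-class : ∀ {D D′} → X′.class D′ ≡ X′.class D → D P′.≈ D′
      equal-class {D} {D′} e = X′.complete {D} {D′} (≡⇒≈ e)

      γ̂-cong : ∀ {D D′} → D P.≈ D′ → γ̂ D P′.≈ γ̂ D′
      γ̂-cong {D} {D′} e = X′.complete {γ̂ D} {γ̂ D′} (≈-trans (≡⇒≈ (class-γ̂ D′)) (≈-trans (X.sound {D} {D′} e) (≡⇒≈ (sym (class-γ̂ D)))))

      γ̂-injective : ∀ {D D′} → γ̂ D P′.≈ γ̂ D′ → D P.≈ D′
      γ̂-injective {D} {D′} e = X.complete {D} {D′} (≈-trans (≡⇒≈ (sym (class-γ̂ D′))) (≈-trans (X′.sound {γ̂ D} {γ̂ D′} e) (≡⇒≈ (class-γ̂ D))))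

    γ̂-isomorphism : IsIsomorphism (Pic⁰ G) (Pic⁰ G′) γ̂
    γ̂-isomorphism = record
      { isGroupMonomorphism = record
        { isGroupHomomorphism = record
          { isMonoidHomomorphism = record
            { isMagmaHomomorphism = record
              { isRelHomomorphism = record { cong = λ {D} {D′} → γ̂-cong {D} {D′} }
              ; homo = λ D D′ → equal-class {γ̂ (D P.∙ D′)} {γ̂ D P′.∙ γ̂ D′} (trans (class-∙ X′ (γ̂ D) (γ̂ D′))
                  (trans (cong₂ _+_ (class-γ̂ D) (class-γ̂ D′)) (sym (trans (class-γ̂ (D P.∙ D′)) (class-∙ X D D′)))))
              }
            ; ε-homo = equal-class {γ̂ P.ε} {P′.ε} (trans (class-ε X′) (sym (trans (class-γ̂ P.ε) (class-ε X))))
            }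
          ; ⁻¹-homo = λ D → equal-class {γ̂ (D P.⁻¹)} {γ̂ D P′.⁻¹} (trans (class-⁻¹ X′ (γ̂ D))
              (trans (cong -_ (class-γ̂ D)) (sym (trans (class-γ̂ (D P.⁻¹)) (class-⁻¹ X D)))))
          }
        ; injective = λ {D} {D′} → γ̂-injective {D} {D′}
        }
      ; surjective = λ D → multiple (X′.class D) , λ {D′} e → X′.complete {γ̂ D′} {D}
          (≈-trans (≡⇒≈ (sym (class-multiple X (X′.class D))))
          (≈-trans (X.sound {D′} {multiple (X′.class D)} e) (≡⇒≈ (sym (class-γ̂ D′)))))
      }

    φ : SpanningTree G → SpanningTree G′
    φ T = proj₁ (X′.label-surjective (X.label T))

    label-φ : ∀ T → X′.label (φ T) ≈ X.label T
    label-φ T = proj₂ (X′.label-surjective (X.label T))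

    φ-bijection : Bijection (𝒯 G) (𝒯 G′)
    φ-bijection = record
      { to = φ
      ; cong = λ {T} {T′} e → X′.label-injective {φ T} {φ T′}
          (≈-trans (label-φ T) (≈-trans (X.label-cong {T} {T′} e) (≈-sym (label-φ T′))))
      ; bijective
        = (λ {T} {T′} e → X.label-injective {T} {T′}
            (≈-trans (≈-sym (label-φ T)) (≈-trans (X′.label-cong {φ T} {φ T′} e) (label-φ T′))))
        , λ T′ → let T , e = X.label-surjective (X′.label T′) in T , λ {U} e′ →
            X′.label-injective {φ U} {T′} (≈-trans (label-φ U) (≈-trans (X.label-cong {U} {T} e′) e))
      }

    -- On both sides the value is the tree with a prescribed label, and `φ` and `γ̂` preserve labels
    -- and classes. It is essential that the same `sgn` occurs on both graphs.
    intertwines : ∀ {α α′} sgn → X.Exact α sgn → X′.Exact α′ sgn → Intertwines G G′ γ̂ φ α α′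
    intertwines {α} {α′} sgn exact exact′ S T = T′
      , (Equivalence.from (exact S T T′) reached , λ T″ r → X.label-injective {T′} {T″}
          (≈-trans reached (≈-sym (Equivalence.to (exact S T T″) r))))
      , (Equivalence.from (exact′ (γ̂ S) (φ T) (φ T′)) reached′ , λ T″ r → X′.label-injective {φ T′} {T″}
          (≈-trans reached′ (≈-sym (Equivalence.to (exact′ (γ̂ S) (φ T) T″) r))))
      where
      target : ∃ λ T′ → X.label T′ ≈ X.label T + sgn * X.class S
      target = X.label-surjective _

      T′ : SpanningTree G
      T′ = proj₁ target

      reached : X.label T′ ≈ X.label T + sgn * X.class S
      reached = proj₂ target

      reached′ : X′.label (φ T′) ≈ X′.label (φ T) + sgn * X′.class (γ̂ S)
      reached′ = ≈-trans (label-φ T′) (≈-trans reached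
        (+-cong (≈-sym (label-φ T)) (*-cong sgn (≡⇒≈ (sym (class-γ̂ S))))))

  opaque
    residue-unique : ∀ {n i j} → i ℕ.< n → j ℕ.< n → ∀ s → + i ≡ + j + s * + n → i ≡ j
    residue-unique {n} {i} {j} _ _ (+ zero) e = ℤ.+-injective (trans e (ℤ.+-identityʳ (+ j)))
    residue-unique {n} {i} {j} i<n _ (+ suc k) e = contradiction i<n (ℕ.≤⇒≯ (subst (n ℕ.≤_) (sym i≡) (ℕ.≤-trans (ℕ.m≤m+n n (k ℕ.* n)) (ℕ.m≤n+m _ j))))
      where
      i≡ : i ≡ j ℕ.+ suc k ℕ.* n
      i≡ = ℤ.+-injective (trans e (cong (λ x → + j + x) (sym (ℤ.pos-* (suc k) n))))
    residue-unique {n} {i} {j} _ j<n (-[1+ k ]) e = contradiction j<n (ℕ.≤⇒≯ (subst (n ℕ.≤_) (sym j≡) (ℕ.≤-trans (ℕ.m≤m+n n (k ℕ.* n)) (ℕ.m≤n+m _ i))))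
      where
      lem : ∀ j s n → j ≡ (j + (- s) * n) + s * n
      lem = solve-∀
      j≡ : j ≡ i ℕ.+ suc k ℕ.* n
      j≡ = ℤ.+-injective (trans (lem (+ j) (+ suc k) (+ n)) (cong₂ _+_ (sym e) (sym (ℤ.pos-* (suc k) n))))

  -- Labels of spanning trees.

  module Labels (a′ b′ : ℕ) (ρ : Ribbon (twoBundles (suc a′) (suc b′))) (nf : TwoBundles.NormalForm a′ b′ ρ)
                (M : ℤ) (character : Character (suc a′) (suc b′) M) where
    open TwoBundles a′ b′ public
    open PicardCharacter a′ b′ M character public
    open Trees a′ b′ ρ nf public

    t : ℕ → ℕ → ℤ
    t i j = + i * p + + j * q

    opaque
      shape-indices : ∀ {T i j i′ j′} → Shape T i j → Shape T i′ j′ → i ≡ i′ × j ≡ j′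
      shape-indices {i = i} {j} {i′} {j′} S S′ = same-i (Shape.only S (Shape.C∈ S′)) , same-j (Shape.only S (Shape.F∈ S′))
        where
        same-i : C i′ ≡ C i ⊎ C i′ ≡ F j → i ≡ i′
        same-i (inj₁ e) = CB.injective (Shape.i<a S) (Shape.i<a S′) (sym e)
        same-i (inj₂ e) = contradiction e C≢F
        same-j : F j′ ≡ C i ⊎ F j′ ≡ F j → j ≡ j′
        same-j (inj₁ e) = contradiction (sym e) C≢F
        same-j (inj₂ e) = FB.injective (Shape.j<b S) (Shape.j<b S′) (sym e)

      label : SpanningTree G → ℤ
      label T = t (proj₁ (shape T)) (proj₁ (proj₂ (shape T)))

      label-shape : ∀ {T i j} → Shape (edges {G = G} T) i j → label T ≡ t i j
      label-shape {T} S with shape-indices (proj₂ (proj₂ (shape T))) S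
      ... | i≡ , j≡ = cong₂ t i≡ j≡

    opaque
      -- Faithfulness of the character gives i ≡ i′ modulo a and j ≡ j′ modulo b, and all indices
      -- are reduced residues.
      t-injective : ∀ {i j i′ j′} → i ℕ.< a → j ℕ.< b → i′ ℕ.< a → j′ ℕ.< b → t i j ≈ t i′ j′ → i ≡ i′ × j ≡ j′
      t-injective {i} {j} {i′} {j′} i<a j<b i′<a j′<b (k , e)
        with faithful {+ i - + i′} {+ j - + j′} (k , trans (lem₁ (+ i) (+ j) (+ i′) (+ j′) p q) (trans (cong (_- t i′ j′) e) (lem₂ (t i′ j′) (k * M))))
        where
        lem₁ : ∀ i j i′ j′ p q → (i - i′) * p + (j - j′) * q ≡ (i * p + j * q) - (i′ * p + j′ * q)
        lem₁ = solve-∀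
        lem₂ : ∀ x y → (x + y) - x ≡ 0ℤ + y
        lem₂ = solve-∀
      ... | (s , es) , (r , er) = residue-unique i<a i′<a s (difference⇒sum (+ i) (+ i′) es) , residue-unique j<b j′<b r (difference⇒sum (+ j) (+ j′) er)

    opaque
      t-surjective : ∀ n → ∃₂ λ i j → i ℕ.< a × j ℕ.< b × t i j ≈ n
      -- Since q = 1 + p, the pair (-n, n) has label -n p + n (1 + p) = n. Reducing its entries
      -- modulo a and b changes the label by multiples of ap and bq, which vanish.
      t-surjective n = i , j , ℤ.n%ℕd<d (- n) a , ℤ.n%ℕd<d n b , ≈-by (+-≈0 (*-≈0 (- k) ap≈0) (*-≈0 (- l) bq≈0)) (begin
        + i * p + + j * q
          ≡⟨ lem₁ (+ i) (+ j) p q k l (+ a) (+ b) ⟩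
        (+ i + k * + a) * p + (+ j + l * + b) * q + (- k * (+ a * p) + - l * (+ b * q))
          ≡⟨ cong₂ (λ x y → x * p + y * q + (- k * (+ a * p) + - l * (+ b * q))) (sym (ℤ.a≡a%ℕn+[a/ℕn]*n (- n) a)) (sym (ℤ.a≡a%ℕn+[a/ℕn]*n n b)) ⟩
        - n * p + n * q + (- k * (+ a * p) + - l * (+ b * q))
          ≡⟨ cong (λ y → - n * p + n * y + (- k * (+ a * p) + - l * (+ b * q))) q≡1+p ⟩
        - n * p + n * (1ℤ + p) + (- k * (+ a * p) + - l * (+ b * q))
          ≡⟨ lem₂ n p (- k * (+ a * p) + - l * (+ b * q)) ⟩
        n + (- k * (+ a * p) + - l * (+ b * q)) ∎)
        where
        open ≡-Reasoning
        i j : ℕ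
        i = (- n) ℤ.%ℕ a
        j = n ℤ.%ℕ b
        k l : ℤ
        k = (- n) ℤ./ℕ a
        l = n ℤ./ℕ b
        lem₁ : ∀ i j p q k l a b → i * p + j * q ≡ (i + k * a) * p + (j + l * b) * q + ((- k) * (a * p) + (- l) * (b * q))
        lem₁ = solve-∀
        lem₂ : ∀ n p e → (- n) * p + n * (1ℤ + p) + e ≡ n + e
        lem₂ = solve-∀

    opaque
      unfolding label
      label-injective : ∀ {T T′} → label T ≈ label T′ → edges {G = G} T ≡ edges {G = G} T′
      label-injective {T} {T′} e = same (proj₂ (proj₂ (shape T))) (proj₂ (proj₂ (shape T′))) e
        where
        same : ∀ {E E′ i j i′ j′} → Shape E i j → Shape E′ i′ j′ → t i j ≈ t i′ j′ → E ≡ E′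
        same {E} S S′ e with t-injective (Shape.i<a S) (Shape.j<b S) (Shape.i<a S′) (Shape.j<b S′) e
        ... | i≡ , j≡ = shape-unique (subst₂ (Shape E) i≡ j≡ S) S′

    opaque
      unfolding label
      label-cong : ∀ {T T′} → edges {G = G} T ≡ edges {G = G} T′ → label T ≈ label T′
      label-cong {T} {T′} e = ≡⇒≈ (label-shape {T} (subst (λ E → Shape E (proj₁ (shape T′)) (proj₁ (proj₂ (shape T′)))) (sym e) (proj₂ (proj₂ (shape T′)))))

    opaque
      label-surjective : ∀ n → ∃ λ T → label T ≈ n
      label-surjective n with t-surjective n
      ... | i , j , i<a , j<b , e with tree i<a j<b
      ... | T , S = T , ≈-trans (≡⇒≈ (label-shape {T} S)) e

    labelling : Labelling G M
    labelling = record
      { weight = potential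
      ; weight-z = refl
      ; weight-w = q≡1+p
      ; sound = λ {D} {D′} → χ-sound {proj₁ D} {proj₁ D′}
      ; complete = λ {D} {D′} → χ-complete {proj₁ D} {proj₁ D′} (trans (proj₂ D′) (sym (proj₂ D)))
      ; label = label
      ; label-cong = λ {T} {T′} → label-cong {T} {T′}
      ; label-injective = λ {T} {T′} → label-injective {T} {T′}
      ; label-surjective = label-surjective
      }
    open Labelling labelling public using (Exact)

  module Turning (a′ b′ : ℕ) (ρ : Ribbon (twoBundles (suc a′) (suc b′))) (nf : TwoBundles.NormalForm a′ b′ ρ)
                 (M : ℤ) (character : Character (suc a′) (suc b′) M) where
    open Labels a′ b′ ρ nf M character public

    charge : Edge → ℤ
    charge e = [ (λ _ → p) , (λ _ → q) ]′ (C-or-F e)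

    -- The rotation from C 0 or F 0 to e, measured by the character.
    turn : Edge → ℤ
    turn e = [ (λ (k , _) → + k * p) , (λ (k , _) → + k * q) ]′ (C-or-F e)

    opaque
      charge-C : ∀ k → charge (C k) ≡ p
      charge-C k with C-or-F (C k)
      ... | inj₁ _           = refl
      ... | inj₂ (_ , _ , e) = contradiction e C≢F

      charge-F : ∀ k → charge (F k) ≡ q
      charge-F k with C-or-F (F k)
      ... | inj₁ (_ , _ , e) = contradiction (sym e) C≢F
      ... | inj₂ _           = refl

      turn-C : ∀ {k} → k ℕ.< a → turn (C k) ≡ + k * p
      turn-C {k} k<a with C-or-F (C k)
      ... | inj₁ (l , l<a , e) = cong (λ k → + k * p) (CB.injective l<a k<a (sym e))
      ... | inj₂ (_ , _ , e)   = contradiction e C≢F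

      turn-F : ∀ {k} → k ℕ.< b → turn (F k) ≡ + k * q
      turn-F {k} k<b with C-or-F (F k)
      ... | inj₁ (_ , _ , e)   = contradiction (sym e) C≢F
      ... | inj₂ (l , l<b , e) = cong (λ k → + k * q) (FB.injective l<b k<b (sym e))

      suc-* : ∀ k c → + suc k * c ≡ + k * c + c
      suc-* k c = lem (+ k) c
        where
        lem : ∀ k c → (1ℤ + k) * c ≡ k * c + c
        lem = solve-∀

      turn-suc-C : ∀ {k} → k ℕ.< a → turn (C (suc k)) ≈ turn (C k) + p
      turn-suc-C {k} k<a rewrite turn-C k<a with last-or-next k<a
      ... | inj₂ k+1<a rewrite turn-C k+1<a = ≡⇒≈ (suc-* k p)
      ... | inj₁ refl rewrite CB.period | turn-C {0} (s≤s z≤n) = ≈-sym (≈-trans (≡⇒≈ (sym (suc-* k p))) ap≈0)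

      turn-suc-F : ∀ {k} → k ℕ.< b → turn (F (suc k)) ≈ turn (F k) + q
      turn-suc-F {k} k<b rewrite turn-F k<b with last-or-next k<b
      ... | inj₂ k+1<b rewrite turn-F k+1<b = ≡⇒≈ (suc-* k q)
      ... | inj₁ refl rewrite FB.period | turn-F {0} (s≤s z≤n) = ≈-sym (≈-trans (≡⇒≈ (sym (suc-* k q))) bq≈0)

      turn-next-v : ∀ {e} → Incident G e v → turn (next ρ v e) ≈ turn e + p
      turn-next-v {e} inc with CB.surjective {e} inc
      ... | k , k<a , refl rewrite CB.next-far k = turn-suc-C k<a

      turn-next-w : ∀ {e} → Incident G e w → turn (next ρ w e) ≈ turn e + q
      turn-next-w {e} inc with FB.surjective {e} inc
      ... | k , k<b , refl rewrite FB.next-far k = turn-suc-F k<b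

      -- Leaving an edge adds its charge. Passing from the last edge of one bundle to the first of
      -- the other resets the index to 0, and this agrees because ap and bq vanish modulo M; so the
      -- rule has no exception around `z`.
      turn-next-z : ∀ e → turn (next ρ z e) ≈ turn e + charge e
      turn-next-z e with C-or-F e
      ... | inj₁ (k , k<a , refl) with last-or-next k<a
      ...   | inj₂ k+1<a rewrite CB.next-near k k+1<a | turn-C k+1<a = ≡⇒≈ (suc-* k p)
      ...   | inj₁ refl rewrite next-CF | turn-F {0} (s≤s z≤n) = ≈-sym (≈-trans (≡⇒≈ (sym (suc-* k p))) ap≈0)
      turn-next-z e | inj₂ (k , k<b , refl) with last-or-next k<b
      ...   | inj₂ k+1<b rewrite FB.next-near k k+1<b | turn-F k+1<b = ≡⇒≈ (suc-* k q)
      ...   | inj₁ refl rewrite next-FC | turn-C {0} (s≤s z≤n) = ≈-sym (≈-trans (≡⇒≈ (sym (suc-* k q))) bq≈0)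

      near-v : ∀ {e} → Incident G e v → other G e v ≡ z
      near-v {e} inc with CB.surjective {e} inc
      ... | k , _ , refl = CB.near k

      near-w : ∀ {e} → Incident G e w → other G e w ≡ z
      near-w {e} inc with FB.surjective {e} inc
      ... | k , _ , refl = FB.near k

      far-z : ∀ e → other G e z ≡ v ⊎ other G e z ≡ w
      far-z e with C-or-F e
      ... | inj₁ (k , _ , refl) = inj₁ (CB.far k)
      ... | inj₂ (k , _ , refl) = inj₂ (FB.far k)

      charge-other : ∀ e → potential (other G e z) ≡ charge e
      charge-other e with C-or-F e
      ... | inj₁ (k , _ , refl) rewrite CB.far k = refl
      ... | inj₂ (k , _ , refl) rewrite FB.far k = refl

  -- The rotor at `z` enters the heights negatively. Towards `v` it is `C i`, whose sign is
  -- immaterial as 2p vanishes; towards `w` it is `F j`, so there j q appears with the opposite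
  -- sign; towards `z` only the rotors at `v` and `w` count.
  rotorSign : Fin 3 → ℤ
  rotorSign 0F = 1ℤ
  rotorSign 1F = 1ℤ
  rotorSign 2F = -1ℤ

  -- Rotor routing

  private
    replace-left : ∀ x x′ y → x′ + y ≡ x + y + (x′ - x)
    replace-left = solve-∀

    replace-right : ∀ x x′ y → y + x′ ≡ y + x + (x′ - x)
    replace-right = solve-∀

  module RotorRoutingTorsor (a′ b′ : ℕ) (ρ : Ribbon (twoBundles (suc a′) (suc b′))) (nf : TwoBundles.NormalForm a′ b′ ρ)
                            (M : ℤ) (character : Character (suc a′) (suc b′) M) where
    open Turning a′ b′ ρ nf M character

    -- At `v` and `w` an advance adds to `turn` just what the chip loses on its way to `z`. At `z`
    -- the chip gains the charge of the new edge, while `turn` grew by that of the old one;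
    -- subtracting the charge of the current edge as well removes this delay by one edge.
    height : Fin 3 → Edge → ℤ
    height 0F e = turn e
    height 1F e = - (turn e + charge e)
    height 2F e = turn e

    heights : Fin 3 → (Fin 3 → Edge) → ℤ
    heights 0F rot = height z (rot z) + height w (rot w)
    heights 1F rot = height v (rot v) + height w (rot w)
    heights 2F rot = height v (rot v) + height z (rot z)

    opaque
      height-next : ∀ y {e} → Incident G e y →
        height y (next ρ y e) + (potential (other G (next ρ y e) y) - potential y) ≈ height y e
      height-next 0F {e} inc = ≈-trans (+-cong (turn-next-v inc) (≡⇒≈ (cong (λ u → potential u - p) (near-v {next ρ v e} (stays ρ inc))))) (≡⇒≈ (lem (turn e) p))
        where
        lem : ∀ x p → x + p + (0ℤ - p) ≡ x
        lem = solve-∀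
      height-next 2F {e} inc = ≈-trans (+-cong (turn-next-w inc) (≡⇒≈ (cong (λ u → potential u - q) (near-w {next ρ w e} (stays ρ inc))))) (≡⇒≈ (lem (turn e) q))
        where
        lem : ∀ x p → x + p + (0ℤ - p) ≡ x
        lem = solve-∀
      height-next 1F {e} inc = ≈-trans
        (≡⇒≈ (trans (cong (λ c → - (turn e′ + charge e′) + (c - 0ℤ)) (charge-other e′)) (lem (turn e′) (charge e′))))
        (≈-trans (*-cong -1ℤ (turn-next-z e)) (≡⇒≈ (ℤ.-1*i≡-i _)))
        where
        e′ : Edge
        e′ = next ρ z e
        lem : ∀ x c → - (x + c) + (c - 0ℤ) ≡ -1ℤ * x
        lem = solve-∀

    heights-update : ∀ u y → y ≢ u → ∀ rot f → heights u (updateAt rot y f) ≡ heights u rot + (height y (f (rot y)) - height y (rot y))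
    heights-update 0F 0F y≢u = contradiction refl y≢u
    heights-update 1F 1F y≢u = contradiction refl y≢u
    heights-update 2F 2F y≢u = contradiction refl y≢u
    heights-update 0F 1F _ rot f = replace-left (height z (rot z)) (height z (f (rot z))) (height w (rot w))
    heights-update 1F 0F _ rot f = replace-left (height v (rot v)) (height v (f (rot v))) (height w (rot w))
    heights-update 2F 0F _ rot f = replace-left (height v (rot v)) (height v (f (rot v))) (height z (rot z))
    heights-update 0F 2F _ rot f = replace-right (height w (rot w)) (height w (f (rot w))) (height z (rot z))
    heights-update 1F 2F _ rot f = replace-right (height w (rot w)) (height w (f (rot w))) (height v (rot v))
    heights-update 2F 1F _ rot f = replace-right (height z (rot z)) (height z (f (rot z))) (height v (rot v))

    Attached : Fin 3 → (Fin 3 → Edge) → Set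
    Attached u rot = ∀ y → y ≢ u → Incident G (rot y) y

    State : Set
    State = Chips 3 × (Fin 3 → Edge)

    level : Fin 3 → State → ℤ
    level u (D , rot) = χ D + heights u rot

    opaque
      attached-step : ∀ {u rot} y → Attached u rot → Attached u (updateAt rot y (next ρ y))
      attached-step {u} {rot} y att y′ y′≢u with y′ Fin.≟ y
      ... | yes refl = subst (λ e → Incident G e y) (sym (updateAt-updates y rot)) (stays ρ (att y y′≢u))
      ... | no y′≢y  = subst (λ e → Incident G e y′) (sym (updateAt-minimal y′ y rot y′≢y)) (att y′ y′≢u)

      degree-sending : ∀ y e D → degree (D ⊕ sending G y e) ≡ degree D
      degree-sending y e D = begin
        degree (D ⊕ sending G y e)                          ≡⟨ degree-⟪⟫ (D ⊕ sending G y e) ⟩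
        ⟪ one , D ⊕ sending G y e ⟫                         ≡⟨ ⟪⟫-⊕ one D (sending G y e) ⟩
        ⟪ one , D ⟫ + ⟪ one , sending G y e ⟫               ≡⟨ cong (λ i → ⟪ one , D ⟫ + i) (⟪⟫-sending G one y e) ⟩
        ⟪ one , D ⟫ + 0ℤ                                    ≡⟨ ℤ.+-identityʳ ⟪ one , D ⟫ ⟩
        ⟪ one , D ⟫                                         ≡⟨ sym (degree-⟪⟫ D) ⟩
        degree D                                            ∎
        where
        open ≡-Reasoning
        one : Fin 3 → ℤ
        one _ = 1ℤ

      level-step : ∀ u y → y ≢ u → ∀ D rot → Attached u rot →
        level u (D ⊕ sending G y (next ρ y (rot y)) , updateAt rot y (next ρ y)) ≈ level u (D , rot)
      level-step u y y≢u D rot att = ≈-trans (≡⇒≈ (trans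
          (cong₂ _+_ (trans (⟪⟫-⊕ potential D (sending G y e′)) (cong (λ i → χ D + i) (⟪⟫-sending G potential y e′))) (heights-update u y y≢u rot (next ρ y)))
          (lem₁ (χ D) (potential (other G e′ y) - potential y) (heights u rot) (height y e′) (height y (rot y)))))
        (≈-trans (+-congˡ (χ D + heights u rot - height y (rot y)) (height-next y {rot y} (att y y≢u))) (≡⇒≈ (lem₂ (χ D) (heights u rot) (height y (rot y)))))
        where
        e′ : Edge
        e′ = next ρ y (rot y)
        lem₁ : ∀ c d h x′ x → (c + d) + (h + (x′ - x)) ≡ (c + h - x) + (x′ + d)
        lem₁ = solve-∀
        lem₂ : ∀ c h x → (c + h - x) + x ≡ c + h
        lem₂ = solve-∀

    opaque
      run-invariant : ∀ {u s s′} → Star (RotorStep ρ u) s s′ → Attached u (proj₂ s) →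
        level u s′ ≈ level u s × degree (proj₁ s′) ≡ degree (proj₁ s)
      run-invariant ε _ = ≈-refl , refl
      run-invariant {u} (advance {D} {rot} y y≢u _ ◅ steps) att with run-invariant steps (attached-step {u} {rot} y att)
      ... | lev , deg = ≈-trans lev (level-step u y y≢u D rot att) , trans deg (degree-sending y (next ρ y (rot y)) D)

      empty : ∀ u {D : Chips 3} → (∀ y → y ≢ u → D y ≡ 0ℤ) → degree D ≡ 0ℤ → χ D ≡ 0ℤ
      empty u {D} off deg = trans (⟪⟫-cong potential {D} {λ _ → 0ℤ} (zeros u off)) (⟪⟫-0 potential)
        where
        at-v′ : ∀ x y u → x ≡ (x + (y + (u + 0ℤ))) - y - u
        at-v′ = solve-∀
        at-z′ : ∀ x y u → y ≡ (x + (y + (u + 0ℤ))) - x - u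
        at-z′ = solve-∀
        at-w′ : ∀ x y u → u ≡ (x + (y + (u + 0ℤ))) - x - y
        at-w′ = solve-∀
        minus : ∀ {d x y} → d ≡ 0ℤ → x ≡ 0ℤ → y ≡ 0ℤ → d - x - y ≡ 0ℤ
        minus refl refl refl = refl
        zeros : ∀ u → (∀ y → y ≢ u → D y ≡ 0ℤ) → ∀ y → D y ≡ 0ℤ
        zeros u off y with y Fin.≟ u
        ... | no y≢u = off y y≢u
        zeros 0F off 0F | yes refl = trans (at-v′ (D v) (D z) (D w)) (minus deg (off z λ ()) (off w λ ()))
        zeros 1F off 1F | yes refl = trans (at-z′ (D v) (D z) (D w)) (minus deg (off v λ ()) (off w λ ()))
        zeros 2F off 2F | yes refl = trans (at-w′ (D v) (D z) (D w)) (minus deg (off v λ ()) (off z λ ()))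

    offset : Fin 3 → ℤ
    offset 0F = p
    offset 1F = 0ℤ
    offset 2F = - q

    opaque
      -- When the sink is `v` or `w`, the terms i p and j q occur in the heights with opposite
      -- signs. Replacing -i p by i p costs i (p + p), which vanishes, and leaves a common sign.
      height-heading : ∀ {i j} → i ℕ.< a → j ℕ.< b → ∀ u →
        t i j ≈ rotorSign u * heights u (λ y → heading i j y u) + offset u
      height-heading {i} {j} i<a j<b 0F rewrite turn-C i<a | charge-C i | turn-F j<b =
        ≈-by (*-≈0 (+ i) 2p≈0) (lem (+ i) (+ j) p q)
        where
        lem : ∀ i j p q → i * p + j * q ≡ 1ℤ * (- (i * p + p) + j * q) + p + i * (p + p)
        lem = solve-∀
      height-heading {i} {j} i<a j<b 1F rewrite turn-C i<a | turn-F j<b = ≡⇒≈ (lem (+ i) (+ j) p q)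
        where
        lem : ∀ i j p q → i * p + j * q ≡ 1ℤ * (i * p + j * q) + 0ℤ
        lem = solve-∀
      height-heading {i} {j} i<a j<b 2F rewrite turn-C i<a | charge-F j | turn-F j<b =
        ≈-by (*-≈0 (+ i) 2p≈0) (lem (+ i) (+ j) p q)
        where
        lem : ∀ i j p q → i * p + j * q ≡ -1ℤ * (i * p + - (j * q + q)) + - q + i * (p + p)
        lem = solve-∀

      heights-cong : ∀ u {rot rot′} → (∀ y → y ≢ u → rot y ≡ rot′ y) → heights u rot ≡ heights u rot′
      heights-cong 0F eq rewrite eq z (λ ()) | eq w (λ ()) = refl
      heights-cong 1F eq rewrite eq v (λ ()) | eq w (λ ()) = refl
      heights-cong 2F eq rewrite eq v (λ ()) | eq z (λ ()) = refl

    opaque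
      label-heights : ∀ u T {rot} → OrientedTowards ρ u T rot → label T ≈ rotorSign u * heights u rot + offset u
      label-heights u T {rot} oriented = from (proj₂ (proj₂ (shape T)))
        where
        from : ∀ {i j} → Shape (edges {G = G} T) i j → label T ≈ rotorSign u * heights u rot + offset u
        from {i} {j} S = ≈-trans (≡⇒≈ (label-shape {T} S)) (≈-trans (height-heading (Shape.i<a S) (Shape.j<b S) u)
          (≡⇒≈ (cong (λ h → rotorSign u * h + offset u) (sym (heights-cong u (λ y y≢u → path-heading S y u y≢u (oriented y y≢u)))))))

      oriented-attached : ∀ u T {rot} → OrientedTowards ρ u T rot → Attached u rot
      oriented-attached u T {rot} oriented y y≢u with oriented y y≢u
      ... | _ , step _ joins _ , _ = joins-incident {rot y} joins

    opaque
      -- At the end the chips contribute nothing: they are gone away from the sink, and the degree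
      -- is 0, so the sink is empty too. Hence the heights of the rotors have absorbed χ of the
      -- start, whichever representative and order of moves was chosen.
      routed-label : ∀ u S T T′ → RotorRouting ρ u S T T′ → label T′ ≈ label T + rotorSign u * χ (proj₁ S)
      routed-label u S T T′ routing = ≈-trans (label-heights u T′ orientedTowards′)
        (≈-trans (+-congʳ (offset u) (*-cong (rotorSign u) heights≈))
        (≈-trans (≡⇒≈ (lem (rotorSign u) (χ (proj₁ S)) (heights u rotors) (offset u)))
          (+-congʳ (rotorSign u * χ (proj₁ S)) (≈-sym (label-heights u T orientedTowards)))))
        where
        open RotorRouting routing
        lem : ∀ e c h o → e * (c + h) + o ≡ (e * h + o) + e * c
        lem = solve-∀
        invariant : level u (final , rotors′) ≈ level u (start , rotors) × degree final ≡ degree start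
        invariant = run-invariant run (oriented-attached u T orientedTowards)
        degree-start : degree start ≡ 0ℤ
        degree-start = trans (proj₂ (∼-elim {proj₁ S} {start} representative)) (proj₂ S)
          where open Firing a′ b′
        heights≈ : heights u rotors′ ≈ χ (proj₁ S) + heights u rotors
        heights≈ = ≈-trans (≡⇒≈ (trans (sym (ℤ.+-identityˡ (heights u rotors′))) (cong (_+ heights u rotors′) (sym (empty u finished (trans (proj₂ invariant) degree-start))))))
          (≈-trans (proj₁ invariant) (+-congʳ (heights u rotors) (χ-sound {proj₁ S} {start} representative)))

  opaque
    chip-same : ∀ {n} (y : Fin n) → chip y y ≡ 1ℤ
    chip-same y with y Fin.≟ y
    ... | yes _  = refl
    ... | no y≢y = contradiction refl y≢y

    chip-other : ∀ {n} {x y : Fin n} → x ≢ y → chip x y ≡ 0ℤ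
    chip-other {x = x} {y} x≢y with x Fin.≟ y
    ... | yes x≡y = contradiction x≡y x≢y
    ... | no _    = refl

  module _ {n m} (G : Graph n m) {e : Fin m} {y y′ : Fin n} (out : other G e y ≡ y′) (D : Chips n) where

    opaque
      fired-source : y′ ≢ y → ∀ {N} → D y ≡ + suc N → (D ⊕ sending G y e) y ≡ + N
      fired-source y′≢y {N} eq rewrite out | eq | chip-other y′≢y | chip-same y = refl

      fired-target : y′ ≢ y → ∀ {N} → D y′ ≡ + N → (D ⊕ sending G y e) y′ ≡ + suc N
      fired-target y′≢y {N} eq rewrite out | eq | chip-same y′ | chip-other (λ e → y′≢y (sym e)) = cong +_ (ℕ.+-comm N 1)

      fired-elsewhere : ∀ {x} → y ≢ x → y′ ≢ x → (D ⊕ sending G y e) x ≡ D x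
      fired-elsewhere {x} y≢x y′≢x rewrite out | chip-other y≢x | chip-other y′≢x = ℤ.+-identityʳ (D x)

  positive : ∀ {x N} → x ≡ + suc N → 0ℤ ℤ.< x
  positive refl = ℤ.+<+ (s≤s z≤n)

  -- Existence of terminating runs of the rotor routing process.

  module RotorRoutingExact (a′ b′ : ℕ) (ρ : Ribbon (twoBundles (suc a′) (suc b′))) (nf : TwoBundles.NormalForm a′ b′ ρ)
                           (M : ℤ) (character : Character (suc a′) (suc b′) M) where
    open Turning a′ b′ ρ nf M character
    open RotorRoutingTorsor a′ b′ ρ nf M character

    -- `o` is the outer vertex other than the sink `u`. The condition `leaves` keeps the rotors at
    -- `z` and `o` from pointing at each other, so that the final rotors form a tree.
    record Drains (u o : Fin 3) (N : ℕ) (s : State) : Set where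
      field
        {final}  : Chips 3
        {rotors} : Fin 3 → Edge
        run      : Star (RotorStep ρ u) s (final , rotors)
        attached : Attached u rotors
        none     : final z ≡ 0ℤ
        left     : final o ≡ + N
        leaves   : other G (rotors z) z ≡ u

    module Far (o u : Fin 3) (z≢u : z ≢ u) (o≢u : o ≢ u) (o≢z : o ≢ z)
               (near-o : ∀ {e} → Incident G e o → other G e o ≡ z)
               (far : ∀ e → other G e z ≡ o ⊎ other G e z ≡ u)
               (exit : Edge) (exit-u : other G exit z ≡ u) where

      z≢o : z ≢ o
      z≢o e = o≢z (sym e)

      prepend : ∀ {N s s′} → RotorStep ρ u s s′ → Drains u o N s′ → Drains u o N s
      prepend s→s′ drained = record
        { run = s→s′ ◅ run ; attached = attached ; none = none ; left = left ; leaves = leaves }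
        where open Drains drained

      opaque
        -- The chip at z returns from o until the rotor at z points to u, after k turns.
        send-one : ∀ k D rot {N} → Attached u rot → D z ≡ 1ℤ → D o ≡ + N →
          other G (iterate (next ρ z) (next ρ z (rot z)) k) z ≡ u → Drains u o N (D , rot)
        send-one k D rot {N} att one left hits = go k (far (next ρ z (rot z))) hits
          where
          e₁ : Edge
          e₁ = next ρ z (rot z)
          D₁ : Chips 3
          D₁ = D ⊕ sending G z e₁
          rot₁ : Fin 3 → Edge
          rot₁ = updateAt rot z (next ρ z)
          first : RotorStep ρ u (D , rot) (D₁ , rot₁)
          first = advance z z≢u (positive {N = 0} one)
          att₁ : Attached u rot₁
          att₁ = attached-step {u} {rot} z att

          e₂ : Edge
          e₂ = next ρ o (rot₁ o)
          D₂ : Chips 3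
          D₂ = D₁ ⊕ sending G o e₂
          rot₂ : Fin 3 → Edge
          rot₂ = updateAt rot₁ o (next ρ o)
          returns : other G e₂ o ≡ z
          returns = near-o {e₂} (stays ρ (att₁ o o≢u))

          go : ∀ k → other G e₁ z ≡ o ⊎ other G e₁ z ≡ u → other G (iterate (next ρ z) e₁ k) z ≡ u → Drains u o N (D , rot)
          go _ (inj₂ out) _ = record
            { run      = first ◅ ε
            ; attached = att₁
            ; none     = fired-source G {e₁} out D (λ e → z≢u (sym e)) one
            ; left     = trans (fired-elsewhere G {e₁} out D z≢o (λ e → o≢u (sym e))) left
            ; leaves   = out
            }
          go zero (inj₁ out) hits = contradiction (trans (sym out) hits) o≢u
          go (suc k) (inj₁ out) hits = prepend first (prepend (advance o o≢u (positive left₁))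
            (send-one k D₂ rot₂ (attached-step {u} {rot₁} o att₁)
              (fired-target G {e₂} returns D₁ z≢o none₁)
              (fired-source G {e₂} returns D₁ z≢o left₁)
              (subst (λ e → other G (iterate (next ρ z) (next ρ z e) k) z ≡ u) (sym (updateAt-minimal z o rot₁ z≢o)) hits)))
            where
            none₁ : D₁ z ≡ + 0
            none₁ = fired-source G {e₁} out D o≢z one
            left₁ : D₁ o ≡ + suc N
            left₁ = fired-target G {e₁} out D o≢z left

      opaque
        -- One chip at a time is brought from `o` to the sink, and `z` is empty again before the
        -- next one starts.
        drain : ∀ N D rot → Attached u rot → D z ≡ 0ℤ → D o ≡ + N → other G (rot z) z ≡ u → Drains u o 0 (D , rot)
        drain zero D rot att none left leaves = record
          { run = ε ; attached = att ; none = none ; left = left ; leaves = leaves }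
        drain (suc N) D rot att none left leaves = record
          { run = advance o o≢u (positive left) ◅ (Drains.run one ◅◅ Drains.run rest)
          ; attached = Drains.attached rest ; none = Drains.none rest ; left = Drains.left rest ; leaves = Drains.leaves rest }
          where
          e₁ : Edge
          e₁ = next ρ o (rot o)
          D₁ : Chips 3
          D₁ = D ⊕ sending G o e₁
          rot₁ : Fin 3 → Edge
          rot₁ = updateAt rot o (next ρ o)
          returns : other G e₁ o ≡ z
          returns = near-o {e₁} (stays ρ (att o o≢u))
          -- Cyclicity at `z` bounds how often the chip can be sent back to `o`: the rotor reaches
          -- `exit` after finitely many turns, and this number drives the recursion of `send-one`.
          reach : Reaches (next ρ z) (next ρ z (rot₁ z)) exit
          reach = cyclic ρ {u = z} {next ρ z (rot₁ z)} {exit} (at-z (next ρ z (rot₁ z))) (at-z exit)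
          one : Drains u o N (D₁ , rot₁)
          one = send-one (proj₁ reach) D₁ rot₁ (attached-step {u} {rot} o att)
            (fired-target G {e₁} returns D z≢o none) (fired-source G {e₁} returns D z≢o left)
            (trans (cong (λ e → other G e z) (proj₂ reach)) exit-u)
          rest : Drains u o 0 (Drains.final one , Drains.rotors one)
          rest = drain N (Drains.final one) (Drains.rotors one) (Drains.attached one) (Drains.none one) (Drains.left one) (Drains.leaves one)

    record Fires (y : Fin 3) (s : State) : Set where
      field
        {final}  : Chips 3
        {rotors} : Fin 3 → Edge
        run      : Star (RotorStep ρ z) s (final , rotors)
        attached : Attached z rotors
        none     : final y ≡ 0ℤ
        others   : ∀ {x} → y ≢ x → z ≢ x → final x ≡ proj₁ s x

    opaque
      fire : ∀ y → y ≢ z → (∀ {e} → Incident G e y → other G e y ≡ z) →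
        ∀ N D rot → Attached z rot → D y ≡ + N → Fires y (D , rot)
      fire y y≢z near zero D rot att eq = record
        { run = ε ; attached = att ; none = eq ; others = λ _ _ → refl }
      fire y y≢z near (suc N) D rot att eq = record
        { run      = advance y y≢z (positive eq) ◅ Fires.run rest
        ; attached = Fires.attached rest
        ; none     = Fires.none rest
        ; others   = λ y≢x z≢x → trans (Fires.others rest y≢x z≢x) (fired-elsewhere G {e₁} returns D y≢x z≢x)
        }
        where
        e₁ : Edge
        e₁ = next ρ y (rot y)
        D₁ : Chips 3
        D₁ = D ⊕ sending G y e₁
        rot₁ : Fin 3 → Edge
        rot₁ = updateAt rot y (next ρ y)
        returns : other G e₁ y ≡ z
        returns = near {e₁} (stays ρ (att y y≢z))
        rest : Fires y (D₁ , rot₁)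
        rest = fire y y≢z (λ {e} → near {e}) N D₁ rot₁ (attached-step {z} {rot} y att)
          (fired-source G {e₁} returns D (λ e → y≢z (sym e)) eq)

    opaque
      -- A nonnegative representative is found modulo ab, which is visibly positive, rather than
      -- modulo the abstract integer M. That ab vanishes modulo M follows from ba = a (bq) - b (ap)
      -- with q = 1 + p.
      residue : ∀ n → ∃ λ N → + N ≈ n
      residue n = N , ≈-by {e = - k * b*a} (*-≈0 (- k) b*a≈0) (trans (lem (+ N) k b*a)
        (cong (_+ - k * b*a) (trans (cong (λ x → + N + k * x) (sym (ℤ.pos-* b a))) (sym (ℤ.a≡a%ℕn+[a/ℕn]*n n (b ℕ.* a))))))
        where
        N : ℕ
        N = n ℤ.%ℕ (b ℕ.* a)
        k b*a : ℤ
        k = n ℤ./ℕ (b ℕ.* a)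
        b*a = + b * + a
        lem : ∀ n k x → n ≡ (n + k * x) + (- k) * x
        lem = solve-∀
        difference : ∀ a b p → b * a ≡ a * (b * (1ℤ + p)) + (- b) * (a * p)
        difference = solve-∀
        b*a≈0 : b*a ≈ 0ℤ
        b*a≈0 = ≈-trans (≡⇒≈ (trans (difference (+ a) (+ b) p) (cong (λ q → + a * (+ b * q) + - + b * (+ a * p)) (sym q≡1+p))))
          (+-≈0 (*-≈0 (+ a) bq≈0) (*-≈0 (- + b) ap≈0))

      rotors-tree : ∀ u {rot i j} → i ℕ.< a → j ℕ.< b → (∀ y → y ≢ u → rot y ≡ heading i j y u) →
        ∃ λ T → OrientedTowards ρ u T rot
      rotors-tree u {rot} {i} {j} i<a j<b eq = from (tree i<a j<b)
        where
        from : (∃ λ (T : SpanningTree G) → Shape (edges {G = G} T) i j) → ∃ λ T → OrientedTowards ρ u T rot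
        from (T , S) = T , λ y y≢u → subst (Path S y u) (sym (eq y y≢u)) (path S y u y≢u)

      tree-rotors : ∀ u T → ∃ λ rot → OrientedTowards ρ u T rot
      tree-rotors u T = from (proj₂ (proj₂ (shape T)))
        where
        from : ∀ {i j} → Shape (edges {G = G} T) i j → ∃ λ rot → OrientedTowards ρ u T rot
        from {i} {j} S = (λ y → heading i j y u) , path′
          where
          path′ : OrientedTowards ρ u T (λ y → heading i j y u)
          path′ y y≢u = path S y u y≢u

      towards-v : ∀ e → other G e z ≡ v → ∃ λ k → k ℕ.< a × e ≡ C k
      towards-v e out with C-or-F e
      ... | inj₁ found = found
      ... | inj₂ (k , _ , refl) = contradiction (trans (sym out) (FB.far k)) λ ()

      towards-w : ∀ e → other G e z ≡ w → ∃ λ k → k ℕ.< b × e ≡ F k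
      towards-w e out with C-or-F e
      ... | inj₂ found = found
      ... | inj₁ (k , _ , refl) = contradiction (trans (sym out) (CB.far k)) λ ()

      heading-leaves-v : ∀ T {rot} → OrientedTowards ρ v T rot → other G (rot z) z ≡ v
      heading-leaves-v T oriented = trans (cong (λ e → other G e z) (path-heading S z v (λ ()) (oriented z λ ()))) (CB.far _)
        where
        S : Shape (edges {G = G} T) (proj₁ (shape T)) (proj₁ (proj₂ (shape T)))
        S = proj₂ (proj₂ (shape T))

      heading-leaves-w : ∀ T {rot} → OrientedTowards ρ w T rot → other G (rot z) z ≡ w
      heading-leaves-w T oriented = trans (cong (λ e → other G e z) (path-heading S z w (λ ()) (oriented z λ ()))) (FB.far _)
        where
        S : Shape (edges {G = G} T) (proj₁ (shape T)) (proj₁ (proj₂ (shape T)))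
        S = proj₂ (proj₂ (shape T))

    far-z′ : ∀ e → other G e z ≡ w ⊎ other G e z ≡ v
    far-z′ e = [ inj₂ , inj₁ ]′ (far-z e)

    module ToV = Far w v (λ ()) (λ ()) (λ ()) (λ {e} inc → near-w {e} inc) far-z′ (C 0) (CB.far 0)
    module ToW = Far v w (λ ()) (λ ()) (λ ()) (λ {e} inc → near-v {e} inc) far-z (F 0) (FB.far 0)

    opaque
      -- For an outer sink all chips are put on the opposite outer vertex and the debt on the sink.
      -- The sink `z` separates `v` and `w`, so there both get nonnegative chips and fire
      -- independently.
      route : ∀ u S T → ∃ λ T′ → RotorRouting ρ u S T T′
      route 0F S T = T′ , record
        { representative = χ-complete {proj₁ S} {start} (trans (proj₂ (multiple (+ N))) (sym (proj₂ S)))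
            (≈-trans (≡⇒≈ (class-multiple labelling (+ N))) (proj₂ (residue (χ (proj₁ S)))))
        ; nonnegative = λ { 0F v≢v → contradiction refl v≢v ; 1F _ → ℤ.≤-refl ; 2F _ → ℤ.+≤+ z≤n }
        ; orientedTowards = proj₂ (tree-rotors v T)
        ; run = run
        ; finished = λ { 0F v≢v → contradiction refl v≢v ; 1F _ → none ; 2F _ → left }
        ; orientedTowards′ = proj₂ final-tree
        }
        where
        N : ℕ
        N = proj₁ (residue (χ (proj₁ S)))
        start : Chips 3
        start = proj₁ (multiple (+ N))
        rot : Fin 3 → Edge
        rot = proj₁ (tree-rotors v T)
        drained : Drains v w 0 (start , rot)
        drained = ToV.drain N start rot (oriented-attached v T (proj₂ (tree-rotors v T))) refl refl
          (heading-leaves-v T (proj₂ (tree-rotors v T)))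
        open Drains drained
        final-tree : ∃ λ T′ → OrientedTowards ρ v T′ rotors
        final-tree with towards-v (rotors z) leaves | FB.surjective {rotors w} (attached w λ ())
        ... | i , i<a , eᵢ | j , j<b , eⱼ = rotors-tree v i<a j<b
          λ { 0F v≢v → contradiction refl v≢v ; 1F _ → eᵢ ; 2F _ → eⱼ }
        T′ : SpanningTree G
        T′ = proj₁ final-tree
      route 2F S T = T′ , record
        { representative = χ-complete {proj₁ S} {start} (trans (proj₂ (multiple (- + N))) (sym (proj₂ S)))
            (≈-trans (≡⇒≈ (class-multiple labelling (- + N))) (≈-trans (≡⇒≈ (sym (ℤ.-1*i≡-i (+ N))))
              (≈-trans (*-cong -1ℤ (proj₂ (residue (- χ (proj₁ S))))) (≡⇒≈ (lem (χ (proj₁ S)))))))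
        ; nonnegative = λ { 0F _ → subst (0ℤ ℤ.≤_) (sym at-v-N) (ℤ.+≤+ z≤n) ; 1F _ → ℤ.≤-refl ; 2F w≢w → contradiction refl w≢w }
        ; orientedTowards = proj₂ (tree-rotors w T)
        ; run = run
        ; finished = λ { 0F _ → left ; 1F _ → none ; 2F w≢w → contradiction refl w≢w }
        ; orientedTowards′ = proj₂ final-tree
        }
        where
        lem : ∀ x → -1ℤ * - x ≡ x
        lem = solve-∀
        N : ℕ
        N = proj₁ (residue (- χ (proj₁ S)))
        start : Chips 3
        start = proj₁ (multiple (- + N))
        at-v-N : start v ≡ + N
        at-v-N = ℤ.neg-involutive (+ N)
        rot : Fin 3 → Edge
        rot = proj₁ (tree-rotors w T)
        drained : Drains w v 0 (start , rot)
        drained = ToW.drain N start rot (oriented-attached w T (proj₂ (tree-rotors w T))) refl at-v-N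
          (heading-leaves-w T (proj₂ (tree-rotors w T)))
        open Drains drained
        final-tree : ∃ λ T′ → OrientedTowards ρ w T′ rotors
        final-tree with CB.surjective {rotors v} (attached v λ ()) | towards-w (rotors z) leaves
        ... | i , i<a , eᵢ | j , j<b , eⱼ = rotors-tree w i<a j<b
          λ { 0F _ → eᵢ ; 1F _ → eⱼ ; 2F w≢w → contradiction refl w≢w }
        T′ : SpanningTree G
        T′ = proj₁ final-tree
      route 1F S T = T′ , record
        { representative = χ-complete {proj₁ S} {start} (trans (degree-start (+ N) (+ N′)) (sym (proj₂ S)))
            (≈-trans (≡⇒≈ (lem₁ p q (+ N) (+ N′)))
              (≈-trans (+-cong (*-cong p (proj₂ (residue (- χ (proj₁ S))))) (*-cong q (proj₂ (residue (χ (proj₁ S))))))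
                (≡⇒≈ (trans (cong (λ q → p * - χ (proj₁ S) + q * χ (proj₁ S)) q≡1+p) (lem₂ p (χ (proj₁ S)))))))
        ; nonnegative = λ { 0F _ → ℤ.+≤+ z≤n ; 1F z≢z → contradiction refl z≢z ; 2F _ → ℤ.+≤+ z≤n }
        ; orientedTowards = proj₂ (tree-rotors z T)
        ; run = Fires.run from-v ◅◅ Fires.run from-w
        ; finished = λ { 0F _ → trans (Fires.others from-w (λ ()) (λ ())) (Fires.none from-v)
                       ; 1F z≢z → contradiction refl z≢z ; 2F _ → Fires.none from-w }
        ; orientedTowards′ = proj₂ final-tree
        }
        where
        N N′ : ℕ
        -- With c = χ of `S`, taking -c chips on `v` and c on `w` has value -p c + (1 + p) c = c;
        -- both counts are then made nonnegative.
        N  = proj₁ (residue (- χ (proj₁ S)))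
        N′ = proj₁ (residue (χ (proj₁ S)))
        start : Chips 3
        start 0F = + N
        start 1F = - (+ N + + N′)
        start 2F = + N′
        degree-start : ∀ n n′ → n + (- (n + n′) + (n′ + 0ℤ)) ≡ 0ℤ
        degree-start = solve-∀
        lem₁ : ∀ p q n n′ → p * n + 0ℤ * - (n + n′) + q * n′ ≡ p * n + q * n′
        lem₁ = solve-∀
        lem₂ : ∀ p x → p * - x + (1ℤ + p) * x ≡ x
        lem₂ = solve-∀
        rot : Fin 3 → Edge
        rot = proj₁ (tree-rotors z T)
        from-v : Fires v (start , rot)
        from-v = fire v (λ ()) (λ {e} inc → near-v {e} inc) N start rot (oriented-attached z T (proj₂ (tree-rotors z T))) refl
        from-w : Fires w (Fires.final from-v , Fires.rotors from-v)
        from-w = fire w (λ ()) (λ {e} inc → near-w {e} inc) N′ _ _ (Fires.attached from-v) (Fires.others from-v (λ ()) (λ ()))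
        final-tree : ∃ λ T′ → OrientedTowards ρ z T′ (Fires.rotors from-w)
        final-tree with CB.surjective {Fires.rotors from-w v} (Fires.attached from-w v λ ())
                      | FB.surjective {Fires.rotors from-w w} (Fires.attached from-w w λ ())
        ... | i , i<a , eᵢ | j , j<b , eⱼ = rotors-tree z i<a j<b
          λ { 0F _ → eᵢ ; 1F z≢z → contradiction refl z≢z ; 2F _ → eⱼ }
        T′ : SpanningTree G
        T′ = proj₁ final-tree

    opaque
      rotor-exact : ∀ u → Exact (RotorRouting ρ u) (rotorSign u)
      rotor-exact u S T T′ = mk⇔ (routed-label u S T T′) (λ e → from e (route u S T))
        where
        from : label T′ ≈ label T + rotorSign u * χ (proj₁ S) → ∃ (RotorRouting ρ u S T) → RotorRouting ρ u S T T′
        -- The run found ends in some tree `T″`. Its label agrees with that of `T′`, so the edge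
        -- sets agree, and the orientation conditions mention nothing but the edge set.
        from e (T″ , routing) = record
          { representative   = representative
          ; nonnegative      = nonnegative
          ; orientedTowards  = orientedTowards
          ; run              = run
          ; finished         = finished
          ; orientedTowards′ = subst Oriented (label-injective {T″} {T′} (≈-trans (routed-label u S T T″ routing) (≈-sym e))) orientedTowards′
          }
          where
          open RotorRouting routing
          Oriented : Subset m → Set
          Oriented E = ∀ y → y ≢ u → ∃ λ es → Walk (ends G) E y u (rotors′ y ∷ es) × Unique (rotors′ y ∷ es)

  -- The Bernardi process

  ∈-ʳ++⁺ˡ : {A : Set} {x : A} (l : List A) {hs : List A} → x ∈ hs → x ∈ l ʳ++ hs
  ∈-ʳ++⁺ˡ []      x∈ = x∈
  ∈-ʳ++⁺ˡ (_ ∷ l) x∈ = ∈-ʳ++⁺ˡ l (there x∈)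

  ∈-ʳ++⁺ʳ : {A : Set} {x : A} (l : List A) {hs : List A} → x ∈ l → x ∈ l ʳ++ hs
  ∈-ʳ++⁺ʳ (_ ∷ l) (here refl) = ∈-ʳ++⁺ˡ l (here refl)
  ∈-ʳ++⁺ʳ (_ ∷ l) (there x∈)  = ∈-ʳ++⁺ʳ l x∈

  ∈-ʳ++⁻ : {A : Set} {x : A} (l : List A) {hs : List A} → x ∈ l ʳ++ hs → x ∈ l ⊎ x ∈ hs
  ∈-ʳ++⁻ []      x∈ = inj₂ x∈
  ∈-ʳ++⁻ (_ ∷ l) x∈ with ∈-ʳ++⁻ l x∈
  ... | inj₁ x∈l          = inj₁ (there x∈l)
  ... | inj₂ (here refl)  = inj₁ (here refl)
  ... | inj₂ (there x∈hs) = inj₂ x∈hs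

  -- Tours as chains of half-edges, and the effect of changing their starting point.

  module Touring {m} {G : Graph 3 m} (ρ : Ribbon G) (T : Subset m) where

    H : Set
    H = HalfEdge ρ

    σ : H → H
    σ = tourNext ρ T

    opposite : H → H
    opposite (e , y) = e , other G e y

    -- The end is not listed. Chains thus concatenate without overlap, and a chain from h to h lists
    -- the period of a tour once.
    data Chain : H → List H → H → Set where
      []   : ∀ {h} → Chain h [] h
      link : ∀ {h l h′} → Chain (σ h) l h′ → Chain h (h ∷ l) h′

    opaque
      σ-cotree : ∀ {e x} → e Sub.∉ T → σ (e , x) ≡ (next ρ x e , x)
      σ-cotree {e} ∉T rewrite dec-false (e ∈? T) ∉T = refl

      σ-tree : ∀ {e x} → e Sub.∈ T → σ (e , x) ≡ (next ρ (other G e x) e , other G e x)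
      σ-tree {e} ∈T rewrite dec-true (e ∈? T) ∈T = refl

      link-≡ : ∀ {h x l h′} → σ h ≡ x → Chain x l h′ → Chain h (h ∷ l) h′
      link-≡ refl c = link c

    chain-++ : ∀ {h l h′ l′ h″} → Chain h l h′ → Chain h′ l′ h″ → Chain h (l ++ l′) h″
    chain-++ []       c′ = c′
    chain-++ (link c) c′ = link (chain-++ c c′)

    chain-split : ∀ {h} l {x l′ h′} → Chain h (l ++ x ∷ l′) h′ → Chain h l x × Chain x (x ∷ l′) h′
    chain-split []      (link c) = [] , link c
    chain-split (_ ∷ l) (link c) with chain-split l c
    ... | c₁ , c₂ = link c₁ , c₂

    opaque
      value : (Fin 3 → ℤ) → List H → H → ℤ
      value f hs h = ⟪ f , tourPlace ρ T hs h ⟫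

    placed : (Fin 3 → ℤ) → List H → List H → ℤ
    placed f hs []      = 0ℤ
    placed f hs (h ∷ l) = value f hs h + placed f (h ∷ hs) l

    opaque
      unfolding value

      value-tree : ∀ f hs {e y} → e Sub.∈ T → value f hs (e , y) ≡ 0ℤ
      value-tree f hs {e} e∈T rewrite dec-true (e ∈? T) e∈T = ⟪⟫-0 f

      value-old : ∀ f hs {e y} → (e , other G e y) ∈ hs → value f hs (e , y) ≡ 0ℤ
      value-old f hs {e} {y} old
        rewrite dec-true (DecMembership._∈?_ (_≟ʰ_ ρ) (e , other G e y) hs) old | ∨-zeroʳ (does (e ∈? T)) = ⟪⟫-0 f

      value-new : ∀ f hs {e y} → e Sub.∉ T → (e , other G e y) ∉ hs → value f hs (e , y) ≡ f y
      value-new f hs {e} {y} e∉T new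
        rewrite dec-false (e ∈? T) e∉T | dec-false (DecMembership._∈?_ (_≟ʰ_ ρ) (e , other G e y) hs) new = ⟪⟫-chip f y

      value-cong : ∀ f {hs hs′ e y} → ((e , other G e y) ∈ hs → (e , other G e y) ∈ hs′) →
        ((e , other G e y) ∈ hs′ → (e , other G e y) ∈ hs) → value f hs (e , y) ≡ value f hs′ (e , y)
      value-cong f {hs} {hs′} {e} {y} to from = cases (e ∈? T) (DecMembership._∈?_ (_≟ʰ_ ρ) (e , other G e y) hs)
        where
        cases : Dec (e Sub.∈ T) → Dec ((e , other G e y) ∈ hs) → value f hs (e , y) ≡ value f hs′ (e , y)
        cases (yes e∈T) _       = trans (value-tree f hs {e} {y} e∈T) (sym (value-tree f hs′ {e} {y} e∈T))
        cases (no _) (yes old)  = trans (value-old f hs {e} {y} old) (sym (value-old f hs′ {e} {y} (to old)))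
        cases (no e∉T) (no new) = trans (value-new f hs {e} {y} e∉T new) (sym (value-new f hs′ {e} {y} e∉T (new ∘ from)))

    placed-++ : ∀ f hs l l′ → placed f hs (l ++ l′) ≡ placed f hs l + placed f (l ʳ++ hs) l′
    placed-++ f hs []      l′ = sym (ℤ.+-identityˡ (placed f hs l′))
    placed-++ f hs (h ∷ l) l′ = trans (cong (λ i → value f hs h + i) (placed-++ f (h ∷ hs) l l′)) (sym (ℤ.+-assoc (value f hs h) _ _))

    opaque
      unfolding value

      -- The divisor is recorded by its pairing with an arbitrary function: constant 1 will give its
      -- degree, the potential its class.
      tour : ∀ {h₀} l {h hs D} → Chain (σ h) l h₀ → h₀ ∉ l →
        ∃ λ D′ → Tour ρ T h₀ hs h D D′ × (∀ f → ⟪ f , D′ ⟫ ≡ ⟪ f , D ⟫ + placed f hs (h ∷ l))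
      tour [] {h} {hs} {D} [] _ = _ , stop refl , λ f →
        trans (⟪⟫-⊕ f D (tourPlace ρ T hs h)) (cong (λ i → ⟪ f , D ⟫ + i) (sym (ℤ.+-identityʳ (value f hs h))))
      tour (_ ∷ l) {h} {hs} {D} (link c) h₀∉ with tour l {hs = h ∷ hs} {D = D ⊕ tourPlace ρ T hs h} c (λ h₀∈ → h₀∉ (there h₀∈))
      ... | D′ , t , eq = D′ , continue (λ e → h₀∉ (here (sym e))) t , λ f →
        trans (eq f) (trans (cong (_+ placed f (h ∷ hs) (σ h ∷ l)) (⟪⟫-⊕ f D (tourPlace ρ T hs h)))
          (ℤ.+-assoc ⟪ f , D ⟫ (value f hs h) _))

    tour-unique : ∀ {h₀ hs h D D₁ D₂} → Tour ρ T h₀ hs h D D₁ → Tour ρ T h₀ hs h D D₂ → D₁ ≡ D₂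
    tour-unique (stop _)       (stop _)       = refl
    tour-unique (stop e)       (continue ¬e _) = contradiction e ¬e
    tour-unique (continue ¬e _) (stop e)       = contradiction e ¬e
    tour-unique (continue _ t) (continue _ t′) = tour-unique t t′

    record Complete (l : List H) : Set where
      field
        unique      : Unique l
        involutive  : ∀ {h} → h ∈ l → opposite (opposite h) ≡ h
        closed      : ∀ {h} → h ∈ l → opposite h ∈ l
        proper      : ∀ {h} → h ∈ l → opposite h ≢ h

    -- The change of the placed chips when the tour starts one step later: the
    -- edge passed in this step, if it is not in the tree, is then met from its
    -- other end first.
    change : (Fin 3 → ℤ) → H → ℤ
    change f (e , y) = if does (e ∈? T) then 0ℤ else f (other G e y) - f y

    changes : (Fin 3 → ℤ) → List H → ℤ
    changes f []      = 0ℤ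
    changes f (h ∷ l) = change f h + changes f l

    opaque
      change-tree : ∀ f {e y} → e Sub.∈ T → change f (e , y) ≡ 0ℤ
      change-tree f {e} e∈T rewrite dec-true (e ∈? T) e∈T = refl

      change-cotree : ∀ f {e y} → e Sub.∉ T → change f (e , y) ≡ f (other G e y) - f y
      change-cotree f {e} e∉T rewrite dec-false (e ∈? T) e∉T = refl

      placed-last : ∀ f hs l {h} → opposite h ∈ l ⊎ opposite h ∈ hs → placed f hs (l ∷ʳ h) ≡ placed f hs l
      placed-last f hs [] (inj₂ old) = trans (ℤ.+-identityʳ _) (value-old f hs old)
      placed-last f hs (x ∷ l) opp = cong (λ i → value f hs x + i) (placed-last f (x ∷ hs) l (move opp))
        where
        move : ∀ {h} → opposite h ∈ x ∷ l ⊎ opposite h ∈ hs → opposite h ∈ l ⊎ opposite h ∈ x ∷ hs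
        move (inj₁ (here e))   = inj₂ (here e)
        move (inj₁ (there h∈)) = inj₁ h∈
        move (inj₂ h∈)         = inj₂ (there h∈)

      value-unaffected : ∀ f hs h {x} → opposite x ≢ h → value f (hs ∷ʳ h) x ≡ value f hs x
      value-unaffected f hs h {x} x≢h = value-cong f {hs ∷ʳ h} {hs}
        (λ x∈ → [ (λ x∈hs → x∈hs) , (λ { (here e) → contradiction e x≢h }) ]′ (∈-++⁻ hs x∈)) ∈-++⁺ˡ

      -- Passed half-edges are stored newest first, so `hs ∷ʳ h` means that h was passed at the very
      -- beginning. Only the opposite half-edge consults this, and only off the tree.
      placed-unaffected : ∀ f hs h l → (∀ {x} → x ∈ l → opposite x ≢ h ⊎ proj₁ x Sub.∈ T) → placed f (hs ∷ʳ h) l ≡ placed f hs l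
      placed-unaffected f hs h []      _  = refl
      placed-unaffected f hs h (x ∷ l) un = cong₂ _+_ (same (un (here refl))) (placed-unaffected f (x ∷ hs) h l (λ x∈ → un (there x∈)))
        where
        same : opposite x ≢ h ⊎ proj₁ x Sub.∈ T → value f (hs ∷ʳ h) x ≡ value f hs x
        same (inj₁ x≢h) = value-unaffected f hs h x≢h
        same (inj₂ x∈T) = trans (value-tree f (hs ∷ʳ h) x∈T) (sym (value-tree f hs x∈T))

      -- If h does not belong to the past, its opposite is the first half-edge of that edge to be
      -- met and receives the chip; with h in the past it receives none.
      placed-affected : ∀ f hs h l → proj₁ h Sub.∉ T → Unique l → h ∉ l → h ∉ hs → opposite h ∈ l →
        (∀ {x} → x ∈ l → opposite (opposite x) ≡ x) → opposite (opposite h) ≡ h →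
        placed f hs l ≡ placed f (hs ∷ʳ h) l + f (proj₂ (opposite h))
      placed-affected f hs h (x ∷ l) h∉T uniq h∉l h∉hs (here refl) inv invʰ = begin
        value f hs x + placed f (x ∷ hs) l
          ≡⟨ cong₂ _+_ (value-new f hs h∉T (subst (_∉ hs) (sym invʰ) h∉hs))
               (sym (placed-unaffected f (x ∷ hs) h l λ {y} y∈ → inj₁ λ e →
                 Unique[x∷xs]⇒x∉xs uniq (subst (_∈ l) (trans (sym (inv (there y∈))) (cong opposite e)) y∈))) ⟩
        f (proj₂ x) + placed f ((x ∷ hs) ∷ʳ h) l
          ≡⟨ ℤ.+-comm (f (proj₂ x)) _ ⟩
        placed f ((x ∷ hs) ∷ʳ h) l + f (proj₂ x)
          ≡⟨ cong (_+ f (proj₂ x)) (sym (trans (cong (_+ placed f ((x ∷ hs) ∷ʳ h) l)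
               (value-old f (hs ∷ʳ h) (∈-++⁺ʳ hs (here invʰ)))) (ℤ.+-identityˡ (placed f ((x ∷ hs) ∷ʳ h) l)))) ⟩
        value f (hs ∷ʳ h) x + placed f ((x ∷ hs) ∷ʳ h) l + f (proj₂ x) ∎
        where open ≡-Reasoning
      placed-affected f hs h (x ∷ l) h∉T (x∉ ∷ uniq) h∉l h∉hs (there opp∈) inv invʰ = begin
        value f hs x + placed f (x ∷ hs) l
          ≡⟨ cong₂ _+_ (sym (value-unaffected f hs h opp-x≢h))
               (placed-affected f (x ∷ hs) h l h∉T uniq (λ h∈ → h∉l (there h∈)) h∉x∷hs opp∈ (λ x∈ → inv (there x∈)) invʰ) ⟩
        value f (hs ∷ʳ h) x + (placed f ((x ∷ hs) ∷ʳ h) l + f (proj₂ (opposite h)))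
          ≡⟨ sym (ℤ.+-assoc (value f (hs ∷ʳ h) x) _ _) ⟩
        value f (hs ∷ʳ h) x + placed f ((x ∷ hs) ∷ʳ h) l + f (proj₂ (opposite h)) ∎
        where
        open ≡-Reasoning
        opp-x≢h : opposite x ≢ h
        opp-x≢h e = All.lookup x∉ opp∈ (trans (sym (inv (here refl))) (cong opposite e))
        h∉x∷hs : h ∉ x ∷ hs
        h∉x∷hs (here e)   = h∉l (here e)
        h∉x∷hs (there h∈) = h∉hs h∈

      -- Moved to the end, h places nothing, since its opposite has been passed by then. For an edge
      -- outside the tree the chip moves from the vertex of h to the other endpoint, which is
      -- `change f h`.
      placed-rotate₁ : ∀ f h l → Complete (h ∷ l) → placed f [] (l ∷ʳ h) ≡ placed f [] (h ∷ l) + change f h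
      placed-rotate₁ f h@(e , y) l comp with closed (here refl)
        where open Complete comp
      ... | here e≡ = contradiction e≡ (Complete.proper comp (here refl))
      ... | there opp∈ with e ∈? T
      ...   | yes e∈T = trans (placed-last f [] l (inj₁ opp∈)) (sym (trans (ℤ.+-identityʳ _)
              (trans (cong (_+ placed f (h ∷ []) l) (value-tree f [] e∈T)) (trans (ℤ.+-identityˡ _)
                (placed-unaffected f [] h l unaffected)))))
        where
        open Complete comp
        unaffected : ∀ {x} → x ∈ l → opposite x ≢ h ⊎ proj₁ x Sub.∈ T
        unaffected {x} x∈ with proj₁ x ∈? T
        ... | yes x∈T = inj₂ x∈T
        ... | no x∉T  = inj₁ λ x≡ → x∉T (subst (Sub._∈ T) (sym (cong proj₁ x≡)) e∈T)
      ...   | no e∉T = begin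
        placed f [] (l ∷ʳ h)                               ≡⟨ placed-last f [] l (inj₁ opp∈) ⟩
        placed f [] l                                      ≡⟨ placed-affected f [] h l e∉T (tail unique) (Unique[x∷xs]⇒x∉xs unique) (λ ())
                                                                opp∈ (λ x∈ → involutive (there x∈)) (involutive (here refl)) ⟩
        placed f (h ∷ []) l + f (other G e y)              ≡⟨ lem (f y) (f (other G e y)) (placed f (h ∷ []) l) ⟩
        f y + placed f (h ∷ []) l + (f (other G e y) - f y) ≡⟨ cong (λ i → i + placed f (h ∷ []) l + (f (other G e y) - f y)) (sym (value-new f [] e∉T λ ())) ⟩
        placed f [] (h ∷ l) + (f (other G e y) - f y)      ∎
        where
        open ≡-Reasoning
        open Complete comp
        tail : ∀ {x : H} {l} → Unique (x ∷ l) → Unique l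
        tail (_ ∷ u) = u
        lem : ∀ x y p → p + y ≡ x + p + (y - x)
        lem = solve-∀

    complete-rotate : ∀ {h l} → Complete (h ∷ l) → Complete (l ∷ʳ h)
    complete-rotate {h} {l} comp = record
      { unique     = ++⁺ (tail unique) ([] ∷ []) (λ { (h∈ , here refl) → Unique[x∷xs]⇒x∉xs unique h∈ })
      ; involutive = involutive ∘ back
      ; closed     = forth ∘ closed ∘ back
      ; proper     = proper ∘ back
      }
      where
      open Complete comp
      tail : ∀ {x : H} {l} → Unique (x ∷ l) → Unique l
      tail (_ ∷ u) = u
      back : ∀ {x} → x ∈ l ∷ʳ h → x ∈ h ∷ l
      back x∈ with ∈-++⁻ l x∈
      ... | inj₁ x∈l       = there x∈l
      ... | inj₂ (here e)  = here e
      forth : ∀ {x} → x ∈ h ∷ l → x ∈ l ∷ʳ h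
      forth (here e)   = ∈-++⁺ʳ l (here e)
      forth (there x∈) = ∈-++⁺ˡ x∈

    opaque
      placed-rotate : ∀ f l l′ → Complete (l ++ l′) → placed f [] (l′ ++ l) ≡ placed f [] (l ++ l′) + changes f l × Complete (l′ ++ l)
      placed-rotate f [] l′ comp rewrite ++-identityʳ l′ = sym (ℤ.+-identityʳ _) , comp
      placed-rotate f (h ∷ l) l′ comp with placed-rotate f l (l′ ∷ʳ h) (subst Complete (++-assoc l l′ (h ∷ [])) (complete-rotate comp))
      ... | eq , comp′ = trans (cong (placed f []) (sym (++-assoc l′ (h ∷ []) l)))
                         (trans eq (trans (cong (λ l → placed f [] l + _) (sym (++-assoc l l′ (h ∷ []))))
                         (trans (cong (_+ changes f l) (placed-rotate₁ f h (l ++ l′) comp))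
                                (ℤ.+-assoc (placed f [] (h ∷ l ++ l′)) (change f h) (changes f l)))))
                       , subst Complete (++-assoc l′ (h ∷ []) l) comp′

      -- Moving chips does not change their number; this makes the degree of the divisor independent
      -- of the start.
      changes-constant : ∀ c l → changes (const c) l ≡ 0ℤ
      changes-constant c []            = refl
      changes-constant c ((e , y) ∷ l) with e ∈? T
      ... | yes _ = trans (ℤ.+-identityˡ _) (changes-constant c l)
      ... | no _  = trans (cong (_+ changes (const c) l) (ℤ.+-inverseʳ c)) (trans (ℤ.+-identityˡ _) (changes-constant c l))

  ∷-unique : {A : Set} {x : A} {l : List A} → x ∉ l → Unique l → Unique (x ∷ l)
  ∷-unique {x = x} {l} x∉ uniq = All.tabulate (λ y∈ e → x∉ (subst (_∈ l) (sym e) y∈)) ∷ uniq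

  -- The part of the tour that passes through one bundle.

  module Excursion (a′ b′ : ℕ) (ρ : Ribbon (twoBundles (suc a′) (suc b′)))
    {y : Fin 3} {n : ℕ} {E : ℕ → TwoBundles.Edge a′ b′} (bundle : TwoBundles.Bundle a′ b′ ρ y n E) (y≢z : y ≢ z)
    (T : Subset (TwoBundles.m a′ b′)) {i r : ℕ} (n≡ : n ≡ suc (i ℕ.+ r))
    (E∈T : E i Sub.∈ T) (only : ∀ {k} → k ℕ.< n → E k Sub.∈ T → k ≡ i)
    (exit : TwoBundles.Edge a′ b′) (next-exit : ∀ {s} → suc s ≡ n → next ρ z (E s) ≡ exit)
    where
    open TwoBundles a′ b′
    open Bundle bundle
    open Touring ρ T

    seg : Fin 3 → ℕ → ℕ → List H
    seg x s zero    = []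
    seg x s (suc l) = (E s , x) ∷ seg x (suc s) l

    -- The tour turns at `z` up to the tree edge `E i`, crosses it, makes a full turn at `y`
    -- starting just after `E i`, crosses back and finishes the bundle at `z`. The turn at `y` is
    -- split where the numbering wraps round to `E 0`.
    excursion : List H
    excursion = seg z 0 i ++ (E i , z) ∷ seg y (suc i) r ++ seg y 0 i ++ (E i , y) ∷ seg z (suc i) r

    i<n : i ℕ.< n
    i<n = subst (i ℕ.<_) (sym n≡) (s≤s (ℕ.m≤m+n i r))

    cotree : ∀ {k} → k ℕ.< n → k ≢ i → E k Sub.∉ T
    cotree k<n k≢i ∈T = k≢i (only k<n ∈T)

    opaque
      chain-before-z : ∀ l s → s ℕ.+ l ≡ i → Chain (E s , z) (seg z s l) (E i , z)
      chain-before-z zero s eq rewrite trans (sym (ℕ.+-identityʳ s)) eq = []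
      chain-before-z (suc l) s eq = link-≡ (trans (σ-cotree (cotree (ℕ.<-trans s<i i<n) (ℕ.<⇒≢ s<i)))
          (cong (_, z) (next-near s (ℕ.≤-<-trans s<i i<n))))
        (chain-before-z l (suc s) eq′)
        where
        eq′ : suc s ℕ.+ l ≡ i
        eq′ = trans (sym (ℕ.+-suc s l)) eq
        s<i : s ℕ.< i
        s<i = subst (suc s ℕ.≤_) eq′ (ℕ.m≤m+n (suc s) l)

      chain-before-y : ∀ l s → s ℕ.+ l ≡ i → Chain (E s , y) (seg y s l) (E i , y)
      chain-before-y zero s eq rewrite trans (sym (ℕ.+-identityʳ s)) eq = []
      chain-before-y (suc l) s eq = link-≡ (trans (σ-cotree (cotree (ℕ.<-trans s<i i<n) (ℕ.<⇒≢ s<i)))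
          (cong (_, y) (next-far s)))
        (chain-before-y l (suc s) eq′)
        where
        eq′ : suc s ℕ.+ l ≡ i
        eq′ = trans (sym (ℕ.+-suc s l)) eq
        s<i : s ℕ.< i
        s<i = subst (suc s ℕ.≤_) eq′ (ℕ.m≤m+n (suc s) l)

      chain-after-y : ∀ l s → i ℕ.< s → s ℕ.+ l ≡ n → Chain (E s , y) (seg y s l) (E 0 , y)
      chain-after-y zero s i<s eq rewrite trans (sym (ℕ.+-identityʳ s)) eq | period = []
      chain-after-y (suc l) s i<s eq = link-≡ (trans (σ-cotree (cotree s<n (ℕ.>⇒≢ i<s))) (cong (_, y) (next-far s)))
        (chain-after-y l (suc s) (ℕ.m<n⇒m<1+n i<s) eq′)
        where
        eq′ : suc s ℕ.+ l ≡ n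
        eq′ = trans (sym (ℕ.+-suc s l)) eq
        s<n : s ℕ.< n
        s<n = subst (suc s ℕ.≤_) eq′ (ℕ.m≤m+n (suc s) l)

      -- The source is `next ρ z (E s)` and not `E (suc s)`: after the last edge the former is
      -- `exit`, whereas the latter wraps round to `E 0`.
      chain-after-z : ∀ l s → i ℕ.≤ s → suc s ℕ.+ l ≡ n → Chain (next ρ z (E s) , z) (seg z (suc s) l) (exit , z)
      chain-after-z zero s i≤s eq rewrite next-exit (trans (sym (ℕ.+-identityʳ (suc s))) eq) = []
      chain-after-z (suc l) s i≤s eq = subst (λ e → Chain (e , z) (seg z (suc s) (suc l)) (exit , z)) (sym (next-near s s+1<n))
        (link-≡ (σ-cotree (cotree s+1<n (ℕ.>⇒≢ (s≤s i≤s)))) (chain-after-z l (suc s) (ℕ.m≤n⇒m≤1+n i≤s) eq′))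
        where
        eq′ : suc (suc s) ℕ.+ l ≡ n
        eq′ = trans (sym (ℕ.+-suc (suc s) l)) eq
        s+1<n : suc s ℕ.< n
        s+1<n = subst (suc (suc s) ℕ.≤_) eq′ (ℕ.m≤m+n (suc (suc s)) l)

      chain : Chain (E 0 , z) excursion (exit , z)
      chain = chain-++ (chain-before-z i 0 refl)
        (link-≡ (trans (σ-tree E∈T) (trans (cong (λ x → next ρ x (E i) , x) (far i)) (cong (_, y) (next-far i))))
        (chain-++ (chain-after-y r (suc i) ℕ.≤-refl (sym n≡))
        (chain-++ (chain-before-y i 0 refl)
        (link-≡ (trans (σ-tree E∈T) (cong (λ x → next ρ x (E i) , x) (near i)))
        (chain-after-z r i ℕ.≤-refl (sym n≡))))))

    opaque
      seg⁻ : ∀ {x s} l {h} → h ∈ seg x s l → ∃ λ k → s ℕ.≤ k × k ℕ.< s ℕ.+ l × h ≡ (E k , x)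
      seg⁻ {s = s} (suc l) (here refl) = s , ℕ.≤-refl , ℕ.m<m+n s (s≤s z≤n) , refl
      seg⁻ {s = s} (suc l) (there h∈) with seg⁻ l h∈
      ... | k , s<k , k< , e = k , ℕ.<⇒≤ s<k , subst (k ℕ.<_) (sym (ℕ.+-suc s l)) k< , e

      seg⁺ : ∀ {x} s l {k} → s ℕ.≤ k → k ℕ.< s ℕ.+ l → (E k , x) ∈ seg x s l
      seg⁺ s zero s≤k k< = contradiction (ℕ.≤-<-trans s≤k k<) (subst (λ t → ¬ s ℕ.< t) (sym (ℕ.+-identityʳ s)) (ℕ.n≮n s))
      seg⁺ s (suc l) {k} s≤k k< with ℕ.m≤n⇒m<n∨m≡n s≤k
      ... | inj₁ s<k  = there (seg⁺ (suc s) l s<k (subst (k ℕ.<_) (ℕ.+-suc s l) k<))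
      ... | inj₂ refl = here refl

      excursion⁻ : ∀ {h} → h ∈ excursion → ∃ λ k → k ℕ.< n × (h ≡ (E k , z) ⊎ h ≡ (E k , y))
      excursion⁻ h∈ with ∈-++⁻ (seg z 0 i) h∈
      ... | inj₁ h∈₁ with seg⁻ i h∈₁
      ...   | k , _ , k<i , e = k , ℕ.<-trans k<i i<n , inj₁ e
      excursion⁻ h∈ | inj₂ (here e) = i , i<n , inj₁ e
      excursion⁻ h∈ | inj₂ (there h∈₂) with ∈-++⁻ (seg y (suc i) r) h∈₂
      ... | inj₁ h∈₃ with seg⁻ r h∈₃
      ...   | k , _ , k<n , e = k , subst (k ℕ.<_) (sym n≡) k<n , inj₂ e
      excursion⁻ h∈ | inj₂ (there h∈₂) | inj₂ h∈₄ with ∈-++⁻ (seg y 0 i) h∈₄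
      ... | inj₁ h∈₅ with seg⁻ i h∈₅
      ...   | k , _ , k<i , e = k , ℕ.<-trans k<i i<n , inj₂ e
      excursion⁻ h∈ | inj₂ (there h∈₂) | inj₂ h∈₄ | inj₂ (here e) = i , i<n , inj₂ e
      excursion⁻ h∈ | inj₂ (there h∈₂) | inj₂ h∈₄ | inj₂ (there h∈₆) with seg⁻ r h∈₆
      ...   | k , _ , k<n , e = k , subst (k ℕ.<_) (sym n≡) k<n , inj₁ e

      excursion-z : ∀ {k} → k ℕ.< n → (E k , z) ∈ excursion
      excursion-z {k} k<n with ℕ.<-cmp k i
      ... | tri< k<i _ _  = ∈-++⁺ˡ (seg⁺ 0 i z≤n k<i)
      ... | tri≈ _ refl _ = ∈-++⁺ʳ (seg z 0 i) (here refl)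
      ... | tri> _ _ i<k  = ∈-++⁺ʳ (seg z 0 i) (there (∈-++⁺ʳ (seg y (suc i) r) (∈-++⁺ʳ (seg y 0 i) (there (seg⁺ (suc i) r i<k (subst (k ℕ.<_) n≡ k<n))))))

      excursion-y : ∀ {k} → k ℕ.< n → (E k , y) ∈ excursion
      excursion-y {k} k<n with ℕ.<-cmp k i
      ... | tri< k<i _ _  = ∈-++⁺ʳ (seg z 0 i) (there (∈-++⁺ʳ (seg y (suc i) r) (∈-++⁺ˡ (seg⁺ 0 i z≤n k<i))))
      ... | tri≈ _ refl _ = ∈-++⁺ʳ (seg z 0 i) (there (∈-++⁺ʳ (seg y (suc i) r) (∈-++⁺ʳ (seg y 0 i) (here refl))))
      ... | tri> _ _ i<k  = ∈-++⁺ʳ (seg z 0 i) (there (∈-++⁺ˡ (seg⁺ (suc i) r i<k (subst (k ℕ.<_) n≡ k<n))))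

      seg-avoids-vertex : ∀ {x x′ s k} l → x ≢ x′ → (E k , x) ∉ seg x′ s l
      seg-avoids-vertex l x≢x′ h∈ with seg⁻ l h∈
      ... | _ , _ , _ , e = x≢x′ (cong proj₂ e)

      seg-avoids-edge : ∀ {x x′ s k} l → k ℕ.< n → s ℕ.+ l ℕ.≤ n → (s ℕ.≤ k → s ℕ.+ l ℕ.≤ k) → (E k , x) ∉ seg x′ s l
      seg-avoids-edge {s = s} l k<n s+l≤n avoid h∈ with seg⁻ l h∈
      ... | k′ , s≤k′ , k′< , e with injective k<n (ℕ.<-≤-trans k′< s+l≤n) (cong proj₁ e)
      ... | refl = ℕ.<⇒≱ k′< (avoid s≤k′)

      seg-unique : ∀ x s l → s ℕ.+ l ℕ.≤ n → Unique (seg x s l)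
      seg-unique x s zero    _ = []
      seg-unique x s (suc l) s+l≤n = ∷-unique
        (seg-avoids-edge l (ℕ.<-≤-trans (ℕ.m<m+n s (s≤s z≤n)) s+l≤n) s+1+l≤n (λ s<s → contradiction s<s (ℕ.n≮n s)))
        (seg-unique x (suc s) l s+1+l≤n)
        where
        s+1+l≤n : suc s ℕ.+ l ℕ.≤ n
        s+1+l≤n = subst (ℕ._≤ n) (ℕ.+-suc s l) s+l≤n

      before≤ : 0 ℕ.+ i ℕ.≤ n
      before≤ = ℕ.<⇒≤ i<n

      after≤ : suc i ℕ.+ r ℕ.≤ n
      after≤ = ℕ.≤-reflexive (sym n≡)

      excursion-unique : Unique excursion
      excursion-unique = ++⁺ (seg-unique z 0 i before≤) (∷-unique z∉rest₁ (++⁺ (seg-unique y (suc i) r after≤)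
          (++⁺ (seg-unique y 0 i before≤) (∷-unique (seg-avoids-vertex r y≢z) (seg-unique z (suc i) r after≤)) disjoint₃) disjoint₂)) disjoint₁
        where
        i∉before : ∀ {x x′} → (E i , x) ∉ seg x′ 0 i
        i∉before = seg-avoids-edge i i<n before≤ (λ _ → ℕ.≤-refl)
        i∉after : ∀ {x x′} → (E i , x) ∉ seg x′ (suc i) r
        i∉after = seg-avoids-edge r i<n after≤ (λ i<i → contradiction i<i (ℕ.n≮n i))
        z≢y : z ≢ y
        z≢y e = y≢z (sym e)

        disjoint₃ : ∀ {h} → ¬ (h ∈ seg y 0 i × h ∈ (E i , y) ∷ seg z (suc i) r)
        disjoint₃ (h∈ , here refl) = i∉before h∈
        disjoint₃ (h∈ , there h∈′) with seg⁻ i h∈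
        ... | _ , _ , _ , refl = seg-avoids-vertex r y≢z h∈′

        disjoint₂ : ∀ {h} → ¬ (h ∈ seg y (suc i) r × h ∈ seg y 0 i ++ (E i , y) ∷ seg z (suc i) r)
        disjoint₂ (h∈ , h∈′) with ∈-++⁻ (seg y 0 i) h∈′
        ... | inj₂ (here refl) = i∉after h∈
        ... | inj₁ h∈″ with seg⁻ r h∈
        ...   | k , i<k , k<n , refl = seg-avoids-edge i (ℕ.<-≤-trans k<n after≤) before≤ (λ _ → ℕ.<⇒≤ i<k) h∈″
        disjoint₂ (h∈ , h∈′) | inj₂ (there h∈″) with seg⁻ r h∈
        ...   | _ , _ , _ , refl = seg-avoids-vertex r y≢z h∈″

        z∉rest₁ : (E i , z) ∉ seg y (suc i) r ++ seg y 0 i ++ (E i , y) ∷ seg z (suc i) r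
        z∉rest₁ h∈ with ∈-++⁻ (seg y (suc i) r) h∈
        ... | inj₁ h∈₁ = seg-avoids-vertex r z≢y h∈₁
        ... | inj₂ h∈₂ with ∈-++⁻ (seg y 0 i) h∈₂
        ...   | inj₁ h∈₃         = seg-avoids-vertex i z≢y h∈₃
        ...   | inj₂ (here e)    = z≢y (cong proj₂ e)
        ...   | inj₂ (there h∈₃) = i∉after h∈₃

        disjoint₁ : ∀ {h} → ¬ (h ∈ seg z 0 i × h ∈ (E i , z) ∷ seg y (suc i) r ++ seg y 0 i ++ (E i , y) ∷ seg z (suc i) r)
        disjoint₁ (h∈ , here refl) = i∉before h∈
        disjoint₁ (h∈ , there h∈′) with seg⁻ i h∈
        ... | k , _ , k<i , refl with ∈-++⁻ (seg y (suc i) r) h∈′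
        ...   | inj₁ h∈₁ = seg-avoids-vertex r z≢y h∈₁
        ...   | inj₂ h∈₂ with ∈-++⁻ (seg y 0 i) h∈₂
        ...     | inj₁ h∈₃         = seg-avoids-vertex i z≢y h∈₃
        ...     | inj₂ (here e)    = z≢y (cong proj₂ e)
        ...     | inj₂ (there h∈₃) = seg-avoids-edge r (ℕ.<-trans k<i i<n) after≤ (λ i<k → contradiction i<k (ℕ.<⇒≯ k<i)) h∈₃

    opaque
      placed-new : ∀ f {x x′} s l {hs} → x′ ≢ x → (∀ k → other G (E k) x ≡ x′) →
        (∀ {k} → s ℕ.≤ k → k ℕ.< s ℕ.+ l → E k Sub.∉ T × (E k , x′) ∉ hs) → placed f hs (seg x s l) ≡ + l * f x
      placed-new f {x} s zero x′≢x opp new = sym (ℤ.*-zeroˡ (f x))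
      placed-new f {x} {x′} s (suc l) {hs} x′≢x opp new = trans
        (cong₂ _+_ (value-new f hs (proj₁ (new ℕ.≤-refl s<)) (subst (λ y → (E s , y) ∉ hs) (sym (opp s)) (proj₂ (new ℕ.≤-refl s<))))
          (placed-new f (suc s) l x′≢x opp (λ {k} s<k k< →
            let ∉T , ∉hs = new (ℕ.<⇒≤ s<k) (subst (k ℕ.<_) (sym (ℕ.+-suc s l)) k<)
            in ∉T , λ { (here e) → x′≢x (cong proj₂ e) ; (there h∈) → ∉hs h∈ })))
        (lem (+ l) (f x))
        where
        s< : s ℕ.< s ℕ.+ suc l
        s< = ℕ.m<m+n s (s≤s z≤n)
        lem : ∀ l x → x + l * x ≡ (1ℤ + l) * x
        lem = solve-∀

      placed-old : ∀ f {x x′} s l {hs} → (∀ k → other G (E k) x ≡ x′) →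
        (∀ {k} → s ℕ.≤ k → k ℕ.< s ℕ.+ l → (E k , x′) ∈ hs) → placed f hs (seg x s l) ≡ 0ℤ
      placed-old f s zero opp old = refl
      placed-old f {x} {x′} s (suc l) {hs} opp old = cong₂ _+_
        (value-old f hs (subst (λ y → (E s , y) ∈ hs) (sym (opp s)) (old ℕ.≤-refl (ℕ.m<m+n s (s≤s z≤n)))))
        (placed-old f (suc s) l opp (λ {k} s<k k< → there (old (ℕ.<⇒≤ s<k) (subst (k ℕ.<_) (sym (ℕ.+-suc s l)) k<))))

      -- The i edges before the tree edge are first met at `z`, the r edges after it are first met
      -- at `y`; their second half-edges and the tree edge place nothing.
      placed-excursion : ∀ f hs → (∀ k x → (E k , x) ∉ hs) → placed f hs excursion ≡ + i * f z + + r * f y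
      placed-excursion f hs none = begin
        placed f hs excursion
          ≡⟨ placed-++ f hs (seg z 0 i) _ ⟩
        placed f hs (seg z 0 i) + (value f hs₁ (E i , z) + placed f hs₂ (seg y (suc i) r ++ seg y 0 i ++ (E i , y) ∷ seg z (suc i) r))
          ≡⟨ cong₂ _+_ before-z (cong₂ _+_ (value-tree f hs₁ E∈T) (placed-++ f hs₂ (seg y (suc i) r) _)) ⟩
        + i * f z + (0ℤ + (placed f hs₂ (seg y (suc i) r) + placed f hs₃ (seg y 0 i ++ (E i , y) ∷ seg z (suc i) r)))
          ≡⟨ cong (λ c → + i * f z + (0ℤ + c)) (cong₂ _+_ after-y (placed-++ f hs₃ (seg y 0 i) _)) ⟩
        + i * f z + (0ℤ + (+ r * f y + (placed f hs₃ (seg y 0 i) + (value f hs₄ (E i , y) + placed f hs₅ (seg z (suc i) r)))))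
          ≡⟨ cong (λ c → + i * f z + (0ℤ + (+ r * f y + c))) (cong₂ _+_ before-y (cong₂ _+_ (value-tree f hs₄ E∈T) after-z)) ⟩
        + i * f z + (0ℤ + (+ r * f y + (0ℤ + (0ℤ + 0ℤ))))
          ≡⟨ lem (+ i * f z) (+ r * f y) ⟩
        + i * f z + + r * f y ∎
        where
        open ≡-Reasoning
        lem : ∀ x y → x + (0ℤ + (y + (0ℤ + (0ℤ + 0ℤ)))) ≡ x + y
        lem = solve-∀
        hs₁ hs₂ hs₃ hs₄ hs₅ : List H
        hs₁ = seg z 0 i ʳ++ hs
        hs₂ = (E i , z) ∷ hs₁
        hs₃ = seg y (suc i) r ʳ++ hs₂
        hs₄ = seg y 0 i ʳ++ hs₃
        hs₅ = (E i , y) ∷ hs₄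
        before-z : placed f hs (seg z 0 i) ≡ + i * f z
        before-z = placed-new f 0 i y≢z far (λ {k} _ k<i → cotree (ℕ.<-trans k<i i<n) (ℕ.<⇒≢ k<i) , none k y)
        after-y : placed f hs₂ (seg y (suc i) r) ≡ + r * f y
        after-y = placed-new f (suc i) r (λ e → y≢z (sym e)) near new
          where
          new : ∀ {k} → suc i ℕ.≤ k → k ℕ.< suc i ℕ.+ r → E k Sub.∉ T × (E k , z) ∉ hs₂
          new {k} i<k k< = cotree k<n (ℕ.>⇒≢ i<k) , unseen
            where
            k<n : k ℕ.< n
            k<n = ℕ.<-≤-trans k< after≤
            unseen : (E k , z) ∉ hs₂
            unseen (here e) = ℕ.>⇒≢ i<k (injective k<n i<n (cong proj₁ e))
            unseen (there h∈) with ∈-ʳ++⁻ (seg z 0 i) h∈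
            ... | inj₁ h∈₁ = seg-avoids-edge i k<n before≤ (λ _ → ℕ.<⇒≤ i<k) h∈₁
            ... | inj₂ h∈₂ = none k z h∈₂
        before-y : placed f hs₃ (seg y 0 i) ≡ 0ℤ
        before-y = placed-old f 0 i near (λ _ k<i → ∈-ʳ++⁺ˡ (seg y (suc i) r) (there (∈-ʳ++⁺ʳ (seg z 0 i) (seg⁺ 0 i z≤n k<i))))
        after-z : placed f hs₅ (seg z (suc i) r) ≡ 0ℤ
        after-z = placed-old f (suc i) r far (λ i<k k< → there (∈-ʳ++⁺ˡ (seg y 0 i) (∈-ʳ++⁺ʳ (seg y (suc i) r) (seg⁺ (suc i) r i<k k<))))

  -- For the start (`C 0`, `z`) the divisor has class -p - q minus the label. Moving the start to
  -- `v` adds 2 i p, which vanishes; moving it to `w` adds 2 j q, which reverses the sign of j q,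
  -- and -i p may be read as i p.
  tourSign : Fin 3 → ℤ
  tourSign 0F = -1ℤ
  tourSign 1F = -1ℤ
  tourSign 2F = 1ℤ

  -- The Bernardi action as a translation of labels.

  module BernardiTorsor (a′ b′ : ℕ) (ρ : Ribbon (twoBundles (suc a′) (suc b′))) (nf : TwoBundles.NormalForm a′ b′ ρ)
                        (M : ℤ) (character : Character (suc a′) (suc b′) M) where
    open Turning a′ b′ ρ nf M character

    module _ {T : Subset m} {i j : ℕ} (S : Shape T i j) where
      open Shape S
      open Touring ρ T

      private
        r s : ℕ
        r = a′ ℕ.∸ i
        s = b′ ℕ.∸ j

        a≡ : a ≡ suc (i ℕ.+ r)
        a≡ = cong suc (sym (ℕ.m+[n∸m]≡n (ℕ.≤-pred i<a)))

        b≡ : b ≡ suc (j ℕ.+ s)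
        b≡ = cong suc (sym (ℕ.m+[n∸m]≡n (ℕ.≤-pred j<b)))

        only-C : ∀ {k} → k ℕ.< a → C k Sub.∈ T → k ≡ i
        only-C k<a ∈T = [ CB.injective k<a i<a , (λ e → contradiction e C≢F) ]′ (only ∈T)

        only-F : ∀ {k} → k ℕ.< b → F k Sub.∈ T → k ≡ j
        only-F k<b ∈T = [ (λ e → contradiction (sym e) C≢F) , FB.injective k<b j<b ]′ (only ∈T)

        exit-C : ∀ {k} → suc k ≡ a → next ρ z (C k) ≡ F 0
        exit-C refl = next-CF

        exit-F : ∀ {k} → suc k ≡ b → next ρ z (F k) ≡ C 0
        exit-F refl = next-FC

        module XC = Excursion a′ b′ ρ C-bundle (λ ()) T a≡ C∈ only-C (F 0) exit-C
        module XF = Excursion a′ b′ ρ F-bundle (λ ()) T b≡ F∈ only-F (C 0) exit-F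

      circuit : List H
      circuit = XC.excursion ++ XF.excursion

      opaque
        circuit-chain : Chain (C 0 , z) circuit (C 0 , z)
        circuit-chain = chain-++ XC.chain XF.chain

        circuit⁻ : ∀ {h} → h ∈ circuit → Incident G (proj₁ h) (proj₂ h) × opposite (opposite h) ≡ h × opposite h ∈ circuit × opposite h ≢ h
        circuit⁻ h∈ with ∈-++⁻ XC.excursion h∈
        ... | inj₁ h∈C with XC.excursion⁻ h∈C
        ...   | k , k<a , inj₁ refl rewrite CB.far k | CB.near k = at-z (C k) , refl , ∈-++⁺ˡ (XC.excursion-y k<a) , λ ()
        ...   | k , k<a , inj₂ refl rewrite CB.near k | CB.far k = CB.incident k , refl , ∈-++⁺ˡ (XC.excursion-z k<a) , λ ()
        circuit⁻ h∈ | inj₂ h∈F with XF.excursion⁻ h∈F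
        ...   | k , k<b , inj₁ refl rewrite FB.far k | FB.near k = at-z (F k) , refl , ∈-++⁺ʳ XC.excursion (XF.excursion-y k<b) , λ ()
        ...   | k , k<b , inj₂ refl rewrite FB.near k | FB.far k = FB.incident k , refl , ∈-++⁺ʳ XC.excursion (XF.excursion-z k<b) , λ ()

        circuit⁺ : ∀ {e} y → Incident G e y → (e , y) ∈ circuit
        circuit⁺ {e} 0F inc with CB.surjective {e} inc
        ... | k , k<a , refl = ∈-++⁺ˡ (XC.excursion-y k<a)
        circuit⁺ {e} 2F inc with FB.surjective {e} inc
        ... | k , k<b , refl = ∈-++⁺ʳ XC.excursion (XF.excursion-y k<b)
        circuit⁺ {e} 1F inc with C-or-F e
        ... | inj₁ (k , k<a , refl) = ∈-++⁺ˡ (XC.excursion-z k<a)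
        ... | inj₂ (k , k<b , refl) = ∈-++⁺ʳ XC.excursion (XF.excursion-z k<b)

        XC-only-C : ∀ k x → (F k , x) ∉ XC.excursion
        XC-only-C k x h∈ with XC.excursion⁻ h∈
        ... | _ , _ , inj₁ e = C≢F (sym (cong proj₁ e))
        ... | _ , _ , inj₂ e = C≢F (sym (cong proj₁ e))

        circuit-complete : Complete circuit
        circuit-complete = record
          { unique = ++⁺ XC.excursion-unique XF.excursion-unique disjoint
          ; involutive = λ h∈ → proj₁ (proj₂ (circuit⁻ h∈))
          ; closed = λ h∈ → proj₁ (proj₂ (proj₂ (circuit⁻ h∈)))
          ; proper = λ h∈ → proj₂ (proj₂ (proj₂ (circuit⁻ h∈)))
          }
          where
          disjoint : ∀ {h} → ¬ (h ∈ XC.excursion × h ∈ XF.excursion)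
          disjoint (h∈C , h∈F) with XF.excursion⁻ h∈F
          ... | k , _ , inj₁ refl = XC-only-C k z h∈C
          ... | k , _ , inj₂ refl = XC-only-C k w h∈C

        placed-circuit : ∀ f → placed f [] circuit ≡ (+ i * f z + + r * f v) + (+ j * f z + + s * f w)
        placed-circuit f = trans (placed-++ f [] XC.excursion XF.excursion) (cong₂ _+_
          (XC.placed-excursion f [] (λ _ _ ()))
          (XF.placed-excursion f (XC.excursion ʳ++ []) (λ k x h∈ →
            [ XC-only-C k x , (λ ()) ]′ (∈-ʳ++⁻ XC.excursion h∈))))

      -- The chips placed by the tour starting at h, compared with the start (C 0 , z).
      shift : H → ℤ
      shift (e , 0F) = + i * (p + p) + p - turn e
      shift (e , 1F) = turn e
      shift (e , 2F) = + j * (q + q) + q - turn e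

      opaque
        -- Off the tree both sides change by the charge of the edge at `z`, and by minus the
        -- potential of the vertex at `v` and `w`. A tree edge must not change `shift`, and this
        -- determines the constants: arriving at `v` after `C i` gives 2 i p + p - (i p + p) = i p,
        -- the value at `C i` before crossing.
        shift-σ : ∀ e y → Incident G e y → shift (σ (e , y)) ≈ shift (e , y) + change potential (e , y)
        shift-σ e y inc = cases (e ∈? T) y inc
          where
          keep : ∀ {x y c} → c ≡ 0ℤ → x ≈ y → x ≈ y + c
          keep {y = y} refl e = ≈-trans e (≡⇒≈ (sym (ℤ.+-identityʳ y)))
          lem-in : ∀ i p → i * (p + p) + p - (i * p + p) ≡ i * p
          lem-in = solve-∀
          lem-out : ∀ i p → i * p + p ≡ i * (p + p) + p - i * p
          lem-out = solve-∀
          lem-z : ∀ x c → x + c ≡ x + (c - 0ℤ)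
          lem-z = solve-∀
          lem-y : ∀ x t p → x - (t + p) ≡ x - t + (0ℤ - p)
          lem-y = solve-∀
          minus : ∀ x {y y′} → y ≈ y′ → x - y ≈ x - y′
          minus x {y} {y′} e = +-congˡ x (≈-trans (≡⇒≈ (sym (ℤ.-1*i≡-i y))) (≈-trans (*-cong -1ℤ e) (≡⇒≈ (ℤ.-1*i≡-i y′))))
          σ-tree-to : ∀ {e x x′} → e Sub.∈ T → other G e x ≡ x′ → σ (e , x) ≡ (next ρ x′ e , x′)
          σ-tree-to {e} ∈T refl = σ-tree ∈T

          cases : Dec (e Sub.∈ T) → ∀ y → Incident G e y → shift (σ (e , y)) ≈ shift (e , y) + change potential (e , y)
          cases (no ∉T) 1F inc rewrite σ-cotree {e} {z} ∉T | change-cotree potential {e} {z} ∉T | charge-other e =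
            ≈-trans (turn-next-z e) (≡⇒≈ (lem-z (turn e) (charge e)))
          cases (no ∉T) 0F inc rewrite σ-cotree {e} {v} ∉T | change-cotree potential {e} {v} ∉T | near-v {e} inc =
            ≈-trans (minus (+ i * (p + p) + p) (turn-next-v {e} inc)) (≡⇒≈ (lem-y (+ i * (p + p) + p) (turn e) p))
          cases (no ∉T) 2F inc rewrite σ-cotree {e} {w} ∉T | change-cotree potential {e} {w} ∉T | near-w {e} inc =
            ≈-trans (minus (+ j * (q + q) + q) (turn-next-w {e} inc)) (≡⇒≈ (lem-y (+ j * (q + q) + q) (turn e) q))
          cases (yes ∈T) y inc = keep (change-tree potential {e} {y} ∈T) (on-tree (only ∈T) y inc)
            where
            on-tree : e ≡ C i ⊎ e ≡ F j → ∀ y → Incident G e y → shift (σ (e , y)) ≈ shift (e , y)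
            on-tree (inj₁ refl) 1F inc rewrite σ-tree-to {C i} {z} ∈T (CB.far i) = ≈-trans
              (minus (+ i * (p + p) + p) (≈-trans (turn-next-v {C i} (CB.incident i)) (≡⇒≈ (cong (_+ p) (turn-C i<a)))))
              (≡⇒≈ (trans (lem-in (+ i) p) (sym (turn-C i<a))))
            on-tree (inj₂ refl) 1F inc rewrite σ-tree-to {F j} {z} ∈T (FB.far j) = ≈-trans
              (minus (+ j * (q + q) + q) (≈-trans (turn-next-w {F j} (FB.incident j)) (≡⇒≈ (cong (_+ q) (turn-F j<b)))))
              (≡⇒≈ (trans (lem-in (+ j) q) (sym (turn-F j<b))))
            on-tree (inj₁ refl) 0F inc rewrite σ-tree-to {C i} {v} ∈T (CB.near i) = ≈-trans (turn-next-z (C i))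
              (≡⇒≈ (trans (cong₂ _+_ (turn-C i<a) (charge-C i)) (trans (lem-out (+ i) p) (cong (λ t → + i * (p + p) + p - t) (sym (turn-C i<a))))))
            on-tree (inj₂ refl) 2F inc rewrite σ-tree-to {F j} {w} ∈T (FB.near j) = ≈-trans (turn-next-z (F j))
              (≡⇒≈ (trans (cong₂ _+_ (turn-F j<b) (charge-F j)) (trans (lem-out (+ j) q) (cong (λ t → + j * (q + q) + q - t) (sym (turn-F j<b))))))
            on-tree (inj₁ refl) 2F inc with FB.surjective {C i} inc
            ... | _ , _ , e = contradiction e C≢F
            on-tree (inj₂ refl) 0F inc with CB.surjective {F j} inc
            ... | _ , _ , e = contradiction (sym e) C≢F

        shift-chain : ∀ {h l h′} → Chain h l h′ → (∀ {e y} → (e , y) ∈ l → Incident G e y) →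
          shift h′ ≈ shift h + changes potential l
        shift-chain {h} [] _ = ≡⇒≈ (sym (ℤ.+-identityʳ (shift h)))
        shift-chain {h = h@(e , y)} (link {l = l} c) inc = ≈-trans (shift-chain c (λ h∈ → inc (there h∈)))
          (≈-trans (+-congʳ (changes potential l) (shift-σ e y (inc (here refl)))) (≡⇒≈ (ℤ.+-assoc (shift h) (change potential h) (changes potential l))))

      opaque
        -- The stretch `l` of the circuit from (`C 0`, `z`) to the desired start is moved to the
        -- end. Its changes telescope to a difference of `shift`, whose value at (`C 0`, `z`) is 0.
        -- The degree a′ + b′ is |E| - |V| + 1.
        tour-divisor : ∀ e₀ u → Incident G e₀ u → ∃ λ D → Tour ρ T (e₀ , u) [] (e₀ , u) (const 0ℤ) D
          × degree D ≡ + a′ + + b′ × χ D ≈ (+ r * p + + s * q) + shift (e₀ , u)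
        tour-divisor e₀ u inc with ∈-∃++ (circuit⁺ {e₀} u inc)
        ... | l , l′ , eq with chain-split l (subst (λ l → Chain (C 0 , z) l (C 0 , z)) eq circuit-chain)
        ... | c₁ , c₂ = go (chain-++ c₂ c₁)
          where
          rotated : ∀ f → placed f [] ((e₀ , u) ∷ l′ ++ l) ≡ placed f [] (l ++ (e₀ , u) ∷ l′) + changes f l × Complete ((e₀ , u) ∷ l′ ++ l)
          rotated f = placed-rotate f l ((e₀ , u) ∷ l′) (subst Complete eq circuit-complete)

          go : Chain (e₀ , u) ((e₀ , u) ∷ l′ ++ l) (e₀ , u) → ∃ λ D → Tour ρ T (e₀ , u) [] (e₀ , u) (const 0ℤ) D
            × degree D ≡ + a′ + + b′ × χ D ≈ (+ r * p + + s * q) + shift (e₀ , u)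
          go (link c) with tour (l′ ++ l) {hs = []} {D = const 0ℤ} c (Unique[x∷xs]⇒x∉xs (Complete.unique (proj₂ (rotated potential))))
          ... | D , t , pairing = D , t , degree-D , χ-D
            where
            total : ∀ f → ⟪ f , D ⟫ ≡ (+ i * f z + + r * f v) + (+ j * f z + + s * f w) + changes f l
            total f = trans (pairing f) (trans (cong (_+ placed f [] ((e₀ , u) ∷ l′ ++ l)) (⟪⟫-0 f)) (trans (ℤ.+-identityˡ _)
              (trans (proj₁ (rotated f)) (cong (_+ changes f l) (trans (cong (placed f []) (sym eq)) (placed-circuit f))))))

            degree-D : degree D ≡ + a′ + + b′
            degree-D = trans (degree-⟪⟫ D) (trans (total (const 1ℤ)) (trans
              (cong (λ c → (+ i * 1ℤ + + r * 1ℤ) + (+ j * 1ℤ + + s * 1ℤ) + c) (changes-constant 1ℤ l))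
              (trans (lem (+ i) (+ r) (+ j) (+ s)) (cong₂ (λ x y → + x + + y) (sym (ℕ.suc-injective a≡)) (sym (ℕ.suc-injective b≡))))))
              where
              lem : ∀ i r j s → (i * 1ℤ + r * 1ℤ) + (j * 1ℤ + s * 1ℤ) + 0ℤ ≡ (i + r) + (j + s)
              lem = solve-∀

            χ-D : χ D ≈ (+ r * p + + s * q) + shift (e₀ , u)
            χ-D = ≈-trans (≡⇒≈ (trans (total potential) (lem (+ i) (+ r) (+ j) (+ s) p q (changes potential l))))
              (+-congˡ (+ r * p + + s * q) (≈-sym (≈-trans (shift-chain c₁ incident-l) (≡⇒≈ (trans (cong (_+ changes potential l) (turn-C {0} (s≤s z≤n))) (ℤ.+-identityˡ (changes potential l)))))))
              where
              lem : ∀ i r j s p q c → (i * 0ℤ + r * p) + (j * 0ℤ + s * q) + c ≡ (r * p + s * q) + c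
              lem = solve-∀
              incident-l : ∀ {e y} → (e , y) ∈ l → Incident G e y
              incident-l h∈ = proj₁ (circuit⁻ (subst (_ ∈_) (sym eq) (∈-++⁺ˡ h∈)))

        -- From 1 + i + r = a and ap vanishing, r p is -p - i p; likewise for s q. This is where the
        -- label enters the class of the divisor.
        remaining : + r * p + + s * q ≈ - p - q - t i j
        remaining = ≈-by (+-≈0 (subst (λ n → + n * p ≈ 0ℤ) a≡ ap≈0) (subst (λ n → + n * q ≈ 0ℤ) b≡ bq≈0))
          (lem (+ i) (+ r) (+ j) (+ s) p q)
          where
          lem : ∀ i r j s p q → r * p + s * q ≡ - p - q - (i * p + j * q) + ((1ℤ + (i + r)) * p + (1ℤ + (j + s)) * q)
          lem = solve-∀

    offset : Fin 3 → Edge → ℤ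
    offset 0F e = - turn e - q
    offset 1F e = turn e - p - q
    offset 2F e = turn e + p

    opaque
      tour-label : ∀ u e {i j} {T : Subset m} (S : Shape T i j) {x} → x ≈ (- p - q - t i j) + shift S (e , u) →
        t i j ≈ tourSign u * x + offset u e
      tour-label u e {i} {j} S {x} eq = ≈-trans (by u) (+-congʳ (offset u e) (*-cong (tourSign u) (≈-sym eq)))
        where
        by : ∀ u → t i j ≈ tourSign u * ((- p - q - t i j) + shift S (e , u)) + offset u e
        by 0F = ≈-by (*-≈0 (+ i) 2p≈0) (lem (+ i) (+ j) p q (turn e))
          where
          lem : ∀ i j p q t → i * p + j * q ≡ -1ℤ * ((- p - q - (i * p + j * q)) + (i * (p + p) + p - t)) + (- t - q) + i * (p + p)
          lem = solve-∀
        by 1F = ≡⇒≈ (lem (+ i) (+ j) p q (turn e))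
          where
          lem : ∀ i j p q t → i * p + j * q ≡ -1ℤ * ((- p - q - (i * p + j * q)) + t) + (t - p - q)
          lem = solve-∀
        by 2F = ≈-by (*-≈0 (+ i) 2p≈0) (lem (+ i) (+ j) p q (turn e))
          where
          lem : ∀ i j p q t → i * p + j * q ≡ 1ℤ * ((- p - q - (i * p + j * q)) + (j * (q + q) + q - t)) + (t + p) + i * (p + p)
          lem = solve-∀

      bernardi-divisor : ∀ u e₀ → Incident G e₀ u → ∀ T → ∃ λ D → BernardiDivisor ρ u e₀ T D
        × degree D ≡ + a′ + + b′ × label T ≈ tourSign u * χ D + offset u e₀
      bernardi-divisor u e₀ inc T = from (proj₂ (proj₂ (shape T)))
        where
        from : ∀ {i j} → Shape (edges {G = G} T) i j → ∃ λ D → BernardiDivisor ρ u e₀ T D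
          × degree D ≡ + a′ + + b′ × label T ≈ tourSign u * χ D + offset u e₀
        from S with tour-divisor S e₀ u inc
        ... | D , t , deg , eq = D , t , deg , ≈-trans (≡⇒≈ (label-shape {T} S))
          (tour-label u e₀ S (≈-trans eq (+-congʳ (shift S (e₀ , u)) (remaining S))))

    opaque
      tourSign² : ∀ u x → tourSign u * (tourSign u * x) ≡ x
      tourSign² 0F x = lem x
        where
        lem : ∀ x → -1ℤ * (-1ℤ * x) ≡ x
        lem = solve-∀
      tourSign² 1F x = lem x
        where
        lem : ∀ x → -1ℤ * (-1ℤ * x) ≡ x
        lem = solve-∀
      tourSign² 2F x = lem x
        where
        lem : ∀ x → 1ℤ * (1ℤ * x) ≡ x
        lem = solve-∀

      -- `offset` depends on the start but not on the tree, so it cancels between `T` and `T′`.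
      -- Multiplying by the sign a second time recovers the congruence of χ, and equal degrees turn
      -- it into equivalence of the divisors.
      bernardi-exact : ∀ u e₀ → Incident G e₀ u → Exact (Bernardi ρ u e₀) (tourSign u)
      bernardi-exact u e₀ inc S T T′ = compare (bernardi-divisor u e₀ inc T) (bernardi-divisor u e₀ inc T′)
        where
        Placed : SpanningTree G → Set
        Placed T = ∃ λ D → BernardiDivisor ρ u e₀ T D × degree D ≡ + a′ + + b′ × label T ≈ tourSign u * χ D + offset u e₀

        sgn : ℤ
        sgn = tourSign u

        compare : Placed T → Placed T′ → Bernardi ρ u e₀ S T T′ ⇔ (label T′ ≈ label T + sgn * χ (proj₁ S))
        compare (D , t , deg , eq) (D′ , t′ , deg′ , eq′) = mk⇔ to from
          where
          χ-sum : χ (D ⊕ proj₁ S) ≡ χ D + χ (proj₁ S)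
          χ-sum = ⟪⟫-⊕ potential D (proj₁ S)
          lem : ∀ e d s o → e * (d + s) + o ≡ (e * d + o) + e * s
          lem = solve-∀
          lem′ : ∀ e d s o → (e * d + o) + e * s - o ≡ e * (d + s)
          lem′ = solve-∀
          cancel : ∀ x o → x ≡ (x + o) - o
          cancel = solve-∀

          to : Bernardi ρ u e₀ S T T′ → label T′ ≈ label T + sgn * χ (proj₁ S)
          to b = ≈-trans eq′ (≈-trans (+-congʳ (offset u e₀) (*-cong sgn (≈-trans (≈-sym moved) (≡⇒≈ χ-sum))))
            (≈-trans (≡⇒≈ (lem sgn (χ D) (χ (proj₁ S)) (offset u e₀))) (+-congʳ (sgn * χ (proj₁ S)) (≈-sym eq))))
            where
            open Bernardi b
            moved : χ (D ⊕ proj₁ S) ≈ χ D′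
            moved = subst₂ (λ D D′ → χ (D ⊕ proj₁ S) ≈ χ D′)
              (Touring.tour-unique ρ (edges {G = G} T) bernardi t) (Touring.tour-unique ρ (edges {G = G} T′) bernardi′ t′)
              (χ-sound {divisor′} {divisor ⊕ proj₁ S} equivalent)

          from : label T′ ≈ label T + sgn * χ (proj₁ S) → Bernardi ρ u e₀ S T T′
          from e = record { bernardi = t ; bernardi′ = t′ ; equivalent = χ-complete {D′} {D ⊕ proj₁ S} degrees (≈-trans (≡⇒≈ χ-sum) (≈-sym same)) }
            where
            degrees : degree (D ⊕ proj₁ S) ≡ degree D′
            degrees = trans (degree-⟪⟫ (D ⊕ proj₁ S)) (trans (⟪⟫-⊕ (const 1ℤ) D (proj₁ S))
              (trans (cong₂ _+_ (trans (sym (degree-⟪⟫ D)) deg) (trans (sym (degree-⟪⟫ (proj₁ S))) (proj₂ S)))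
                (trans (ℤ.+-identityʳ _) (sym deg′))))
            scaled : sgn * χ D′ ≈ sgn * (χ D + χ (proj₁ S))
            scaled = ≈-trans (≡⇒≈ (cancel (sgn * χ D′) (offset u e₀)))
              (≈-trans (+-congʳ (- offset u e₀) (≈-trans (≈-sym eq′) (≈-trans e (+-congʳ (sgn * χ (proj₁ S)) eq))))
                (≡⇒≈ (lem′ sgn (χ D) (χ (proj₁ S)) (offset u e₀))))
            same : χ D′ ≈ χ D + χ (proj₁ S)
            same = ≈-trans (≡⇒≈ (sym (tourSign² u (χ D′)))) (≈-trans (*-cong sgn scaled) (≡⇒≈ (tourSign² u (χ D + χ (proj₁ S)))))

-- Euler characteristics, and the comparison of the two given graphs.

open import Data.Nat.Base using (_*_)

-- With three vertices and two faces, genus h means 3 + 2h edges. Indeed 2 + x = 3 + 2g, and 1 + 2x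
-- = 3 + 2 (2g).
genus-formula : ∀ x → ℤ.+ 2 ℤ.* x ≡ ℤ.+ 2 ℤ.- ℤ.+ 3 ℤ.+ (ℤ.+ 3 ℤ.+ ℤ.+ 2 ℤ.* x) ℤ.- ℤ.+ 2
genus-formula = solve-∀

theorem3p7 : (g : ℕ) → .{{_ : NonZero g}} →
    let x  = suc (2 * g)
        G  = twoBundles 2 x
        G′ = twoBundles 1 (2 * x)
    in
    (ρ : Ribbon G) (ρ′ : Ribbon G′) →
    Consecutive (next ρ z) (vz 2 x 0F) (vz 2 x 1F) →
    RestrictsTo (IsZW 2 x) (next ρ z) (next ρ w) →
    RestrictsTo (IsZW 1 (2 * x)) (next ρ′ z) (next ρ′ w) →
    (Pic⁰ G ≅ Pic⁰ G′)
    × Property1 G G′ Vgen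
    × Property2 G G′ Vgen
    × (Σ[ γ̂ ∈ (AbelianGroup.Carrier (Pic⁰ G) → AbelianGroup.Carrier (Pic⁰ G′)) ]
    InducedByIdentity G G′ Vgen γ̂
    × IsIsomorphism (Pic⁰ G) (Pic⁰ G′) γ̂
    × (Σ[ φ ∈ Bijection (𝒯 G) (𝒯 G′) ]
    (∀ u →
    Intertwines G G′ γ̂ (Bijection.to φ) (RotorRouting ρ u) (RotorRouting ρ′ u)
    × (∀ e₀ e₀′ → Incident G e₀ u → Incident G′ e₀′ u →
    Intertwines G G′ γ̂ (Bijection.to φ) (Bernardi ρ u e₀) (Bernardi ρ′ u e₀′)))))
    × HasGenus ρ g
    × HasGenus ρ′ (2 * g)
theorem3p7 g ρ ρ′ consecutive same same′ =
    (γ̂ , γ̂-isomorphism)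
  , property₁
  , property₂
  , (γ̂ , γ̂-induced , γ̂-isomorphism , φ-bijection , λ u →
      intertwines (rotorSign u) (RotorRoutingExact.rotor-exact 1 (2 * g) ρ nf M χ u) (RotorRoutingExact.rotor-exact 0 b′ ρ′ nf′ M χ′ u)
    , λ e₀ e₀′ inc inc′ → intertwines (tourSign u)
        (BernardiTorsor.bernardi-exact 1 (2 * g) ρ nf M χ u e₀ inc) (BernardiTorsor.bernardi-exact 0 b′ ρ′ nf′ M χ′ u e₀′ inc′))
  -- The second bundle has odd size x here and even size 2x in the next component. Both parities
  -- lead to two faces, so the genera differ only through the numbers of edges.
  , (2 , Faces.two-cycles 1 (2 * g) ρ nf (TwoEdgeFaces.two-faces (2 * g) (parity-even g) ρ nf) , genus)
  , (2 , Faces.two-cycles 0 b′ ρ′ nf′ (OneEdgeFaces.two-faces b′ (parity-even x) ρ′ nf′) , genus′)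
  where
  x b′ : ℕ
  x = suc (2 * g)
  b′ = ℕ.pred (2 * x)

  M : ℤ
  M = ℤ.+ 2 ℤ.* ℤ.+ x

  nf : TwoBundles.NormalForm 1 (2 * g) ρ
  nf = normalForm₂ (2 * g) ρ consecutive same

  nf′ : TwoBundles.NormalForm 0 b′ ρ′
  nf′ = normalForm₁ b′ ρ′ same′

  χ : Character 2 x M
  χ = character₂ g

  χ′ : Character 1 (2 * x) M
  χ′ = character₁ x

  open Compare (Labels.labelling 1 (2 * g) ρ nf M χ) (Labels.labelling 0 b′ ρ′ nf′ M χ′)

  genus : ℤ.+ 2 ℤ.* ℤ.+ g ≡ ℤ.+ 2 ℤ.- ℤ.+ 3 ℤ.+ ℤ.+ (2 ℕ.+ x) ℤ.- ℤ.+ 2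
  genus = trans (genus-formula (ℤ.+ g)) (cong (λ m → ℤ.+ 2 ℤ.- ℤ.+ 3 ℤ.+ m ℤ.- ℤ.+ 2) (cong (λ y → ℤ.+ 3 ℤ.+ y) (sym (double g))))

  genus′ : ℤ.+ 2 ℤ.* ℤ.+ (2 * g) ≡ ℤ.+ 2 ℤ.- ℤ.+ 3 ℤ.+ ℤ.+ (1 ℕ.+ 2 * x) ℤ.- ℤ.+ 2
  genus′ = trans (genus-formula (ℤ.+ (2 * g))) (cong (λ m → ℤ.+ 2 ℤ.- ℤ.+ 3 ℤ.+ m ℤ.- ℤ.+ 2) (trans (lem (ℤ.+ (2 * g)))
    (cong (λ y → ℤ.+ 1 ℤ.+ y) (sym (double x)))))
    where
    lem : ∀ y → ℤ.+ 3 ℤ.+ ℤ.+ 2 ℤ.* y ≡ ℤ.+ 1 ℤ.+ ℤ.+ 2 ℤ.* (ℤ.+ 1 ℤ.+ y)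
    lem = solve-∀
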